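{- Let $n=3M$, let $f(X_1,\dots,X_n)$ be the logical formula in Laurent form associated with a CNF formula with $M$ clauses of three literals each, and let $C$ be its constant term. For $1\le j\le n$ let $$a_j=\sin(n^2+j),\quad b_j=\sin\Bigl((n^2+j)\bigl(1+\tfrac{\pi}{2}\tfrac{1}{n^2+1}\bigr)\Bigr),\quad c_j=\sin\Bigl((n^2+j)\bigl(1+\tfrac{3\pi}{n^2+1}\bigr)\Bigr),$$ $$d_j=\sin\Bigl((n^2+j)\bigl(1+\tfrac{3\pi}{n^2+1}+\tfrac{\pi}{2}\tfrac{1}{n^2+1}\bigr)\Bigr),$$ with frequencies $A_k,B_k,C_k,D_k$ and integerized frequencies $z'(A_k),z'(B_k),z'(C_k),z'(D_k)$ ($1\le k\le3^n-1$). If a positive integer $l$ is greater than the integerized maximal maximum frequency $\max_{1\le k\le 3^n-1}\{\max\{|z'(A_k)|,|z'(B_k)|,|z'(C_k)|,|z'(D_k)|\}\}$, then $$\sum_{m_1=1}^{l}\sum_{m_2=1}^{l}\sum_{m_3=1}^{l}\sum_{m_4=1}^{l}\exp\Bigl(i\tfrac{2\pi z'(A_k)}{l}m_1\Bigr)\exp\Bigl(i\tfrac{2\pi z'(B_k)}{l}m_2\Bigr)\exp\Bigl(i\tfrac{2\pi z'(C_k)}{l}m_3\Bigr)\exp\Bigl(i\tfrac{2\pi z'(D_k)}{l}m_4\Bigr)=0$$ for all $k$, and $$\sum_{m_1=1}^{l}\sum_{m_2=1}^{l}\sum_{m_3=1}^{l}\sum_{m_4=1}^{l}f=l^4C,$$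 where in the $(m_1,m_2,m_3,m_4)$-th summand $f$ is evaluated at $X_j=\exp\bigl(i(z'(a_j)x+z'(b_j)y+z'(c_j)z+z'(d_j)w)\bigr)$ with $x=\frac{2\pi}{l}m_1$, $y=\frac{2\pi}{l}m_2$, $z=\frac{2\pi}{l}m_3$, $w=\frac{2\pi}{l}m_4$.
   Context: The logical formula in Laurent form: given a CNF formula with $M$ clauses of three literals each and $N$ variables (the $s$-th one occurring $r_s\ge1$ times), number the literal occurrences $1,\dots,3M$ (clause $c$ consists of occurrences $3c-2,3c-1,3c$), assign to the $a$-th occurrence (positive or negated) a variable $X_a$, let $X_{st}$ be the variable assigned to the $t$-th occurrence of the $s$-th old variable, and $\varepsilon_{st}=1$ or $-1$ according to whether that occurrence is positive or negative. Then $$f=\frac{1}{2^{6M-1}}\prod_{c=1}^{M}\bigl((X_{3c-2}-1)(X_{3c-1}-1)(X_{3c}-1)+8\bigr)\prod_{s=1}^{N}\Bigl(\prod_{t=1}^{r_s}\bigl(\tfrac{\varepsilon_{st}}{X_{st}}+1\bigr)+\prod_{t=1}^{r_s}\bigl(-\tfrac{\varepsilon_{st}}{X_{st}}+1\bigr)\Bigr)-1 .$$ It expands as $f=\sum_{k=1}^{3^n-1}q_k\prod_{j=1}^nX_j^{e_j}+C$, where $k$ enumerates the non-zero vectors $(e_1,\dots,e_n)\in\{ -1,0,1\}^n$ and $C$ is the constant term. Frequencies: for the vector $(e_j)$ belonging to $k$, $A_k=\sum_je_ja_j$, $B_k=\sum_je_jb_j$, $C_k=\sum_je_jc_j$, $D_k=\sum_je_jd_j$.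 The minimal maximum frequency is $\mu=\min_{1\le k\le 3^n-1}\{\max\{|A_k|,|B_k|,|C_k|,|D_k|\}\}$. Integerization $z'$: all $a_j,b_j,c_j,d_j$ are multiplied by one certain integer and rounded to integers $z'(a_j),z'(b_j),z'(c_j),z'(d_j)$; $z'(A_k)=\sum_je_jz'(a_j)$, and similarly for $z'(B_k),z'(C_k),z'(D_k)$. The integerization $z'$ is such that frequencies with absolute value at least $\mu$ become non-zero integers: if $|A_k|\ge\mu$ then $z'(A_k)\ne0$, and similarly for $B_k,C_k,D_k$. -}

module Defs where

open import Data.Bool.Base using (if_then_else_)
open import Data.Fin.Base as Fin using (Fin; zero; suc; toℕ; combine; finToFun)
import Data.Fin.Properties as Fin
open import Data.Integer.Base as ℤ using (ℤ; +_; -[1+_]; 0ℤ; 1ℤ; -1ℤ)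
import Data.Integer.Properties as ℤ
open import Data.List.Base as List using (List; []; _∷_; _++_)
open import Data.Nat.Base as ℕ using (ℕ; zero; suc; NonZero)
import Data.Nat.Properties as ℕ
open import Data.Product.Base using (∃; ∃₂; _×_; _,_; proj₁; proj₂)
open import Data.Rational.Base as ℚ using (ℚ; 0ℚ; 1ℚ; ½)
import Data.Rational.Properties as ℚ
open import Data.Rational.Solver using (module +-*-Solver)
import Data.Rational.Unnormalised.Base as ℚᵘ
import Data.Rational.Unnormalised.Properties as ℚᵘ
open import Data.Sign.Base as Sign using (Sign)
open import Data.Sum.Base using (inj₁; inj₂)
open import Data.Vec.Base as Vec using (Vec)
open import Data.Vec.Functional using (Vector; foldr)
import Data.Vec.Properties as Vec
open import Relation.Binary.PropositionalEquality
open import Relation.Nullary using (¬_; does)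

∣-∣-triangle : ∀ p q r → ℚ.∣ p ℚ.- r ∣ ℚ.≤ ℚ.∣ p ℚ.- q ∣ ℚ.+ ℚ.∣ q ℚ.- r ∣
∣-∣-triangle p q r =
  subst (λ t → ℚ.∣ t ∣ ℚ.≤ ℚ.∣ p ℚ.- q ∣ ℚ.+ ℚ.∣ q ℚ.- r ∣)
    (solve 3 (λ p q r → (p :- q) :+ (q :- r) := p :- r) refl p q r)
    (ℚ.∣p+q∣≤∣p∣+∣q∣ (p ℚ.- q) (q ℚ.- r))
  where open +-*-Solver

∣-∣-comm : ∀ p q → ℚ.∣ p ℚ.- q ∣ ≡ ℚ.∣ q ℚ.- p ∣
∣-∣-comm p q = trans (sym (ℚ.∣-p∣≡∣p∣ (p ℚ.- q)))
  (cong ℚ.∣_∣ (solve 2 (λ p q → :- (p :- q) := q :- p) refl p q))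
  where open +-*-Solver

halves : ∀ ε → ½ ℚ.* ε ℚ.+ ½ ℚ.* ε ≡ ε
halves ε = trans (sym (ℚ.*-distribʳ-+ ε ½ ½)) (ℚ.*-identityˡ ε)

half>0 : ∀ {ε} → 0ℚ ℚ.< ε → 0ℚ ℚ.< ½ ℚ.* ε
half>0 {ε} ε>0 = subst (ℚ._< ½ ℚ.* ε) (ℚ.*-zeroʳ ½) (ℚ.*-monoʳ-<-pos ½ ε>0)

p≤∣p∣ : ∀ p → p ℚ.≤ ℚ.∣ p ∣
p≤∣p∣ p with ℚ.≤-total 0ℚ p
... | inj₁ 0≤p = ℚ.≤-reflexive (sym (ℚ.0≤p⇒∣p∣≡p 0≤p))
... | inj₂ p≤0 = ℚ.≤-trans p≤0 (ℚ.0≤∣p∣ p)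

p≤q+∣p-q∣ : ∀ p q → p ℚ.≤ q ℚ.+ ℚ.∣ p ℚ.- q ∣
p≤q+∣p-q∣ p q = subst (ℚ._≤ q ℚ.+ ℚ.∣ p ℚ.- q ∣)
  (solve 2 (λ p q → q :+ (p :- q) := p) refl p q)
  (ℚ.+-monoʳ-≤ q (p≤∣p∣ (p ℚ.- q)))
  where open +-*-Solver

p≤q+δ : ∀ {p q δ} → ℚ.∣ p ℚ.- q ∣ ℚ.≤ δ → p ℚ.≤ q ℚ.+ δ
p≤q+δ {p} {q} h = ℚ.≤-trans (p≤q+∣p-q∣ p q) (ℚ.+-monoʳ-≤ q h)

q≤p+δ : ∀ {p q δ} → ℚ.∣ p ℚ.- q ∣ ℚ.≤ δ → q ℚ.≤ p ℚ.+ δ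
q≤p+δ {p} {q} h = p≤q+δ (subst (ℚ._≤ _) (∣-∣-comm p q) h)

p-q≤δ : ∀ p q {δ} → p ℚ.≤ q ℚ.+ δ → p ℚ.- q ℚ.≤ δ
p-q≤δ p q {δ} h = subst (p ℚ.- q ℚ.≤_)
  (solve 2 (λ q δ → (q :+ δ) :- q := δ) refl q δ)
  (ℚ.+-monoˡ-≤ (ℚ.- q) h)
  where open +-*-Solver

∣p-q∣≤δ : ∀ p q {δ} → p ℚ.≤ q ℚ.+ δ → q ℚ.≤ p ℚ.+ δ → ℚ.∣ p ℚ.- q ∣ ℚ.≤ δ
∣p-q∣≤δ p q {δ} p≤ q≤ with ℚ.∣p∣≡p∨∣p∣≡-p (p ℚ.- q)
... | inj₁ eq = subst (ℚ._≤ δ) (sym eq) (p-q≤δ p q p≤)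
... | inj₂ eq = subst (ℚ._≤ δ)
    (trans (solve 2 (λ p q → q :- p := :- (p :- q)) refl p q) (sym eq))
    (p-q≤δ q p q≤)
  where open +-*-Solver

*-mono-≤-nonNeg : ∀ {p q r s} → 0ℚ ℚ.≤ p → 0ℚ ℚ.≤ s →
                  p ℚ.≤ q → r ℚ.≤ s → p ℚ.* r ℚ.≤ q ℚ.* s
*-mono-≤-nonNeg {p} {q} {r} {s} 0≤p 0≤s p≤q r≤s = ℚ.≤-trans
  (ℚ.*-monoˡ-≤-nonNeg p {{ℚ.nonNegative 0≤p}} r≤s)
  (ℚ.*-monoʳ-≤-nonNeg s {{ℚ.nonNegative 0≤s}} p≤q)

1/suc : ℕ → ℚ
1/suc k = + 1 ℚ./ suc k

0≤1/suc : ∀ k → 0ℚ ℚ.≤ 1/suc k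
0≤1/suc k = ℚ.nonNegative⁻¹ (1/suc k) {{ℚ.normalize-nonNeg 1 (suc k)}}

toℚᵘ-1/suc : ∀ k → ℚ.toℚᵘ (1/suc k) ℚᵘ.≃ ℚᵘ.mkℚᵘ (+ 1) k
toℚᵘ-1/suc k = ℚ.toℚᵘ-fromℚᵘ (ℚᵘ.mkℚᵘ (+ 1) k)

archimedean : ∀ q {ε} → 0ℚ ℚ.< ε → ∃ λ N → ∀ k → N ℕ.≤ k → q ℚ.* 1/suc k ℚ.≤ ε
archimedean q@(ℚ.mkℚ a b-1 _) {ε@(ℚ.mkℚ -[1+ _ ] _ _)} (ℚ.*<* ())
archimedean q@(ℚ.mkℚ a b-1 _) {ε@(ℚ.mkℚ (+ 0) _ _)} (ℚ.*<* (ℤ.+<+ ()))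
archimedean q@(ℚ.mkℚ a b-1 _) {ε@(ℚ.mkℚ (+ (suc c)) d-1 _)} _ =
  ℤ.∣ a ∣ ℕ.* suc d-1 , λ k N≤k → ℚ.toℚᵘ-cancel-≤ (begin
    ℚ.toℚᵘ (q ℚ.* 1/suc k)           ≃⟨ ℚ.toℚᵘ-homo-* q (1/suc k) ⟩
    ℚ.toℚᵘ q ℚᵘ.* ℚ.toℚᵘ (1/suc k)   ≃⟨ ℚᵘ.*-congˡ {ℚ.toℚᵘ q} (toℚᵘ-1/suc k) ⟩
    ℚ.toℚᵘ q ℚᵘ.* ℚᵘ.mkℚᵘ (+ 1) k    ≤⟨ ℚᵘ.*≤* (bound k N≤k) ⟩
    ℚ.toℚᵘ ε                         ∎)
  where
  open ℚᵘ.≤-Reasoning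
  i≤∣i∣ : ∀ i → i ℤ.≤ + ℤ.∣ i ∣
  i≤∣i∣ (+ _)    = ℤ.≤-refl
  i≤∣i∣ -[1+ _ ] = ℤ.-≤+
  bound : ∀ k → ℤ.∣ a ∣ ℕ.* suc d-1 ℕ.≤ k →
          (a ℤ.* + 1) ℤ.* + suc d-1 ℤ.≤ + suc c ℤ.* + (suc b-1 ℕ.* suc k)
  bound k N≤k = ℤ.≤-trans
    (ℤ.≤-reflexive (cong (ℤ._* + suc d-1) (ℤ.*-identityʳ a)))
    (ℤ.≤-trans (ℤ.*-monoʳ-≤-nonNeg (+ suc d-1) (i≤∣i∣ a))
    (ℤ.≤-trans (ℤ.≤-reflexive (sym (ℤ.pos-* ℤ.∣ a ∣ (suc d-1))))
    (ℤ.≤-trans (ℤ.+≤+ (ℕ.≤-trans N≤k (ℕ.≤-trans (ℕ.n≤1+n k)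
      (ℕ.≤-trans (ℕ.m≤n*m (suc k) (suc b-1)) (ℕ.m≤n*m _ (suc c))))))
    (ℤ.≤-reflexive (ℤ.pos-* (suc c) (suc b-1 ℕ.* suc k))))))

½*1/suc≤ : ∀ k → ½ ℚ.* 1/suc k ℚ.≤ 1/suc (suc k)
½*1/suc≤ k = ℚ.toℚᵘ-cancel-≤ (begin
    ℚ.toℚᵘ (½ ℚ.* 1/suc k)            ≃⟨ ℚ.toℚᵘ-homo-* ½ (1/suc k) ⟩
    ℚ.toℚᵘ ½ ℚᵘ.* ℚ.toℚᵘ (1/suc k)    ≃⟨ ℚᵘ.*-congˡ {ℚ.toℚᵘ ½} (toℚᵘ-1/suc k) ⟩
    ℚ.toℚᵘ ½ ℚᵘ.* ℚᵘ.mkℚᵘ (+ 1) k     ≤⟨ ℚᵘ.*≤* (ℤ.+≤+ bound) ⟩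
    ℚᵘ.mkℚᵘ (+ 1) (suc k)             ≃⟨ toℚᵘ-1/suc (suc k) ⟨
    ℚ.toℚᵘ (1/suc (suc k))            ∎)
  where
  open ℚᵘ.≤-Reasoning
  bound : 1 ℕ.* suc (suc k) ℕ.≤ 1 ℕ.* (2 ℕ.* suc k)
  bound = ℕ.*-monoʳ-≤ 1 (subst (2 ℕ.+ k ℕ.≤_) (cong suc (sym (ℕ.+-suc k (k ℕ.+ 0))))
    (ℕ.s≤s (ℕ.s≤s (ℕ.m≤m+n k (k ℕ.+ 0)))))

infix 4 _≃ℝ_ _<ℝ_ _≤ℝ_

IsCauchy : (ℕ → ℚ) → Set
IsCauchy u = ∀ ε → 0ℚ ℚ.< ε →
  ∃ λ N → ∀ m n → N ℕ.≤ m → N ℕ.≤ n → ℚ.∣ u m ℚ.- u n ∣ ℚ.≤ ε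

record ℝ : Set where
  constructor mkℝ
  field
    approx : ℕ → ℚ
    cauchy : IsCauchy approx

open ℝ public

_≃ℝ_ : ℝ → ℝ → Set
x ≃ℝ y = ∀ ε → 0ℚ ℚ.< ε →
  ∃ λ N → ∀ n → N ℕ.≤ n → ℚ.∣ approx x n ℚ.- approx y n ∣ ℚ.≤ ε

_<ℝ_ : ℝ → ℝ → Set
x <ℝ y = ∃ λ δ → 0ℚ ℚ.< δ ×
  ∃ λ N → ∀ n → N ℕ.≤ n → approx x n ℚ.+ δ ℚ.≤ approx y n

_≤ℝ_ : ℝ → ℝ → Set
x ≤ℝ y = ∀ ε → 0ℚ ℚ.< ε →
  ∃ λ N → ∀ n → N ℕ.≤ n → approx x n ℚ.≤ approx y n ℚ.+ ε

-- Convergence proofs are opaque to keep the normal forms of reals small.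

opaque
  cauchy-lipschitz₁ : (f : ℚ → ℚ) → (∀ p q → ℚ.∣ f p ℚ.- f q ∣ ℚ.≤ ℚ.∣ p ℚ.- q ∣) →
                      ∀ {u} → IsCauchy u → IsCauchy (λ n → f (u n))
  cauchy-lipschitz₁ f lip {u} cu ε ε>0 with cu ε ε>0
  ... | N , h = N , λ m n N≤m N≤n → ℚ.≤-trans (lip (u m) (u n)) (h m n N≤m N≤n)

opaque
  cauchy-lipschitz₂ : (f : ℚ → ℚ → ℚ) →
    (∀ p q r s → ℚ.∣ f p q ℚ.- f r s ∣ ℚ.≤ ℚ.∣ p ℚ.- r ∣ ℚ.+ ℚ.∣ q ℚ.- s ∣) →
    ∀ {u v} → IsCauchy u → IsCauchy v → IsCauchy (λ n → f (u n) (v n))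
  cauchy-lipschitz₂ f lip {u} {v} cu cv ε ε>0
    with cu (½ ℚ.* ε) (half>0 ε>0) | cv (½ ℚ.* ε) (half>0 ε>0)
  ... | N₁ , h₁ | N₂ , h₂ = N₁ ℕ.⊔ N₂ , λ m n N≤m N≤n →
    ℚ.≤-trans (lip (u m) (v m) (u n) (v n))
      (subst (ℚ.∣ u m ℚ.- u n ∣ ℚ.+ ℚ.∣ v m ℚ.- v n ∣ ℚ.≤_) (halves ε)
        (ℚ.+-mono-≤ (h₁ m n (ℕ.m⊔n≤o⇒m≤o N₁ N₂ N≤m) (ℕ.m⊔n≤o⇒m≤o N₁ N₂ N≤n))
                    (h₂ m n (ℕ.m⊔n≤o⇒n≤o N₁ N₂ N≤m) (ℕ.m⊔n≤o⇒n≤o N₁ N₂ N≤n))))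

opaque
  lipschitz-+ : ∀ p q r s →
    ℚ.∣ (p ℚ.+ q) ℚ.- (r ℚ.+ s) ∣ ℚ.≤ ℚ.∣ p ℚ.- r ∣ ℚ.+ ℚ.∣ q ℚ.- s ∣
  lipschitz-+ p q r s = subst (λ t → ℚ.∣ t ∣ ℚ.≤ ℚ.∣ p ℚ.- r ∣ ℚ.+ ℚ.∣ q ℚ.- s ∣)
    (solve 4 (λ p q r s → (p :- r) :+ (q :- s) := (p :+ q) :- (r :+ s)) refl p q r s)
    (ℚ.∣p+q∣≤∣p∣+∣q∣ (p ℚ.- r) (q ℚ.- s))
    where open +-*-Solver

opaque
  lipschitz-neg : ∀ p q → ℚ.∣ ℚ.- p ℚ.- ℚ.- q ∣ ℚ.≤ ℚ.∣ p ℚ.- q ∣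
  lipschitz-neg p q = ℚ.≤-reflexive (trans
    (cong ℚ.∣_∣ (solve 2 (λ p q → :- p :- :- q := q :- p) refl p q)) (∣-∣-comm q p))
    where open +-*-Solver

opaque
  lipschitz-∣∣ : ∀ p q → ℚ.∣ ℚ.∣ p ∣ ℚ.- ℚ.∣ q ∣ ∣ ℚ.≤ ℚ.∣ p ℚ.- q ∣
  lipschitz-∣∣ p q = ∣p-q∣≤δ ℚ.∣ p ∣ ℚ.∣ q ∣ (half p q)
    (subst (λ t → ℚ.∣ q ∣ ℚ.≤ ℚ.∣ p ∣ ℚ.+ t) (∣-∣-comm q p) (half q p))
    where
    open +-*-Solver
    half : ∀ p q → ℚ.∣ p ∣ ℚ.≤ ℚ.∣ q ∣ ℚ.+ ℚ.∣ p ℚ.- q ∣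
    half p q = subst (λ t → ℚ.∣ t ∣ ℚ.≤ ℚ.∣ q ∣ ℚ.+ ℚ.∣ p ℚ.- q ∣)
      (solve 2 (λ p q → q :+ (p :- q) := p) refl p q)
      (ℚ.∣p+q∣≤∣p∣+∣q∣ q (p ℚ.- q))

p≤q+[d+e]ˡ : ∀ p q d e → 0ℚ ℚ.≤ e → p ℚ.≤ q ℚ.+ d → p ℚ.≤ q ℚ.+ (d ℚ.+ e)
p≤q+[d+e]ˡ p q d e 0≤e h = ℚ.≤-trans h (ℚ.+-monoʳ-≤ q
  (subst (ℚ._≤ d ℚ.+ e) (ℚ.+-identityʳ d) (ℚ.+-monoʳ-≤ d 0≤e)))

p≤q+[d+e]ʳ : ∀ p q d e → 0ℚ ℚ.≤ d → p ℚ.≤ q ℚ.+ e → p ℚ.≤ q ℚ.+ (d ℚ.+ e)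
p≤q+[d+e]ʳ p q d e 0≤d h =
  subst (λ t → p ℚ.≤ q ℚ.+ t) (ℚ.+-comm e d) (p≤q+[d+e]ˡ p q e d 0≤d h)

opaque
  lipschitz-⊔ : ∀ p q r s →
    ℚ.∣ (p ℚ.⊔ q) ℚ.- (r ℚ.⊔ s) ∣ ℚ.≤ ℚ.∣ p ℚ.- r ∣ ℚ.+ ℚ.∣ q ℚ.- s ∣
  lipschitz-⊔ p q r s = ∣p-q∣≤δ (p ℚ.⊔ q) (r ℚ.⊔ s) (half p q r s)
    (subst₂ (λ t u → r ℚ.⊔ s ℚ.≤ p ℚ.⊔ q ℚ.+ (t ℚ.+ u)) (∣-∣-comm r p) (∣-∣-comm s q)
      (half r s p q))
    where
    half : ∀ p q r s → p ℚ.⊔ q ℚ.≤ r ℚ.⊔ s ℚ.+ (ℚ.∣ p ℚ.- r ∣ ℚ.+ ℚ.∣ q ℚ.- s ∣)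
    half p q r s = ℚ.⊔-lub
      (p≤q+[d+e]ˡ p (r ℚ.⊔ s) ℚ.∣ p ℚ.- r ∣ ℚ.∣ q ℚ.- s ∣ (ℚ.0≤∣p∣ (q ℚ.- s))
        (ℚ.≤-trans (p≤q+∣p-q∣ p r) (ℚ.+-monoˡ-≤ ℚ.∣ p ℚ.- r ∣ (ℚ.p≤p⊔q r s))))
      (p≤q+[d+e]ʳ q (r ℚ.⊔ s) ℚ.∣ p ℚ.- r ∣ ℚ.∣ q ℚ.- s ∣ (ℚ.0≤∣p∣ (p ℚ.- r))
        (ℚ.≤-trans (p≤q+∣p-q∣ q s) (ℚ.+-monoˡ-≤ ℚ.∣ q ℚ.- s ∣ (ℚ.p≤q⊔p r s))))

opaque
  lipschitz-⊓ : ∀ p q r s →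
    ℚ.∣ (p ℚ.⊓ q) ℚ.- (r ℚ.⊓ s) ∣ ℚ.≤ ℚ.∣ p ℚ.- r ∣ ℚ.+ ℚ.∣ q ℚ.- s ∣
  lipschitz-⊓ p q r s = ∣p-q∣≤δ (p ℚ.⊓ q) (r ℚ.⊓ s) (half p q r s)
    (subst₂ (λ t u → r ℚ.⊓ s ℚ.≤ p ℚ.⊓ q ℚ.+ (t ℚ.+ u)) (∣-∣-comm r p) (∣-∣-comm s q)
      (half r s p q))
    where
    half : ∀ p q r s → p ℚ.⊓ q ℚ.≤ r ℚ.⊓ s ℚ.+ (ℚ.∣ p ℚ.- r ∣ ℚ.+ ℚ.∣ q ℚ.- s ∣)
    half p q r s with ℚ.≤-total r s
    ... | inj₁ r≤s rewrite ℚ.p≤q⇒p⊓q≡p r≤s =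
      p≤q+[d+e]ˡ (p ℚ.⊓ q) r ℚ.∣ p ℚ.- r ∣ ℚ.∣ q ℚ.- s ∣ (ℚ.0≤∣p∣ (q ℚ.- s))
        (ℚ.≤-trans (ℚ.p⊓q≤p p q) (p≤q+∣p-q∣ p r))
    ... | inj₂ s≤r rewrite ℚ.p≥q⇒p⊓q≡q s≤r =
      p≤q+[d+e]ʳ (p ℚ.⊓ q) s ℚ.∣ p ℚ.- r ∣ ℚ.∣ q ℚ.- s ∣ (ℚ.0≤∣p∣ (p ℚ.- r))
        (ℚ.≤-trans (ℚ.p⊓q≤q p q) (p≤q+∣p-q∣ q s))

cauchy⇒bounded : ∀ {u} → IsCauchy u →
  ∃₂ λ B N → 0ℚ ℚ.< B × (∀ n → N ℕ.≤ n → ℚ.∣ u n ∣ ℚ.≤ B)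
cauchy⇒bounded {u} cu with cu 1ℚ (ℚ.positive⁻¹ 1ℚ)
... | N , h = ℚ.∣ u N ∣ ℚ.+ 1ℚ , N
    , subst (ℚ._< ℚ.∣ u N ∣ ℚ.+ 1ℚ) (ℚ.+-identityˡ 0ℚ)
        (ℚ.+-mono-≤-< (ℚ.0≤∣p∣ (u N)) (ℚ.positive⁻¹ 1ℚ))
    , λ n N≤n → p≤q+δ {ℚ.∣ u n ∣} {ℚ.∣ u N ∣} (ℚ.≤-trans (lipschitz-∣∣ (u n) (u N)) (h n N N≤n ℕ.≤-refl))

*-difference : ∀ p q r s →
  p ℚ.* q ℚ.- r ℚ.* s ≡ p ℚ.* (q ℚ.- s) ℚ.+ s ℚ.* (p ℚ.- r)
*-difference = solve 4 (λ p q r s →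
  p :* q :- r :* s := p :* (q :- s) :+ s :* (p :- r)) refl
  where open +-*-Solver

divide : ∀ {D ε} → 0ℚ ℚ.< D → 0ℚ ℚ.< ε → ∃ λ δ → 0ℚ ℚ.< δ × D ℚ.* δ ≡ ε
divide {D} {ε} D>0 ε>0 = D⁻¹ ℚ.* ε
  , subst (ℚ._< D⁻¹ ℚ.* ε) (ℚ.*-zeroʳ D⁻¹)
      (ℚ.*-monoʳ-<-pos D⁻¹ {{ℚ.1/pos⇒pos D {{D-pos}}}} ε>0)
  , trans (sym (ℚ.*-assoc D D⁻¹ ε))
      (trans (cong (ℚ._* ε) (ℚ.*-inverseʳ D {{D≢0}})) (ℚ.*-identityˡ ε))
  where
  D-pos = ℚ.positive D>0
  D≢0 = ℚ.pos⇒nonZero D {{D-pos}}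
  D⁻¹ = ℚ.1/_ D {{D≢0}}

+-swap : ∀ a b → a ℚ.+ (b ℚ.+ a) ≡ (a ℚ.+ a) ℚ.+ b
+-swap = solve 2 (λ a b → a :+ (b :+ a) := (a :+ a) :+ b) refl
  where open +-*-Solver

0<p+q : ∀ {p q} → 0ℚ ℚ.< p → 0ℚ ℚ.< q → 0ℚ ℚ.< p ℚ.+ q
0<p+q {p} {q} p>0 q>0 =
  subst (ℚ._< p ℚ.+ q) (ℚ.+-identityˡ 0ℚ) (ℚ.+-mono-< p>0 q>0)

∣*-difference∣≤ : ∀ p q r s {B C δ} → 0ℚ ℚ.≤ δ → ℚ.∣ p ∣ ℚ.≤ B → ℚ.∣ s ∣ ℚ.≤ C →
  ℚ.∣ p ℚ.- r ∣ ℚ.≤ δ → ℚ.∣ q ℚ.- s ∣ ℚ.≤ δ →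
  ℚ.∣ p ℚ.* q ℚ.- r ℚ.* s ∣ ℚ.≤ (B ℚ.+ C) ℚ.* δ
∣*-difference∣≤ p q r s {B} {C} {δ} 0≤δ p≤B s≤C p-r≤δ q-s≤δ = begin
  ℚ.∣ p ℚ.* q ℚ.- r ℚ.* s ∣
    ≡⟨ cong ℚ.∣_∣ (*-difference p q r s) ⟩
  ℚ.∣ p ℚ.* (q ℚ.- s) ℚ.+ s ℚ.* (p ℚ.- r) ∣
    ≤⟨ ℚ.∣p+q∣≤∣p∣+∣q∣ (p ℚ.* (q ℚ.- s)) (s ℚ.* (p ℚ.- r)) ⟩
  ℚ.∣ p ℚ.* (q ℚ.- s) ∣ ℚ.+ ℚ.∣ s ℚ.* (p ℚ.- r) ∣
    ≡⟨ cong₂ ℚ._+_ (ℚ.∣p*q∣≡∣p∣*∣q∣ p (q ℚ.- s)) (ℚ.∣p*q∣≡∣p∣*∣q∣ s (p ℚ.- r)) ⟩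
  ℚ.∣ p ∣ ℚ.* ℚ.∣ q ℚ.- s ∣ ℚ.+ ℚ.∣ s ∣ ℚ.* ℚ.∣ p ℚ.- r ∣
    ≤⟨ ℚ.+-mono-≤ (*-mono-≤-nonNeg (ℚ.0≤∣p∣ p) 0≤δ p≤B q-s≤δ)
                  (*-mono-≤-nonNeg (ℚ.0≤∣p∣ s) 0≤δ s≤C p-r≤δ) ⟩
  B ℚ.* δ ℚ.+ C ℚ.* δ
    ≡⟨ ℚ.*-distribʳ-+ δ B C ⟨
  (B ℚ.+ C) ℚ.* δ ∎
  where open ℚ.≤-Reasoning

cauchy-*′ : ∀ {u v} → IsCauchy u → IsCauchy v → IsCauchy (λ n → u n ℚ.* v n)
cauchy-*′ {u} {v} cu cv ε ε>0 = N , λ m n N≤m N≤n →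
  subst (ℚ.∣ u m ℚ.* v m ℚ.- u n ℚ.* v n ∣ ℚ.≤_) scaled
    (∣*-difference∣≤ (u m) (v m) (u n) (v n) (ℚ.<⇒≤ δ>0)
      (u≤B m (N₁≤ N≤m)) (v≤C n (N₂≤ N≤n))
      (hu m n (N₃≤ N≤m) (N₃≤ N≤n)) (hv m n (N₄≤ N≤m) (N₄≤ N≤n)))
  where
  bu = cauchy⇒bounded {u} cu
  bv = cauchy⇒bounded {v} cv
  B = proj₁ bu
  C = proj₁ bv
  N₁ = proj₁ (proj₂ bu)
  N₂ = proj₁ (proj₂ bv)
  u≤B = proj₂ (proj₂ (proj₂ bu))
  v≤C = proj₂ (proj₂ (proj₂ bv))
  quotient = divide {B ℚ.+ C} (0<p+q (proj₁ (proj₂ (proj₂ bu))) (proj₁ (proj₂ (proj₂ bv)))) ε>0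
  δ = proj₁ quotient
  δ>0 = proj₁ (proj₂ quotient)
  scaled = proj₂ (proj₂ quotient)
  N₃ = proj₁ (cu δ δ>0)
  N₄ = proj₁ (cv δ δ>0)
  hu = proj₂ (cu δ δ>0)
  hv = proj₂ (cv δ δ>0)
  N = (N₁ ℕ.⊔ N₂) ℕ.⊔ (N₃ ℕ.⊔ N₄)
  N₁≤ : ∀ {m} → N ℕ.≤ m → N₁ ℕ.≤ m
  N₁≤ h = ℕ.m⊔n≤o⇒m≤o N₁ N₂ (ℕ.m⊔n≤o⇒m≤o (N₁ ℕ.⊔ N₂) (N₃ ℕ.⊔ N₄) h)
  N₂≤ : ∀ {m} → N ℕ.≤ m → N₂ ℕ.≤ m
  N₂≤ h = ℕ.m⊔n≤o⇒n≤o N₁ N₂ (ℕ.m⊔n≤o⇒m≤o (N₁ ℕ.⊔ N₂) (N₃ ℕ.⊔ N₄) h)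
  N₃≤ : ∀ {m} → N ℕ.≤ m → N₃ ℕ.≤ m
  N₃≤ h = ℕ.m⊔n≤o⇒m≤o N₃ N₄ (ℕ.m⊔n≤o⇒n≤o (N₁ ℕ.⊔ N₂) (N₃ ℕ.⊔ N₄) h)
  N₄≤ : ∀ {m} → N ℕ.≤ m → N₄ ℕ.≤ m
  N₄≤ h = ℕ.m⊔n≤o⇒n≤o N₃ N₄ (ℕ.m⊔n≤o⇒n≤o (N₁ ℕ.⊔ N₂) (N₃ ℕ.⊔ N₄) h)

opaque
  cauchy-* : ∀ {u v} → IsCauchy u → IsCauchy v → IsCauchy (λ n → u n ℚ.* v n)
  cauchy-* {u} {v} = cauchy-*′ {u} {v}

infixl 6 _+ℝ_ _-ℝ_ _⊔ℝ_
infixl 7 _*ℝ_ _⊓ℝ_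
infix  8 -ℝ_

opaque
  cauchy-const : ∀ q → IsCauchy (λ _ → q)
  cauchy-const q ε ε>0 = 0 , λ _ _ _ _ →
    subst (ℚ._≤ ε) (sym (cong ℚ.∣_∣ (ℚ.+-inverseʳ q))) (ℚ.<⇒≤ ε>0)

fromℚ : ℚ → ℝ
fromℚ q = mkℝ (λ _ → q) (cauchy-const q)

fromℤ : ℤ → ℝ
fromℤ i = fromℚ (i ℚ./ 1)

fromℕ : ℕ → ℝ
fromℕ k = fromℤ (+ k)

0ℝ 1ℝ : ℝ
0ℝ = fromℚ 0ℚ
1ℝ = fromℚ 1ℚ

_+ℝ_ : ℝ → ℝ → ℝ
x +ℝ y = mkℝ (λ n → approx x n ℚ.+ approx y n)
             (cauchy-lipschitz₂ ℚ._+_ lipschitz-+ {approx x} {approx y} (cauchy x) (cauchy y))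

-ℝ_ : ℝ → ℝ
-ℝ x = mkℝ (λ n → ℚ.- approx x n) (cauchy-lipschitz₁ ℚ.-_ lipschitz-neg {approx x} (cauchy x))

_-ℝ_ : ℝ → ℝ → ℝ
x -ℝ y = x +ℝ (-ℝ y)

_*ℝ_ : ℝ → ℝ → ℝ
x *ℝ y = mkℝ (λ n → approx x n ℚ.* approx y n) (cauchy-* {approx x} {approx y} (cauchy x) (cauchy y))

_⊔ℝ_ : ℝ → ℝ → ℝ
x ⊔ℝ y = mkℝ (λ n → approx x n ℚ.⊔ approx y n)
             (cauchy-lipschitz₂ ℚ._⊔_ lipschitz-⊔ {approx x} {approx y} (cauchy x) (cauchy y))

_⊓ℝ_ : ℝ → ℝ → ℝ
x ⊓ℝ y = mkℝ (λ n → approx x n ℚ.⊓ approx y n)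
             (cauchy-lipschitz₂ ℚ._⊓_ lipschitz-⊓ {approx x} {approx y} (cauchy x) (cauchy y))

∣_∣ℝ : ℝ → ℝ
∣ x ∣ℝ = mkℝ (λ n → ℚ.∣ approx x n ∣) (cauchy-lipschitz₁ ℚ.∣_∣ lipschitz-∣∣ {approx x} (cauchy x))

-- The tails of s are small simultaneously at all late approximation indices;
-- the diagonal of the approximants then represents the limit of s.

IsTailCauchy : (ℕ → ℝ) → Set
IsTailCauchy s = ∀ ε → 0ℚ ℚ.< ε → ∃₂ λ p N → ∀ m n → p ℕ.≤ m → N ℕ.≤ n →
  ℚ.∣ approx (s m) n ℚ.- approx (s p) n ∣ ℚ.≤ ε

diagonal : (s : ℕ → ℝ) → IsTailCauchy s → IsCauchy (λ n → approx (s n) n)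
diagonal s tc ε ε>0 with tc (½ ℚ.* (½ ℚ.* ε)) (half>0 (half>0 ε>0))
... | p , N , tail with cauchy (s p) (½ ℚ.* ε) (half>0 ε>0)
... | N′ , close = p ℕ.⊔ (N ℕ.⊔ N′) , λ m n h k → begin
  ℚ.∣ approx (s m) m ℚ.- approx (s n) n ∣
    ≤⟨ ∣-∣-triangle (approx (s m) m) (approx (s p) m) (approx (s n) n) ⟩
  ℚ.∣ approx (s m) m ℚ.- approx (s p) m ∣ ℚ.+ ℚ.∣ approx (s p) m ℚ.- approx (s n) n ∣
    ≤⟨ ℚ.+-mono-≤ (tail m m (p≤ h) (N≤ h)) (∣-∣-triangle (approx (s p) m) (approx (s p) n) (approx (s n) n)) ⟩
  η ℚ.+ (ℚ.∣ approx (s p) m ℚ.- approx (s p) n ∣ ℚ.+ ℚ.∣ approx (s p) n ℚ.- approx (s n) n ∣)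
    ≤⟨ ℚ.+-monoʳ-≤ η (ℚ.+-mono-≤ (close m n (N′≤ h) (N′≤ k))
         (subst (ℚ._≤ η) (∣-∣-comm (approx (s n) n) (approx (s p) n))
           (tail n n (p≤ k) (N≤ k)))) ⟩
  η ℚ.+ (½ ℚ.* ε ℚ.+ η)
    ≡⟨ +-swap η (½ ℚ.* ε) ⟩
  (η ℚ.+ η) ℚ.+ ½ ℚ.* ε
    ≡⟨ cong (ℚ._+ ½ ℚ.* ε) (halves (½ ℚ.* ε)) ⟩
  ½ ℚ.* ε ℚ.+ ½ ℚ.* ε
    ≡⟨ halves ε ⟩
  ε ∎
  where
  open ℚ.≤-Reasoning
  η = ½ ℚ.* (½ ℚ.* ε)
  p≤ : ∀ {m} → p ℕ.⊔ (N ℕ.⊔ N′) ℕ.≤ m → p ℕ.≤ m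
  p≤ h = ℕ.m⊔n≤o⇒m≤o p _ h
  N≤ : ∀ {m} → p ℕ.⊔ (N ℕ.⊔ N′) ℕ.≤ m → N ℕ.≤ m
  N≤ h = ℕ.m⊔n≤o⇒m≤o N N′ (ℕ.m⊔n≤o⇒n≤o p _ h)
  N′≤ : ∀ {m} → p ℕ.⊔ (N ℕ.⊔ N′) ℕ.≤ m → N′ ℕ.≤ m
  N′≤ h = ℕ.m⊔n≤o⇒n≤o N N′ (ℕ.m⊔n≤o⇒n≤o p _ h)

lim : (s : ℕ → ℝ) → IsTailCauchy s → ℝ
lim s tc = mkℝ (λ n → approx (s n) n) (diagonal s tc)

infix  4 _≃ℂ_
infix  5 _+i_
infixl 6 _+ℂ_
infixl 7 _*ℂ_
infix  8 -ℂ_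
infixr 8 _∙ℂ_ _^ℂ_

record ℂ : Set where
  constructor _+i_
  field
    re im : ℝ

open ℂ public

_≃ℂ_ : ℂ → ℂ → Set
z ≃ℂ w = re z ≃ℝ re w × im z ≃ℝ im w

ofReal : ℝ → ℂ
ofReal x = x +i 0ℝ

0ℂ 1ℂ 𝕚 : ℂ
0ℂ = ofReal 0ℝ
1ℂ = ofReal 1ℝ
𝕚 = 0ℝ +i 1ℝ

_+ℂ_ : ℂ → ℂ → ℂ
z +ℂ w = (re z +ℝ re w) +i (im z +ℝ im w)

-ℂ_ : ℂ → ℂ
-ℂ z = (-ℝ re z) +i (-ℝ im z)

_*ℂ_ : ℂ → ℂ → ℂ
z *ℂ w = (re z *ℝ re w -ℝ im z *ℝ im w) +i (re z *ℝ im w +ℝ im z *ℝ re w)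

_^ℂ_ : ℂ → ℕ → ℂ
z ^ℂ zero  = 1ℂ
z ^ℂ suc k = z *ℂ (z ^ℂ k)

_∙ℂ_ : ℚ → ℂ → ℂ
q ∙ℂ z = (fromℚ q *ℝ re z) +i (fromℚ q *ℝ im z)

-- expTerm z k is zᵏ / k!

expTerm : ℂ → ℕ → ℂ
expTerm z zero    = 1ℂ
expTerm z (suc k) = 1/suc k ∙ℂ (expTerm z k *ℂ z)

expSum : ℂ → ℕ → ℂ
expSum z zero    = 0ℂ
expSum z (suc k) = expSum z k +ℂ expTerm z k

∥_∥₁ : ℂ → ℕ → ℚ
∥ z ∥₁ n = ℚ.∣ approx (re z) n ∣ ℚ.+ ℚ.∣ approx (im z) n ∣

0≤∥∥₁ : ∀ z n → 0ℚ ℚ.≤ ∥ z ∥₁ n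
0≤∥∥₁ z n = ℚ.+-mono-≤ {0ℚ} (ℚ.0≤∣p∣ (approx (re z) n)) (ℚ.0≤∣p∣ (approx (im z) n))

∥∥₁-bounded : ∀ z → ∃₂ λ B N → ∀ n → N ℕ.≤ n → ∥ z ∥₁ n ℚ.≤ B
∥∥₁-bounded z = proj₁ br ℚ.+ proj₁ bi , N ℕ.⊔ N′ , λ n N≤n → ℚ.+-mono-≤
    (proj₂ (proj₂ (proj₂ br)) n (ℕ.m⊔n≤o⇒m≤o N N′ N≤n))
    (proj₂ (proj₂ (proj₂ bi)) n (ℕ.m⊔n≤o⇒n≤o N N′ N≤n))
  where
  br = cauchy⇒bounded {approx (re z)} (cauchy (re z))
  bi = cauchy⇒bounded {approx (im z)} (cauchy (im z))
  N = proj₁ (proj₂ br)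
  N′ = proj₁ (proj₂ bi)

∣pq∣-bound : ∀ a b c d →
  ℚ.∣ a ℚ.* c ℚ.- b ℚ.* d ∣ ℚ.+ ℚ.∣ a ℚ.* d ℚ.+ b ℚ.* c ∣ ℚ.≤
  (ℚ.∣ a ∣ ℚ.+ ℚ.∣ b ∣) ℚ.* (ℚ.∣ c ∣ ℚ.+ ℚ.∣ d ∣)
∣pq∣-bound a b c d = begin
  ℚ.∣ a ℚ.* c ℚ.- b ℚ.* d ∣ ℚ.+ ℚ.∣ a ℚ.* d ℚ.+ b ℚ.* c ∣
    ≤⟨ ℚ.+-mono-≤ (ℚ.∣p-q∣≤∣p∣+∣q∣ (a ℚ.* c) (b ℚ.* d))
                  (ℚ.∣p+q∣≤∣p∣+∣q∣ (a ℚ.* d) (b ℚ.* c)) ⟩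
  (ℚ.∣ a ℚ.* c ∣ ℚ.+ ℚ.∣ b ℚ.* d ∣) ℚ.+ (ℚ.∣ a ℚ.* d ∣ ℚ.+ ℚ.∣ b ℚ.* c ∣)
    ≡⟨ cong₂ ℚ._+_ (cong₂ ℚ._+_ (ℚ.∣p*q∣≡∣p∣*∣q∣ a c) (ℚ.∣p*q∣≡∣p∣*∣q∣ b d))
                   (cong₂ ℚ._+_ (ℚ.∣p*q∣≡∣p∣*∣q∣ a d) (ℚ.∣p*q∣≡∣p∣*∣q∣ b c)) ⟩
  (ℚ.∣ a ∣ ℚ.* ℚ.∣ c ∣ ℚ.+ ℚ.∣ b ∣ ℚ.* ℚ.∣ d ∣) ℚ.+
  (ℚ.∣ a ∣ ℚ.* ℚ.∣ d ∣ ℚ.+ ℚ.∣ b ∣ ℚ.* ℚ.∣ c ∣)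
    ≡⟨ expand ℚ.∣ a ∣ ℚ.∣ b ∣ ℚ.∣ c ∣ ℚ.∣ d ∣ ⟩
  (ℚ.∣ a ∣ ℚ.+ ℚ.∣ b ∣) ℚ.* (ℚ.∣ c ∣ ℚ.+ ℚ.∣ d ∣) ∎
  where
  open ℚ.≤-Reasoning
  expand : ∀ a b c d → (a ℚ.* c ℚ.+ b ℚ.* d) ℚ.+ (a ℚ.* d ℚ.+ b ℚ.* c) ≡
                       (a ℚ.+ b) ℚ.* (c ℚ.+ d)
  expand = solve 4 (λ a b c d →
    (a :* c :+ b :* d) :+ (a :* d :+ b :* c) := (a :+ b) :* (c :+ d)) refl
    where open +-*-Solver

∥∥₁-* : ∀ z w n → ∥ z *ℂ w ∥₁ n ℚ.≤ ∥ z ∥₁ n ℚ.* ∥ w ∥₁ n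
∥∥₁-* z w n = ∣pq∣-bound (approx (re z) n) (approx (im z) n) (approx (re w) n) (approx (im w) n)

∥∥₁-∙ : ∀ q z n → 0ℚ ℚ.≤ q → ∥ q ∙ℂ z ∥₁ n ≡ q ℚ.* ∥ z ∥₁ n
∥∥₁-∙ q z n 0≤q = trans (cong₂ ℚ._+_ (part (approx (re z) n)) (part (approx (im z) n)))
  (sym (ℚ.*-distribˡ-+ q ℚ.∣ approx (re z) n ∣ ℚ.∣ approx (im z) n ∣))
  where
  part : ∀ p → ℚ.∣ q ℚ.* p ∣ ≡ q ℚ.* ℚ.∣ p ∣
  part p = trans (ℚ.∣p*q∣≡∣p∣*∣q∣ q p) (cong (ℚ._* ℚ.∣ p ∣) (ℚ.0≤p⇒∣p∣≡p 0≤q))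

expTerm-halves : ∀ z {K} n k → ∥ z ∥₁ n ℚ.≤ K → K ℚ.* 1/suc k ℚ.≤ ½ →
                 ∥ expTerm z (suc k) ∥₁ n ℚ.≤ ½ ℚ.* ∥ expTerm z k ∥₁ n
expTerm-halves z {K} n k z≤K K/k≤½ = begin
  ∥ 1/suc k ∙ℂ (expTerm z k *ℂ z) ∥₁ n
    ≡⟨ ∥∥₁-∙ (1/suc k) (expTerm z k *ℂ z) n (0≤1/suc k) ⟩
  1/suc k ℚ.* ∥ expTerm z k *ℂ z ∥₁ n
    ≤⟨ *-monoˡ (0≤1/suc k) (∥∥₁-* (expTerm z k) z n) ⟩
  1/suc k ℚ.* (t ℚ.* ∥ z ∥₁ n)
    ≤⟨ *-monoˡ (0≤1/suc k) (*-monoˡ 0≤t z≤K) ⟩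
  1/suc k ℚ.* (t ℚ.* K)
    ≡⟨ rearrange (1/suc k) t K ⟩
  t ℚ.* (K ℚ.* 1/suc k)
    ≤⟨ *-monoˡ 0≤t K/k≤½ ⟩
  t ℚ.* ½
    ≡⟨ ℚ.*-comm t ½ ⟩
  ½ ℚ.* t ∎
  where
  open ℚ.≤-Reasoning
  t = ∥ expTerm z k ∥₁ n
  0≤t = 0≤∥∥₁ (expTerm z k) n
  *-monoˡ : ∀ {r p q} → 0ℚ ℚ.≤ r → p ℚ.≤ q → r ℚ.* p ℚ.≤ r ℚ.* q
  *-monoˡ {r} 0≤r = ℚ.*-monoˡ-≤-nonNeg r {{ℚ.nonNegative 0≤r}}
  rearrange : ∀ i t k → i ℚ.* (t ℚ.* k) ≡ t ℚ.* (k ℚ.* i)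
  rearrange = solve 3 (λ i t k → i :* (t :* k) := t :* (k :* i)) refl
    where open +-*-Solver

expTerm-decays : ∀ z {K B} n p₀ → ∥ z ∥₁ n ℚ.≤ K →
  (∀ k → p₀ ℕ.≤ k → K ℚ.* 1/suc k ℚ.≤ ½) →
  0ℚ ℚ.≤ B → ∥ expTerm z p₀ ∥₁ n ℚ.≤ B →
  ∀ e → ∥ expTerm z (e ℕ.+ p₀) ∥₁ n ℚ.≤ B ℚ.* 1/suc e
expTerm-decays z {K} {B} n p₀ z≤K h 0≤B t≤B zero =
  ℚ.≤-trans t≤B (ℚ.≤-reflexive (sym (ℚ.*-identityʳ B)))
expTerm-decays z {K} {B} n p₀ z≤K h 0≤B t≤B (suc e) = begin
  ∥ expTerm z (suc (e ℕ.+ p₀)) ∥₁ n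
    ≤⟨ expTerm-halves z n (e ℕ.+ p₀) z≤K (h (e ℕ.+ p₀) (ℕ.m≤n+m p₀ e)) ⟩
  ½ ℚ.* ∥ expTerm z (e ℕ.+ p₀) ∥₁ n
    ≤⟨ ℚ.*-monoˡ-≤-nonNeg ½ (expTerm-decays z n p₀ z≤K h 0≤B t≤B e) ⟩
  ½ ℚ.* (B ℚ.* 1/suc e)
    ≡⟨ rearrange ½ B (1/suc e) ⟩
  B ℚ.* (½ ℚ.* 1/suc e)
    ≤⟨ ℚ.*-monoˡ-≤-nonNeg B {{ℚ.nonNegative 0≤B}} (½*1/suc≤ e) ⟩
  B ℚ.* 1/suc (suc e) ∎
  where
  open ℚ.≤-Reasoning
  rearrange : ∀ h b i → h ℚ.* (b ℚ.* i) ≡ b ℚ.* (h ℚ.* i)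
  rearrange = solve 3 (λ h b i → h :* (b :* i) := b :* (h :* i)) refl
    where open +-*-Solver

expTail : ℂ → ℕ → ℕ → ℕ → ℚ
expTail z p d n =
  ℚ.∣ approx (re (expSum z (d ℕ.+ p))) n ℚ.- approx (re (expSum z p)) n ∣ ℚ.+
  ℚ.∣ approx (im (expSum z (d ℕ.+ p))) n ℚ.- approx (im (expSum z p)) n ∣

∣∣-shift : ∀ s t u → ℚ.∣ (s ℚ.+ t) ℚ.- u ∣ ℚ.≤ ℚ.∣ s ℚ.- u ∣ ℚ.+ ℚ.∣ t ∣
∣∣-shift s t u = subst (λ v → ℚ.∣ v ∣ ℚ.≤ ℚ.∣ s ℚ.- u ∣ ℚ.+ ℚ.∣ t ∣)
  (solve 3 (λ s t u → (s :- u) :+ t := (s :+ t) :- u) refl s t u)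
  (ℚ.∣p+q∣≤∣p∣+∣q∣ (s ℚ.- u) t)
  where open +-*-Solver

expTail-suc : ∀ z p d n →
  expTail z p (suc d) n ℚ.≤ expTail z p d n ℚ.+ ∥ expTerm z (d ℕ.+ p) ∥₁ n
expTail-suc z p d n = ℚ.≤-trans
  (ℚ.+-mono-≤
    (∣∣-shift (part re S) (part re t) (part re (expSum z p)))
    (∣∣-shift (part im S) (part im t) (part im (expSum z p))))
  (ℚ.≤-reflexive (interchange
    ℚ.∣ part re S ℚ.- part re (expSum z p) ∣ ℚ.∣ part re t ∣
    ℚ.∣ part im S ℚ.- part im (expSum z p) ∣ ℚ.∣ part im t ∣))
  where
  S = expSum z (d ℕ.+ p)
  t = expTerm z (d ℕ.+ p)
  part : (ℂ → ℝ) → ℂ → ℚ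
  part f w = approx (f w) n
  interchange : ∀ a b c d → (a ℚ.+ b) ℚ.+ (c ℚ.+ d) ≡ (a ℚ.+ c) ℚ.+ (b ℚ.+ d)
  interchange = solve 4 (λ a b c d →
    (a :+ b) :+ (c :+ d) := (a :+ c) :+ (b :+ d)) refl
    where open +-*-Solver

expTail-bound : ∀ z {K} n p → ∥ z ∥₁ n ℚ.≤ K →
  (∀ k → p ℕ.≤ k → K ℚ.* 1/suc k ℚ.≤ ½) → ∀ d →
  expTail z p d n ℚ.+ (∥ expTerm z (d ℕ.+ p) ∥₁ n ℚ.+ ∥ expTerm z (d ℕ.+ p) ∥₁ n) ℚ.≤
  ∥ expTerm z p ∥₁ n ℚ.+ ∥ expTerm z p ∥₁ n
expTail-bound z n p z≤K h zero = ℚ.≤-reflexive (trans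
  (cong (ℚ._+ (t ℚ.+ t)) (cong₂ ℚ._+_
    (cong ℚ.∣_∣ (ℚ.+-inverseʳ (approx (re (expSum z p)) n)))
    (cong ℚ.∣_∣ (ℚ.+-inverseʳ (approx (im (expSum z p)) n)))))
  (ℚ.+-identityˡ (t ℚ.+ t)))
  where t = ∥ expTerm z p ∥₁ n
expTail-bound z {K} n p z≤K h (suc d) = begin
  expTail z p (suc d) n ℚ.+ (t′ ℚ.+ t′)
    ≤⟨ ℚ.+-mono-≤ (expTail-suc z p d n) (ℚ.+-mono-≤ t′≤ t′≤) ⟩
  (expTail z p d n ℚ.+ t) ℚ.+ (½ ℚ.* t ℚ.+ ½ ℚ.* t)
    ≡⟨ cong ((expTail z p d n ℚ.+ t) ℚ.+_) (halves t) ⟩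
  (expTail z p d n ℚ.+ t) ℚ.+ t
    ≡⟨ ℚ.+-assoc (expTail z p d n) t t ⟩
  expTail z p d n ℚ.+ (t ℚ.+ t)
    ≤⟨ expTail-bound z n p z≤K h d ⟩
  ∥ expTerm z p ∥₁ n ℚ.+ ∥ expTerm z p ∥₁ n ∎
  where
  open ℚ.≤-Reasoning
  t = ∥ expTerm z (d ℕ.+ p) ∥₁ n
  t′ = ∥ expTerm z (suc (d ℕ.+ p)) ∥₁ n
  t′≤ : t′ ℚ.≤ ½ ℚ.* t
  t′≤ = expTerm-halves z n (d ℕ.+ p) z≤K (h (d ℕ.+ p) (ℕ.m≤n+m p d))

p≤p+q : ∀ p q → 0ℚ ℚ.≤ q → p ℚ.≤ p ℚ.+ q
p≤p+q p q 0≤q = subst (ℚ._≤ p ℚ.+ q) (ℚ.+-identityʳ p) (ℚ.+-monoʳ-≤ p 0≤q)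

expSum-tail : ∀ z ε → 0ℚ ℚ.< ε → ∃₂ λ p N → ∀ d n → N ℕ.≤ n → expTail z p d n ℚ.≤ ε
expSum-tail z ε ε>0 = p , N₁ ℕ.⊔ N₂ , λ d n N≤n → bound d n
    (K-bound n (ℕ.m⊔n≤o⇒m≤o N₁ N₂ N≤n)) (t-bound n (ℕ.m⊔n≤o⇒n≤o N₁ N₂ N≤n))
  where
  open ℚ.≤-Reasoning
  K = proj₁ (∥∥₁-bounded z)
  N₁ = proj₁ (proj₂ (∥∥₁-bounded z))
  K-bound = proj₂ (proj₂ (∥∥₁-bounded z))
  p₀ = proj₁ (archimedean K half-pos)
    where half-pos = ℚ.positive⁻¹ ½
  halving = proj₂ (archimedean K (ℚ.positive⁻¹ ½))
  B = proj₁ (∥∥₁-bounded (expTerm z p₀))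
  N₂ = proj₁ (proj₂ (∥∥₁-bounded (expTerm z p₀)))
  t-bound = proj₂ (proj₂ (∥∥₁-bounded (expTerm z p₀)))
  e = proj₁ (archimedean (B ℚ.+ B) ε>0)
  small = proj₂ (archimedean (B ℚ.+ B) ε>0)
  p = e ℕ.+ p₀
  bound : ∀ d n → ∥ z ∥₁ n ℚ.≤ K → ∥ expTerm z p₀ ∥₁ n ℚ.≤ B → expTail z p d n ℚ.≤ ε
  bound d n z≤K t≤B = begin
    expTail z p d n
      ≤⟨ p≤p+q (expTail z p d n) _ (ℚ.+-mono-≤ {0ℚ} 0≤t 0≤t) ⟩
    expTail z p d n ℚ.+ (t ℚ.+ t)
      ≤⟨ expTail-bound z n p z≤K (λ k p≤k → halving k (ℕ.≤-trans (ℕ.m≤n+m p₀ e) p≤k)) d ⟩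
    ∥ expTerm z p ∥₁ n ℚ.+ ∥ expTerm z p ∥₁ n
      ≤⟨ ℚ.+-mono-≤ decays decays ⟩
    B ℚ.* 1/suc e ℚ.+ B ℚ.* 1/suc e
      ≡⟨ ℚ.*-distribʳ-+ (1/suc e) B B ⟨
    (B ℚ.+ B) ℚ.* 1/suc e
      ≤⟨ small e ℕ.≤-refl ⟩
    ε ∎
    where
    t = ∥ expTerm z (d ℕ.+ p) ∥₁ n
    0≤t = 0≤∥∥₁ (expTerm z (d ℕ.+ p)) n
    decays = expTerm-decays z n p₀ z≤K halving
      (ℚ.≤-trans (0≤∥∥₁ (expTerm z p₀) n) t≤B) t≤B e

q≤p+q : ∀ p q → 0ℚ ℚ.≤ p → q ℚ.≤ p ℚ.+ q
q≤p+q p q 0≤p = subst (q ℚ.≤_) (ℚ.+-comm q p) (p≤p+q q p 0≤p)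

expSum-tail-re : ∀ z → IsTailCauchy (λ k → re (expSum z k))
expSum-tail-re z ε ε>0 = p , proj₁ (proj₂ tail) , λ m n p≤m N≤n →
  subst (λ k → ℚ.∣ approx (re (expSum z k)) n ℚ.- approx (re (expSum z p)) n ∣ ℚ.≤ ε)
    (ℕ.m∸n+n≡m p≤m)
    (ℚ.≤-trans (p≤p+q (real (m ℕ.∸ p) n) (imag (m ℕ.∸ p) n) (ℚ.0≤∣p∣ (imag₀ (m ℕ.∸ p) n)))
      (proj₂ (proj₂ tail) (m ℕ.∸ p) n N≤n))
  where
  tail = expSum-tail z ε ε>0
  p = proj₁ tail
  real imag imag₀ : ℕ → ℕ → ℚ
  real d n = ℚ.∣ approx (re (expSum z (d ℕ.+ p))) n ℚ.- approx (re (expSum z p)) n ∣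
  imag₀ d n = approx (im (expSum z (d ℕ.+ p))) n ℚ.- approx (im (expSum z p)) n
  imag d n = ℚ.∣ imag₀ d n ∣

expSum-tail-im : ∀ z → IsTailCauchy (λ k → im (expSum z k))
expSum-tail-im z ε ε>0 = p , proj₁ (proj₂ tail) , λ m n p≤m N≤n →
  subst (λ k → ℚ.∣ approx (im (expSum z k)) n ℚ.- approx (im (expSum z p)) n ∣ ℚ.≤ ε)
    (ℕ.m∸n+n≡m p≤m)
    (ℚ.≤-trans (q≤p+q (real (m ℕ.∸ p) n) (imag (m ℕ.∸ p) n) (ℚ.0≤∣p∣ (real₀ (m ℕ.∸ p) n)))
      (proj₂ (proj₂ tail) (m ℕ.∸ p) n N≤n))
  where
  tail = expSum-tail z ε ε>0
  p = proj₁ tail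
  real real₀ imag : ℕ → ℕ → ℚ
  real₀ d n = approx (re (expSum z (d ℕ.+ p))) n ℚ.- approx (re (expSum z p)) n
  real d n = ℚ.∣ real₀ d n ∣
  imag d n = ℚ.∣ approx (im (expSum z (d ℕ.+ p))) n ℚ.- approx (im (expSum z p)) n ∣

opaque
  exp : ℂ → ℂ
  exp z = lim (λ k → re (expSum z k)) (expSum-tail-re z)
       +i lim (λ k → im (expSum z k)) (expSum-tail-im z)

  re-exp : ∀ z n → approx (re (exp z)) n ≡ approx (re (expSum z n)) n
  re-exp z n = refl

  im-exp : ∀ z n → approx (im (exp z)) n ≡ approx (im (expSum z n)) n
  im-exp z n = refl

exp[𝕚_] : ℝ → ℂ
exp[𝕚 x ] = exp (𝕚 *ℂ ofReal x)

sin : ℝ → ℝ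
sin x = im exp[𝕚 x ]

-- π is the least positive zero of the sine.

record IsPi (π : ℝ) : Set where
  field
    positive : 0ℝ <ℝ π
    root     : sin π ≃ℝ 0ℝ
    least    : ∀ x → 0ℝ <ℝ x → x <ℝ π → ¬ (sin x ≃ℝ 0ℝ)

Laurent : ℕ → Set
Laurent n = List (ℚ × Vec ℤ n)

-- A Laurent polynomial is a formal sum of terms q · ∏ⱼ Xⱼ^eⱼ, in which the same
-- exponent vector may be repeated; coefficients collect these repetitions.

infixl 6 _+ᴸ_
infixl 7 _*ᴸ_

const : ∀ {n} → ℚ → Laurent n
const {n} q = (q , Vec.replicate n 0ℤ) ∷ []

X X⁻¹ : ∀ {n} → Fin n → Laurent n
X   {n} j = (1ℚ , Vec.replicate n 0ℤ Vec.[ j ]≔ 1ℤ) ∷ []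
X⁻¹ {n} j = (1ℚ , Vec.replicate n 0ℤ Vec.[ j ]≔ -1ℤ) ∷ []

_+ᴸ_ : ∀ {n} → Laurent n → Laurent n → Laurent n
_+ᴸ_ = _++_

_*ᴸ_ : ∀ {n} → Laurent n → Laurent n → Laurent n
_*ᴸ_ = List.cartesianProductWith λ (q , e) (r , d) → q ℚ.* r , Vec.zipWith ℤ._+_ e d

∏ᴸ : ∀ {n k} → (Fin k → Laurent n) → Laurent n
∏ᴸ = foldr _*ᴸ_ (const 1ℚ)

coefficient : ∀ {n} → Vec ℤ n → Laurent n → ℚ
coefficient e =
  List.foldr (λ (q , d) s → if does (Vec.≡-dec ℤ._≟_ d e) then q ℚ.+ s else s) 0ℚ

constantTerm : ∀ {n} → Laurent n → ℚ
constantTerm {n} = coefficient (Vec.replicate n 0ℤ)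

record ℂˣ : Set where
  field
    value inverse : ℂ
    isInverse     : value *ℂ inverse ≃ℂ 1ℂ

open ℂˣ public

infixr 8 _^ℤ_

_^ℤ_ : ℂˣ → ℤ → ℂ
u ^ℤ (+ k)    = value u ^ℂ k
u ^ℤ -[1+ k ] = inverse u ^ℂ suc k

eval : ∀ {n} → Laurent n → (Fin n → ℂˣ) → ℂ
eval f x = List.foldr
  (λ (q , e) s → ofReal (fromℚ q) *ℂ foldr _*ℂ_ 1ℂ (λ j → x j ^ℤ Vec.lookup e j) +ℂ s)
  0ℂ f

-- The literal occurrences are numbered so that clause c consists of the
-- occurrences combine c 0, combine c 1, combine c 2, i.e. 3c, 3c+1, 3c+2 when
-- counting from zero.

record CNF (M N : ℕ) : Set where
  field
    var  : Fin (M ℕ.* 3) → Fin N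
    sign : Fin (M ℕ.* 3) → Sign

  occurrences : Fin N → List (Fin (M ℕ.* 3))
  occurrences s = List.filter (λ a → var a Fin.≟ s) (List.allFin (M ℕ.* 3))

  r : Fin N → ℕ
  r s = List.length (occurrences s)

  occurrence : (s : Fin N) → Fin (r s) → Fin (M ℕ.* 3)
  occurrence s = List.lookup (occurrences s)

  field
    r≥1 : ∀ s → 1 ℕ.≤ r s

  ε : (s : Fin N) → Fin (r s) → ℚ
  ε s t = (sign (occurrence s t) ℤ.◃ 1) ℚ./ 1

logicalFormula : ∀ {M N} → CNF M N → Laurent (M ℕ.* 3)
logicalFormula {M} φ =
  const (ℚ._/_ (+ 1) (2 ℕ.^ (6 ℕ.* M ℕ.∸ 1)) {{ℕ.m^n≢0 2 (6 ℕ.* M ℕ.∸ 1)}})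
  *ᴸ ∏ᴸ (λ (c : Fin M) → X-1 (combine c zero) *ᴸ X-1 (combine c (suc zero))
                       *ᴸ X-1 (combine c (suc (suc zero))) +ᴸ const (+ 8 ℚ./ 1))
  *ᴸ ∏ᴸ (λ s → ∏ᴸ (λ t → const (ε s t) *ᴸ X⁻¹ (occurrence s t) +ᴸ const 1ℚ)
            +ᴸ ∏ᴸ (λ t → const (ℚ.- ε s t) *ᴸ X⁻¹ (occurrence s t) +ᴸ const 1ℚ))
  +ᴸ const (ℚ.- 1ℚ)
  where
  open CNF φ
  X-1 : Fin (M ℕ.* 3) → Laurent (M ℕ.* 3)
  X-1 a = X a +ᴸ const (ℚ.- 1ℚ)

-- finToFun reads off base-3 digits; the digits 0, 1, 2 stand for the exponents
-- 0, 1, -1. Only the index 0 has all digits 0, so the non-zero vectors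
-- correspond to 1 ≤ k ≤ 3ⁿ - 1, which is shifted to Fin (3ⁿ ∸ 1).

digit : Fin 3 → ℤ
digit zero             = 0ℤ
digit (suc zero)       = 1ℤ
digit (suc (suc zero)) = -1ℤ

exponents : ∀ {n} → Fin (3 ℕ.^ n ℕ.∸ 1) → Fin n → ℤ
exponents {n} k j =
  digit (finToFun (Fin.cast (ℕ.suc-pred (3 ℕ.^ n) {{ℕ.m^n≢0 3 n}}) (suc k)) j)

frequency : ∀ {n} → (Fin n → ℝ) → Fin (3 ℕ.^ n ℕ.∸ 1) → ℝ
frequency a k = foldr _+ℝ_ 0ℝ λ j → fromℤ (exponents k j) *ℝ a j

frequencyℤ : ∀ {n} → (Fin n → ℤ) → Fin (3 ℕ.^ n ℕ.∸ 1) → ℤ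
frequencyℤ a k = foldr ℤ._+_ 0ℤ λ j → exponents k j ℤ.* a j

-- The value on the empty family is a placeholder; for n ≥ 1 the indices of
-- the non-zero exponent vectors form a non-empty type.

minimum : ∀ {m} → (Fin m → ℝ) → ℝ
minimum {zero}        F = 0ℝ
minimum {suc zero}    F = F zero
minimum {suc (suc m)} F = F zero ⊓ℝ minimum (λ k → F (suc k))

module Coefficients (π : ℝ) (n : ℕ) where

  -- n² + j with j counted from one
  n²+ : Fin n → ℝ
  n²+ j = fromℕ (n ℕ.* n ℕ.+ suc (toℕ j))

  π/2 3π 1/[n²+1] : ℝ
  π/2 = fromℚ ½ *ℝ π
  3π = fromℕ 3 *ℝ π
  1/[n²+1] = fromℚ (1/suc (n ℕ.* n))

  a b c d : Fin n → ℝ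
  a j = sin (n²+ j)
  b j = sin (n²+ j *ℝ (1ℝ +ℝ π/2 *ℝ 1/[n²+1]))
  c j = sin (n²+ j *ℝ (1ℝ +ℝ 3π *ℝ 1/[n²+1]))
  d j = sin (n²+ j *ℝ (1ℝ +ℝ 3π *ℝ 1/[n²+1] +ℝ π/2 *ℝ 1/[n²+1]))

  A B C D : Fin (3 ℕ.^ n ℕ.∸ 1) → ℝ
  A = frequency a
  B = frequency b
  C = frequency c
  D = frequency d

  μ : ℝ
  μ = minimum λ k → ∣ A k ∣ℝ ⊔ℝ ∣ B k ∣ℝ ⊔ℝ ∣ C k ∣ℝ ⊔ℝ ∣ D k ∣ℝ

-- Rounding to the nearest integer; either neighbour of a half-integer qualifies.

IsRounding : ℤ → ℝ → Set
IsRounding i x = ∣ x -ℝ fromℤ i ∣ℝ ≤ℝ fromℚ ½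

record Integerization (n : ℕ) : Set where
  field
    multiplier      : ℤ
    z′a z′b z′c z′d : Fin n → ℤ

  z′A z′B z′C z′D : Fin (3 ℕ.^ n ℕ.∸ 1) → ℤ
  z′A = frequencyℤ z′a
  z′B = frequencyℤ z′b
  z′C = frequencyℤ z′c
  z′D = frequencyℤ z′d

  maximalMaximum : ℕ
  maximalMaximum = foldr ℕ._⊔_ 0 λ k →
    ℤ.∣ z′A k ∣ ℕ.⊔ ℤ.∣ z′B k ∣ ℕ.⊔ ℤ.∣ z′C k ∣ ℕ.⊔ ℤ.∣ z′D k ∣

open Integerization public

module _ (π : ℝ) {n : ℕ} (z′ : Integerization n) where
  open Coefficients π n

  Rounds : Set
  Rounds = ∀ j →
    IsRounding (z′a z′ j) (fromℤ (multiplier z′) *ℝ a j) ×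
    IsRounding (z′b z′ j) (fromℤ (multiplier z′) *ℝ b j) ×
    IsRounding (z′c z′ j) (fromℤ (multiplier z′) *ℝ c j) ×
    IsRounding (z′d z′ j) (fromℤ (multiplier z′) *ℝ d j)

  SeparatesFromZero : Set
  SeparatesFromZero = ∀ k →
    (μ ≤ℝ ∣ A k ∣ℝ → z′A z′ k ≢ 0ℤ) ×
    (μ ≤ℝ ∣ B k ∣ℝ → z′B z′ k ≢ 0ℤ) ×
    (μ ≤ℝ ∣ C k ∣ℝ → z′C z′ k ≢ 0ℤ) ×
    (μ ≤ℝ ∣ D k ∣ℝ → z′D z′ k ≢ 0ℤ)

infix 9 _/ℝ_

_/ℝ_ : ℝ → (l : ℕ) .{{_ : NonZero l}} → ℝ
x /ℝ l = x *ℝ fromℚ (+ 1 ℚ./ l)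

∑₁ : ℕ → (ℕ → ℂ) → ℂ
∑₁ zero    F = 0ℂ
∑₁ (suc l) F = ∑₁ l F +ℂ F (suc l)

∑₁⁴ : ℕ → (ℕ → ℕ → ℕ → ℕ → ℂ) → ℂ
∑₁⁴ l F = ∑₁ l λ m₁ → ∑₁ l λ m₂ → ∑₁ l λ m₃ → ∑₁ l λ m₄ → F m₁ m₂ m₃ m₄

{-# OPTIONS --safe #-}

-- The exponent vectors of f lie in {-1,0,1}ⁿ, because every Xⱼ enters exactly one clause
-- factor, with exponent 0 or 1, and exactly one literal factor, with exponent 0 or -1. A
-- non-constant monomial thus is some exp(i(z′A_k x + z′B_k y + z′C_k z + z′D_k w)), whose sum
-- over the grid is a product of four geometric sums of l-th roots of unity. One of the four
-- frequencies is non-zero by the choice of z′ and smaller than l in absolute value, so the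
-- ratio of its geometric sum is not 1 and the sum vanishes; only the constant term survives.
--
-- The functional equation of exp is the binomial theorem for the terms zᵏ/k!, up to the terms
-- zⁱwʲ/(i!j!) with i,j < n ≤ i + j, which are damped by ½ⁿ after doubling z and w. As π is
-- given as the least positive zero of the sine, exp(2πi) = 1 and exp(2πip/l) ≠ 1 come from
-- comparing a point of the unit circle with its conjugate.

module Submission where

open import Defs
open import Algebra.Bundles using (CommutativeRing)
import Algebra.Properties.CommutativeSemigroup as CommutativeSemigroupProperties
import Algebra.Properties.Ring as RingProperties
open import Data.Bool.Base using (if_then_else_)
open import Data.Empty using (⊥; ⊥-elim)
open import Data.Fin.Base as Fin using (Fin; zero; suc; combine; finToFun; funToFin)
import Data.Fin.Properties as Fin
open import Data.Integer.Base as ℤ using (ℤ; +_; -[1+_]; 0ℤ; 1ℤ; -1ℤ)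
import Data.Integer.Properties as ℤ
open import Data.List.Base as List using (List; []; _∷_)
open import Data.List.Membership.Propositional.Properties using (∈-lookup)
open import Data.List.Relation.Unary.All as All using (All; []; _∷_)
import Data.List.Relation.Unary.All.Properties as All
open import Data.List.Relation.Unary.Unique.Propositional using (Unique; _∷_)
import Data.List.Relation.Unary.Unique.Propositional.Properties as Unique
open import Data.Nat.Base as ℕ using (ℕ; zero; suc; NonZero)
import Data.Nat.Properties as ℕ
open import Data.Product.Base using (∃; _×_; _,_; proj₁; proj₂)
open import Data.Rational.Base as ℚ using (ℚ; 0ℚ; 1ℚ; ½)
import Data.Rational.Properties as ℚ
open import Data.Rational.Solver using (module +-*-Solver)
import Data.Rational.Unnormalised.Base as ℚᵘ
import Data.Rational.Unnormalised.Properties as ℚᵘ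
open import Data.Sum.Base as Sum using (_⊎_; inj₁; inj₂)
open import Data.Vec.Base as Vec using (Vec)
open import Data.Vec.Functional using (foldr)
import Data.Vec.Properties as Vec
open import Function.Base using (_∘_)
open import Level using (0ℓ)
open import Relation.Binary.PropositionalEquality
  using (_≡_; _≢_; refl; sym; trans; cong; cong₂; subst)
open import Relation.Binary.Structures using (IsEquivalence)
import Relation.Binary.Reasoning.Setoid as SetoidReasoning
open import Relation.Nullary using (¬_; Dec; yes; no)
open import Relation.Nullary.Decidable using (dec-true; dec-false)

-- Cauchy products

-- Equality and order of reals given by Cauchy sequences are undecidable, and this shapes two steps.
-- A ratio of a geometric sum is only known not to equal 1, so `*≈0⇒≈0` cancels the factor z - 1 by
-- refuting that the sum is apart from 0; this works because equality of reals is stable under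
-- double negation. That some frequency of each quadruple is non-zero is likewise obtained only by
-- refuting the opposite, until decidable equality of integers turns the refutation into a choice.
--
-- The `n`-th approximant of `exp z` is the `n`-th partial sum formed from the `n`-th approximants
-- of `z`. Algebraic identities between partial sums therefore hold exactly at each index (`≐`), and
-- the limit enters the functional equation only through the estimate of the defect at index `n`.

module Convolution {c ℓ} (R : CommutativeRing c ℓ) where
  open CommutativeRing R renaming (sym to ≈-sym; refl to ≈-refl; trans to ≈-trans)
  open SetoidReasoning setoid
  open RingProperties ring using (-‿+-comm; -‿distribʳ-*)
  open CommutativeSemigroupProperties +-commutativeSemigroup using (interchange)
  open CommutativeSemigroupProperties *-commutativeSemigroup using (x∙yz≈y∙xz)

  ∑ : (ℕ → Carrier) → ℕ → Carrier
  ∑ f zero    = 0#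
  ∑ f (suc n) = ∑ f n + f n

  ∑-head : ∀ f n → ∑ f (suc n) ≈ f 0 + ∑ (f ∘ suc) n
  ∑-head f zero = +-comm 0# (f 0)
  ∑-head f (suc n) = ≈-trans (+-congʳ (∑-head f n)) (+-assoc _ _ _)

  ∑-cong : ∀ {f g} → (∀ k → f k ≈ g k) → ∀ n → ∑ f n ≈ ∑ g n
  ∑-cong f≈g zero    = ≈-refl
  ∑-cong f≈g (suc n) = +-cong (∑-cong f≈g n) (f≈g n)

  ∑-+ : ∀ f g n → ∑ (λ k → f k + g k) n ≈ ∑ f n + ∑ g n
  ∑-+ f g zero    = ≈-sym (+-identityˡ 0#)
  ∑-+ f g (suc n) = ≈-trans (+-congʳ (∑-+ f g n)) (interchange _ _ _ _)

  ∑-*ˡ : ∀ x f n → ∑ (λ k → x * f k) n ≈ x * ∑ f n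
  ∑-*ˡ x f zero    = ≈-sym (zeroʳ x)
  ∑-*ˡ x f (suc n) = ≈-trans (+-congʳ (∑-*ˡ x f n)) (≈-sym (distribˡ _ _ _))

  conv : (ℕ → Carrier) → (ℕ → Carrier) → ℕ → Carrier
  conv f g zero    = f 0 * g 0
  conv f g (suc k) = f 0 * g (suc k) + conv (f ∘ suc) g k

  -- triangle f g m is the sum of f i * g j over i + j < m.

  triangle : (ℕ → Carrier) → (ℕ → Carrier) → ℕ → Carrier
  triangle f g zero    = 0#
  triangle f g (suc m) = f 0 * ∑ g (suc m) + triangle (f ∘ suc) g m

  -- Row 0 of the triangle contributes one product to each antidiagonal; removing these leaves the
  -- same regrouping for the shifted `f`.
  triangle≈∑conv : ∀ f g m → triangle f g m ≈ ∑ (conv f g) m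
  triangle≈∑conv f g zero    = ≈-refl
  triangle≈∑conv f g (suc m) = begin
    f 0 * ∑ g (suc m) + triangle (f ∘ suc) g m
      ≈⟨ +-cong (*-congˡ (∑-head g m)) (triangle≈∑conv (f ∘ suc) g m) ⟩
    f 0 * (g 0 + ∑ (g ∘ suc) m) + ∑ (conv (f ∘ suc) g) m
      ≈⟨ +-congʳ (distribˡ _ _ _) ⟩
    (f 0 * g 0 + f 0 * ∑ (g ∘ suc) m) + ∑ (conv (f ∘ suc) g) m
      ≈⟨ +-assoc _ _ _ ⟩
    f 0 * g 0 + (f 0 * ∑ (g ∘ suc) m + ∑ (conv (f ∘ suc) g) m)
      ≈⟨ +-congˡ (+-congʳ (∑-*ˡ (f 0) (g ∘ suc) m)) ⟨
    f 0 * g 0 + (∑ (λ k → f 0 * g (suc k)) m + ∑ (conv (f ∘ suc) g) m)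
      ≈⟨ +-congˡ (∑-+ (λ k → f 0 * g (suc k)) (conv (f ∘ suc) g) m) ⟨
    conv f g 0 + ∑ (conv f g ∘ suc) m
      ≈⟨ ∑-head (conv f g) m ⟨
    ∑ (conv f g) (suc m) ∎

  -- Row 0 of the square exceeds row 0 of the triangle by a tail of `g`. `G` is an arbitrary element
  -- because the full sum of `g` stays fixed while the triangle shrinks in the induction on rows.
  square-triangle-suc : ∀ f g G m →
    ∑ f (suc m) * G + - triangle f g (suc m) ≈
    f 0 * (G + - ∑ g (suc m)) + (∑ (f ∘ suc) m * G + - triangle (f ∘ suc) g m)
  square-triangle-suc f g G m = begin
    ∑ f (suc m) * G + - (f 0 * S + T)
      ≈⟨ +-cong (*-congʳ (∑-head f m)) (≈-sym (-‿+-comm (f 0 * S) T)) ⟩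
    (f 0 + F) * G + (- (f 0 * S) + - T)
      ≈⟨ +-cong (distribʳ _ _ _) (+-congʳ (-‿distribʳ-* (f 0) S)) ⟩
    (f 0 * G + F * G) + (f 0 * (- S) + - T)
      ≈⟨ interchange _ _ _ _ ⟩
    (f 0 * G + f 0 * (- S)) + (F * G + - T)
      ≈⟨ +-congʳ (distribˡ _ _ _) ⟨
    f 0 * (G + - S) + (F * G + - T) ∎
    where
    S = ∑ g (suc m)
    T = triangle (f ∘ suc) g m
    F = ∑ (f ∘ suc) m

  conv-cong : ∀ {f f′ g g′} → (∀ i → f i ≈ f′ i) → (∀ i → g i ≈ g′ i) → ∀ k → conv f g k ≈ conv f′ g′ k
  conv-cong f≈ g≈ zero    = *-cong (f≈ 0) (g≈ 0)
  conv-cong f≈ g≈ (suc k) = +-cong (*-cong (f≈ 0) (g≈ (suc k))) (conv-cong (f≈ ∘ suc) g≈ k)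

  conv-+ˡ : ∀ f f′ g k → conv (λ i → f i + f′ i) g k ≈ conv f g k + conv f′ g k
  conv-+ˡ f f′ g zero    = distribʳ _ _ _
  conv-+ˡ f f′ g (suc k) =
    ≈-trans (+-cong (distribʳ _ _ _) (conv-+ˡ (f ∘ suc) (f′ ∘ suc) g k)) (interchange _ _ _ _)

  conv-*ˡ : ∀ x f g k → conv (λ i → x * f i) g k ≈ x * conv f g k
  conv-*ˡ x f g zero    = *-assoc _ _ _
  conv-*ˡ x f g (suc k) =
    ≈-trans (+-cong (*-assoc _ _ _) (conv-*ˡ x (f ∘ suc) g k)) (≈-sym (distribˡ _ _ _))

  conv-*ʳ : ∀ x f g k → conv f (λ i → x * g i) k ≈ x * conv f g k
  conv-*ʳ x f g zero    = x∙yz≈y∙xz _ _ _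
  conv-*ʳ x f g (suc k) =
    ≈-trans (+-cong (x∙yz≈y∙xz _ _ _) (conv-*ʳ x (f ∘ suc) g k)) (≈-sym (distribˡ _ _ _))

  conv-last : ∀ f g k → conv f g (suc k) ≈ conv f (g ∘ suc) k + f (suc k) * g 0
  conv-last f g zero    = ≈-refl
  conv-last f g (suc k) = ≈-trans (+-congˡ (conv-last (f ∘ suc) g k)) (≈-sym (+-assoc _ _ _))

  ι : ℕ → Carrier
  ι zero    = 0#
  ι (suc k) = 1# + ι k

  ι-suc-* : ∀ k x → ι (suc k) * x ≈ x + ι k * x
  ι-suc-* k x = ≈-trans (distribʳ _ _ _) (+-congʳ (*-identityˡ x))

  -- The Euler operator x · d/dx on coefficient sequences.

  θ : (ℕ → Carrier) → ℕ → Carrier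
  θ f i = ι i * f i

  -- The Leibniz rule: the weight k of a product of terms of degrees i and j splits as i + j.
  θ-conv : ∀ f g k → θ (conv f g) k ≈ conv (θ f) g k + conv f (θ g) k
  θ-conv f g zero = begin
    0# * (f 0 * g 0)                        ≈⟨ zeroˡ _ ⟩
    0#                                      ≈⟨ +-identityˡ 0# ⟨
    0# + 0#                                 ≈⟨ +-cong (zeroˡ (g 0)) (zeroʳ (f 0)) ⟨
    0# * g 0 + f 0 * 0#                     ≈⟨ +-cong (*-congʳ (zeroˡ (f 0))) (*-congˡ (zeroˡ (g 0))) ⟨
    0# * f 0 * g 0 + f 0 * (0# * g 0)       ∎
  θ-conv f g (suc k) = begin
    ι (suc k) * (f 0 * g (suc k) + conv f′ g k)
      ≈⟨ distribˡ _ _ _ ⟩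
    ι (suc k) * (f 0 * g (suc k)) + ι (suc k) * conv f′ g k
      ≈⟨ +-cong (x∙yz≈y∙xz _ _ _) (ι-suc-* k _) ⟩
    f 0 * θ g (suc k) + (conv f′ g k + θ (conv f′ g) k)
      ≈⟨ +-congˡ (+-congˡ (θ-conv f′ g k)) ⟩
    f 0 * θ g (suc k) + (conv f′ g k + (conv (θ f′) g k + conv f′ (θ g) k))
      ≈⟨ +-congˡ (≈-sym (+-assoc _ _ _)) ⟩
    f 0 * θ g (suc k) + ((conv f′ g k + conv (θ f′) g k) + conv f′ (θ g) k)
      ≈⟨ +-congˡ (+-congʳ (conv-+ˡ f′ (θ f′) g k)) ⟨
    f 0 * θ g (suc k) + (conv (λ i → f′ i + θ f′ i) g k + conv f′ (θ g) k)
      -- Shifting raises each weight by one, so `θ f ∘ suc` is `f′` plus `θ f′`; the extra copy of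
      -- `f′` is the one split off from `ι (suc k)`.
      ≈⟨ +-congˡ (+-congʳ (conv-cong (λ i → ι-suc-* i (f′ i)) (λ _ → ≈-refl) k)) ⟨
    f 0 * θ g (suc k) + (conv (θ f ∘ suc) g k + conv f′ (θ g) k)
      ≈⟨ +-assoc _ _ _ ⟨
    (f 0 * θ g (suc k) + conv (θ f ∘ suc) g k) + conv f′ (θ g) k
      ≈⟨ +-congʳ (+-comm _ _) ⟩
    (conv (θ f ∘ suc) g k + f 0 * θ g (suc k)) + conv f′ (θ g) k
      ≈⟨ +-assoc _ _ _ ⟩
    conv (θ f ∘ suc) g k + conv f (θ g) (suc k)
      ≈⟨ +-congʳ (+-identityˡ _) ⟨
    (0# + conv (θ f ∘ suc) g k) + conv f (θ g) (suc k)
      ≈⟨ +-congʳ (+-congʳ (≈-trans (*-congʳ (zeroˡ (f 0))) (zeroˡ (g (suc k))))) ⟨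
    conv (θ f) g (suc k) + conv f (θ g) (suc k) ∎
    where
    f′ = f ∘ suc

  -- The coefficients of e^(zx), characterised by y(0) = 1 and the differential equation y' = zy;
  -- written without division, so that it makes sense in every commutative ring.
  record IsExponential (z : Carrier) (f : ℕ → Carrier) : Set ℓ where
    field
      at-0   : f 0 ≈ 1#
      at-suc : ∀ k → ι (suc k) * f (suc k) ≈ z * f k

  open IsExponential

  -- The product rule: y' = zy and v' = wv give (yv)' = (z + w)yv. Together with uniqueness of the
  -- solution over ℂ this is the binomial theorem.
  conv-isExponential : ∀ {z w f g} → IsExponential z f → IsExponential w g →
                       IsExponential (z + w) (conv f g)
  conv-isExponential exp-f exp-g .at-0 =
    ≈-trans (*-cong (at-0 exp-f) (at-0 exp-g)) (*-identityˡ 1#)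
  conv-isExponential {z} {w} {f} {g} exp-f exp-g .at-suc k = begin
    ι (suc k) * conv f g (suc k)
      ≈⟨ θ-conv f g (suc k) ⟩
    conv (θ f) g (suc k) + conv f (θ g) (suc k)
      ≈⟨ +-cong left right ⟩
    z * conv f g k + w * conv f g k
      ≈⟨ distribʳ _ _ _ ⟨
    (z + w) * conv f g k ∎
    where
    left = begin
      0# * f 0 * g (suc k) + conv (θ f ∘ suc) g k
        ≈⟨ +-cong (≈-trans (*-congʳ (zeroˡ (f 0))) (zeroˡ _)) (conv-cong (at-suc exp-f) (λ _ → ≈-refl) k) ⟩
      0# + conv (λ i → z * f i) g k
        ≈⟨ ≈-trans (+-identityˡ _) (conv-*ˡ z f g k) ⟩
      z * conv f g k ∎
    -- `conv` recurses on its first argument, so the term of `θ g` of weight 0 has to be detached at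
    -- the far end.
    right = begin
      conv f (θ g) (suc k)
        ≈⟨ conv-last f (θ g) k ⟩
      conv f (θ g ∘ suc) k + f (suc k) * (0# * g 0)
        ≈⟨ +-cong (conv-cong (λ _ → ≈-refl) (at-suc exp-g) k) (≈-trans (*-congˡ (zeroˡ (g 0))) (zeroʳ _)) ⟩
      conv f (λ i → w * g i) k + 0#
        ≈⟨ ≈-trans (+-identityʳ _) (conv-*ʳ w f g k) ⟩
      w * conv f g k ∎

-- Real and complex numbers up to the limit

Eventually : (ℕ → Set) → Set
Eventually P = ∃ λ N → ∀ n → N ℕ.≤ n → P n

eventually-map : ∀ {P Q : ℕ → Set} → (∀ n → P n → Q n) → Eventually P → Eventually Q
eventually-map f (N , p) = N , λ n N≤n → f n (p n N≤n)

eventually-zip : ∀ {P Q R : ℕ → Set} →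
  (∀ n → P n → Q n → R n) → Eventually P → Eventually Q → Eventually R
eventually-zip f (N , p) (N′ , q) = N ℕ.⊔ N′ , λ n h →
  f n (p n (ℕ.m⊔n≤o⇒m≤o N N′ h)) (q n (ℕ.m⊔n≤o⇒n≤o N N′ h))

-- Only an upper bound: for absolute values this is convergence to 0, and `x ≃ℝ y` unfolds to it;
-- for `approx x` itself it says that `x` is at most 0.
Null : (ℕ → ℚ) → Set
Null u = ∀ ε → 0ℚ ℚ.< ε → Eventually λ n → u n ℚ.≤ ε

null-≤ : ∀ {u v} → (∀ n → u n ℚ.≤ v n) → Null v → Null u
null-≤ u≤v v→0 ε ε>0 = eventually-map (λ n → ℚ.≤-trans (u≤v n)) (v→0 ε ε>0)

null-+ : ∀ {u v} → Null u → Null v → Null (λ n → u n ℚ.+ v n)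
null-+ {u} {v} u→0 v→0 ε ε>0 = eventually-zip
  (λ n p q → subst (u n ℚ.+ v n ℚ.≤_) (halves ε) (ℚ.+-mono-≤ p q))
  (u→0 (½ ℚ.* ε) (half>0 ε>0)) (v→0 (½ ℚ.* ε) (half>0 ε>0))

null-squeeze : ∀ {u v B} → 0ℚ ℚ.< B → Eventually (λ n → u n ℚ.≤ B ℚ.* v n) → Null v → Null u
null-squeeze {u} {v} {B} B>0 u≤ v→0 ε ε>0 = eventually-zip
  (λ n p q → subst (u n ℚ.≤_) Bδ≡ε
    (ℚ.≤-trans p (ℚ.*-monoˡ-≤-nonNeg B {{ℚ.nonNegative (ℚ.<⇒≤ B>0)}} q)))
  u≤ (v→0 δ δ>0)
  where
  δ = proj₁ (divide B>0 ε>0)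
  δ>0 = proj₁ (proj₂ (divide B>0 ε>0))
  Bδ≡ε = proj₂ (proj₂ (divide B>0 ε>0))

null-0 : Null (λ _ → 0ℚ)
null-0 ε ε>0 = 0 , λ _ _ → ℚ.<⇒≤ ε>0

≃ℝ-pointwise : ∀ x y → (∀ n → approx x n ≡ approx y n) → x ≃ℝ y
≃ℝ-pointwise x y x≡y = null-≤
  (λ n → ℚ.≤-reflexive (cong ℚ.∣_∣
    (trans (cong (ℚ._- approx y n) (x≡y n)) (ℚ.+-inverseʳ (approx y n)))))
  null-0

≃ℝ-sym : ∀ x y → x ≃ℝ y → y ≃ℝ x
≃ℝ-sym x y = null-≤ (λ n → ℚ.≤-reflexive (∣-∣-comm (approx y n) (approx x n)))

≃ℝ-trans : ∀ x y z → x ≃ℝ y → y ≃ℝ z → x ≃ℝ z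
≃ℝ-trans x y z x≃y y≃z = null-≤
  (λ n → ∣-∣-triangle (approx x n) (approx y n) (approx z n)) (null-+ x≃y y≃z)

+ℝ-cong : ∀ x x′ y y′ → x ≃ℝ x′ → y ≃ℝ y′ → x +ℝ y ≃ℝ x′ +ℝ y′
+ℝ-cong x x′ y y′ x≃ y≃ = null-≤
  (λ n → lipschitz-+ (approx x n) (approx y n) (approx x′ n) (approx y′ n)) (null-+ x≃ y≃)

-ℝ-cong : ∀ x x′ → x ≃ℝ x′ → -ℝ x ≃ℝ -ℝ x′
-ℝ-cong x x′ = null-≤ (λ n → lipschitz-neg (approx x n) (approx x′ n))

*ℝ-cong : ∀ x x′ y y′ → x ≃ℝ x′ → y ≃ℝ y′ → x *ℝ y ≃ℝ x′ *ℝ y′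
*ℝ-cong x x′ y y′ x≃ y≃ = null-squeeze
  (0<p+q {B} {C} (proj₁ (proj₂ (proj₂ bx))) (proj₁ (proj₂ (proj₂ by))))
  (eventually-zip bound (N , proj₂ (proj₂ (proj₂ bx))) (N′ , proj₂ (proj₂ (proj₂ by))))
  (null-+ x≃ y≃)
  where
  bx = cauchy⇒bounded {approx x} (cauchy x)
  by = cauchy⇒bounded {approx y′} (cauchy y′)
  B = proj₁ bx
  C = proj₁ by
  N = proj₁ (proj₂ bx)
  N′ = proj₁ (proj₂ by)
  bound : ∀ n → ℚ.∣ approx x n ∣ ℚ.≤ B → ℚ.∣ approx y′ n ∣ ℚ.≤ C →
    ℚ.∣ approx x n ℚ.* approx y n ℚ.- approx x′ n ℚ.* approx y′ n ∣ ℚ.≤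
    (B ℚ.+ C) ℚ.* (ℚ.∣ approx x n ℚ.- approx x′ n ∣ ℚ.+ ℚ.∣ approx y n ℚ.- approx y′ n ∣)
  bound n x≤B y′≤C = ∣*-difference∣≤ (approx x n) (approx y n) (approx x′ n) (approx y′ n)
    {B} {C} {ℚ.∣ dx ∣ ℚ.+ ℚ.∣ dy ∣}
    (ℚ.+-mono-≤ {0ℚ} {ℚ.∣ dx ∣} {0ℚ} {ℚ.∣ dy ∣} (ℚ.0≤∣p∣ dx) (ℚ.0≤∣p∣ dy)) x≤B y′≤C
    (p≤p+q ℚ.∣ dx ∣ ℚ.∣ dy ∣ (ℚ.0≤∣p∣ dy)) (q≤p+q ℚ.∣ dx ∣ ℚ.∣ dy ∣ (ℚ.0≤∣p∣ dx))
    where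
    dx = approx x n ℚ.- approx x′ n
    dy = approx y n ℚ.- approx y′ n

-- Equality at every index of the approximating sequences: the identities behind
-- the estimates for exp hold exactly, not only in the limit.

infix 4 _≐_ _≈_

record _≐_ (z w : ℂ) : Set where
  constructor pointwise
  field
    re-≡ : ∀ n → approx (re z) n ≡ approx (re w) n
    im-≡ : ∀ n → approx (im z) n ≡ approx (im w) n

open _≐_

-- A record, unlike _≃ℂ_ itself, lets z and w be inferred.

record _≈_ (z w : ℂ) : Set where
  constructor asymptotic
  field
    ≈⇒≃ : z ≃ℂ w

open _≈_

≐⇒≈ : ∀ {z w} → z ≐ w → z ≈ w
≐⇒≈ {z} {w} (pointwise r i) = asymptotic ( ≃ℝ-pointwise (re z) (re w) r , ≃ℝ-pointwise (im z) (im w) i )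

-- The ring axioms hold exactly at each index, and every congruence coarser than `≐` inherits them;
-- one construction of the ring thus serves both `≐` and `≈`.
record IsCongruence (_∼_ : ℂ → ℂ → Set) : Set where
  field
    isEquivalence : IsEquivalence _∼_
    ≐⇒∼    : ∀ {z w} → z ≐ w → z ∼ w
    +-cong : ∀ {z z′ w w′} → z ∼ z′ → w ∼ w′ → (z +ℂ w) ∼ (z′ +ℂ w′)
    *-cong : ∀ {z z′ w w′} → z ∼ z′ → w ∼ w′ → (z *ℂ w) ∼ (z′ *ℂ w′)
    -‿cong : ∀ {z z′} → z ∼ z′ → (-ℂ z) ∼ (-ℂ z′)

module _ where
  open +-*-Solver

  re-*-assoc : ∀ a b c d e f →
    (a ℚ.* c ℚ.- b ℚ.* d) ℚ.* e ℚ.- (a ℚ.* d ℚ.+ b ℚ.* c) ℚ.* f ≡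
    a ℚ.* (c ℚ.* e ℚ.- d ℚ.* f) ℚ.- b ℚ.* (c ℚ.* f ℚ.+ d ℚ.* e)
  re-*-assoc = solve 6 (λ a b c d e f →
    (a :* c :- b :* d) :* e :- (a :* d :+ b :* c) :* f :=
    a :* (c :* e :- d :* f) :- b :* (c :* f :+ d :* e)) refl

  im-*-assoc : ∀ a b c d e f →
    (a ℚ.* c ℚ.- b ℚ.* d) ℚ.* f ℚ.+ (a ℚ.* d ℚ.+ b ℚ.* c) ℚ.* e ≡
    a ℚ.* (c ℚ.* f ℚ.+ d ℚ.* e) ℚ.+ b ℚ.* (c ℚ.* e ℚ.- d ℚ.* f)
  im-*-assoc = solve 6 (λ a b c d e f →
    (a :* c :- b :* d) :* f :+ (a :* d :+ b :* c) :* e :=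
    a :* (c :* f :+ d :* e) :+ b :* (c :* e :- d :* f)) refl

  re-*-comm : ∀ a b c d → a ℚ.* c ℚ.- b ℚ.* d ≡ c ℚ.* a ℚ.- d ℚ.* b
  re-*-comm = solve 4 (λ a b c d → a :* c :- b :* d := c :* a :- d :* b) refl

  im-*-comm : ∀ a b c d → a ℚ.* d ℚ.+ b ℚ.* c ≡ c ℚ.* b ℚ.+ d ℚ.* a
  im-*-comm = solve 4 (λ a b c d → a :* d :+ b :* c := c :* b :+ d :* a) refl

  re-*-identityˡ : ∀ a b → 1ℚ ℚ.* a ℚ.- 0ℚ ℚ.* b ≡ a
  re-*-identityˡ = solve 2 (λ a b → con 1ℚ :* a :- con 0ℚ :* b := a) refl

  im-*-identityˡ : ∀ a b → 1ℚ ℚ.* b ℚ.+ 0ℚ ℚ.* a ≡ b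
  im-*-identityˡ = solve 2 (λ a b → con 1ℚ :* b :+ con 0ℚ :* a := b) refl

  re-*-distribˡ-+ : ∀ a b c d e f →
    a ℚ.* (c ℚ.+ e) ℚ.- b ℚ.* (d ℚ.+ f) ≡ (a ℚ.* c ℚ.- b ℚ.* d) ℚ.+ (a ℚ.* e ℚ.- b ℚ.* f)
  re-*-distribˡ-+ = solve 6 (λ a b c d e f →
    a :* (c :+ e) :- b :* (d :+ f) := (a :* c :- b :* d) :+ (a :* e :- b :* f)) refl

  im-*-distribˡ-+ : ∀ a b c d e f →
    a ℚ.* (d ℚ.+ f) ℚ.+ b ℚ.* (c ℚ.+ e) ≡ (a ℚ.* d ℚ.+ b ℚ.* c) ℚ.+ (a ℚ.* f ℚ.+ b ℚ.* e)
  im-*-distribˡ-+ = solve 6 (λ a b c d e f →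
    a :* (d :+ f) :+ b :* (c :+ e) := (a :* d :+ b :* c) :+ (a :* f :+ b :* e)) refl

module _ (z : ℂ) where
  private
    a b : ℕ → ℚ
    a = approx (re z)
    b = approx (im z)

  +ℂ-identityˡ : 0ℂ +ℂ z ≐ z
  +ℂ-identityˡ = pointwise (λ n → ℚ.+-identityˡ (a n)) (λ n → ℚ.+-identityˡ (b n))

  -ℂ-inverseˡ : (-ℂ z) +ℂ z ≐ 0ℂ
  -ℂ-inverseˡ = pointwise (λ n → ℚ.+-inverseˡ (a n)) (λ n → ℚ.+-inverseˡ (b n))

  *ℂ-identityˡ : 1ℂ *ℂ z ≐ z
  *ℂ-identityˡ = pointwise (λ n → re-*-identityˡ (a n) (b n)) (λ n → im-*-identityˡ (a n) (b n))

  module _ (w : ℂ) where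
    private
      c d : ℕ → ℚ
      c = approx (re w)
      d = approx (im w)

    +ℂ-comm : z +ℂ w ≐ w +ℂ z
    +ℂ-comm = pointwise (λ n → ℚ.+-comm (a n) (c n)) (λ n → ℚ.+-comm (b n) (d n))

    *ℂ-comm : z *ℂ w ≐ w *ℂ z
    *ℂ-comm = pointwise (λ n → re-*-comm (a n) (b n) (c n) (d n))
                        (λ n → im-*-comm (a n) (b n) (c n) (d n))

    module _ (v : ℂ) where
      private
        e f : ℕ → ℚ
        e = approx (re v)
        f = approx (im v)

      +ℂ-assoc : (z +ℂ w) +ℂ v ≐ z +ℂ (w +ℂ v)
      +ℂ-assoc = pointwise (λ n → ℚ.+-assoc (a n) (c n) (e n)) (λ n → ℚ.+-assoc (b n) (d n) (f n))

      *ℂ-assoc : (z *ℂ w) *ℂ v ≐ z *ℂ (w *ℂ v)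
      *ℂ-assoc = pointwise (λ n → re-*-assoc (a n) (b n) (c n) (d n) (e n) (f n))
                           (λ n → im-*-assoc (a n) (b n) (c n) (d n) (e n) (f n))

      *ℂ-distribˡ-+ℂ : z *ℂ (w +ℂ v) ≐ z *ℂ w +ℂ z *ℂ v
      *ℂ-distribˡ-+ℂ = pointwise (λ n → re-*-distribˡ-+ (a n) (b n) (c n) (d n) (e n) (f n))
                                 (λ n → im-*-distribˡ-+ (a n) (b n) (c n) (d n) (e n) (f n))

ℂ-ring : ∀ {_∼_} → IsCongruence _∼_ → CommutativeRing 0ℓ 0ℓ
ℂ-ring {_∼_} isCongruence = record
  { Carrier = ℂ ; _≈_ = _∼_ ; _+_ = _+ℂ_ ; _*_ = _*ℂ_ ; -_ = -ℂ_ ; 0# = 0ℂ ; 1# = 1ℂ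
  ; isCommutativeRing = record
    { isRing = record
      { +-isAbelianGroup = record
        { isGroup = record
          { isMonoid = record
            { isSemigroup = record
              { isMagma = record { isEquivalence = isEquivalence ; ∙-cong = +-cong }
              ; assoc = λ z w v → ≐⇒∼ (+ℂ-assoc z w v) }
            ; identity = (λ z → ≐⇒∼ (+ℂ-identityˡ z))
                       , (λ z → ≈-trans (+-comm′ z 0ℂ) (≐⇒∼ (+ℂ-identityˡ z))) }
          ; inverse = (λ z → ≐⇒∼ (-ℂ-inverseˡ z))
                    , (λ z → ≈-trans (+-comm′ z (-ℂ z)) (≐⇒∼ (-ℂ-inverseˡ z)))
          ; ⁻¹-cong = -‿cong }
        ; comm = +-comm′ }
      ; *-cong = *-cong
      ; *-assoc = λ z w v → ≐⇒∼ (*ℂ-assoc z w v)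
      ; *-identity = (λ z → ≐⇒∼ (*ℂ-identityˡ z))
                   , (λ z → ≈-trans (*-comm′ z 1ℂ) (≐⇒∼ (*ℂ-identityˡ z)))
      ; distrib = distribˡ
                , (λ z w v → ≈-trans (*-comm′ (w +ℂ v) z)
                    (≈-trans (distribˡ z w v) (+-cong (*-comm′ z w) (*-comm′ z v)))) }
    ; *-comm = *-comm′ } }
  where
  open IsCongruence isCongruence
  open IsEquivalence isEquivalence using () renaming (trans to ≈-trans)
  +-comm′ : ∀ z w → (z +ℂ w) ∼ (w +ℂ z)
  +-comm′ z w = ≐⇒∼ (+ℂ-comm z w)
  *-comm′ : ∀ z w → (z *ℂ w) ∼ (w *ℂ z)
  *-comm′ z w = ≐⇒∼ (*ℂ-comm z w)
  distribˡ : ∀ z w v → (z *ℂ (w +ℂ v)) ∼ (z *ℂ w +ℂ z *ℂ v)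
  distribˡ z w v = ≐⇒∼ (*ℂ-distribˡ-+ℂ z w v)

≐-isCongruence : IsCongruence _≐_
≐-isCongruence = record
  { isEquivalence = record
    { refl = pointwise (λ _ → refl) (λ _ → refl)
    ; sym = λ (pointwise r i) → pointwise (sym ∘ r) (sym ∘ i)
    ; trans = λ (pointwise r i) (pointwise r′ i′) →
        pointwise (λ n → trans (r n) (r′ n)) (λ n → trans (i n) (i′ n)) }
  ; ≐⇒∼ = λ z≐w → z≐w
  ; +-cong = λ (pointwise r i) (pointwise r′ i′) →
      pointwise (λ n → cong₂ ℚ._+_ (r n) (r′ n)) (λ n → cong₂ ℚ._+_ (i n) (i′ n))
  ; *-cong = λ (pointwise r i) (pointwise r′ i′) → pointwise
      (λ n → cong₂ ℚ._-_ (cong₂ ℚ._*_ (r n) (r′ n)) (cong₂ ℚ._*_ (i n) (i′ n)))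
      (λ n → cong₂ ℚ._+_ (cong₂ ℚ._*_ (r n) (i′ n)) (cong₂ ℚ._*_ (i n) (r′ n)))
  ; -‿cong = λ (pointwise r i) → pointwise (cong ℚ.-_ ∘ r) (cong ℚ.-_ ∘ i) }

≈-isCongruence : IsCongruence _≈_
≈-isCongruence = record
  { isEquivalence = record
    { refl = λ {z} → ≐⇒≈ {z} (pointwise (λ _ → refl) (λ _ → refl))
    ; sym = λ {z} {w} (asymptotic (r , i)) → asymptotic ( ≃ℝ-sym (re z) (re w) r , ≃ℝ-sym (im z) (im w) i )
    ; trans = λ {z} {w} {v} (asymptotic (r , i)) (asymptotic (r′ , i′)) →
        asymptotic ( ≃ℝ-trans (re z) (re w) (re v) r r′ , ≃ℝ-trans (im z) (im w) (im v) i i′ ) }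
  ; ≐⇒∼ = ≐⇒≈
  ; +-cong = λ {z} {z′} {w} {w′} (asymptotic (r , i)) (asymptotic (r′ , i′)) →
      asymptotic ( +ℝ-cong (re z) (re z′) (re w) (re w′) r r′
      , +ℝ-cong (im z) (im z′) (im w) (im w′) i i′ )
  ; *-cong = λ {z} {z′} {w} {w′} (asymptotic (r , i)) (asymptotic (r′ , i′)) →
      asymptotic ( +ℝ-cong (re z *ℝ re w) (re z′ *ℝ re w′) (-ℝ (im z *ℝ im w)) (-ℝ (im z′ *ℝ im w′))
          (*ℝ-cong (re z) (re z′) (re w) (re w′) r r′)
          (-ℝ-cong (im z *ℝ im w) (im z′ *ℝ im w′) (*ℝ-cong (im z) (im z′) (im w) (im w′) i i′))
      , +ℝ-cong (re z *ℝ im w) (re z′ *ℝ im w′) (im z *ℝ re w) (im z′ *ℝ re w′)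
          (*ℝ-cong (re z) (re z′) (im w) (im w′) r i′)
          (*ℝ-cong (im z) (im z′) (re w) (re w′) i r′) )
  ; -‿cong = λ {z} {z′} (asymptotic (r , i)) →
      asymptotic ( -ℝ-cong (re z) (re z′) r , -ℝ-cong (im z) (im z′) i ) }

module ≐ = CommutativeRing (ℂ-ring ≐-isCongruence)
module ≈ = CommutativeRing (ℂ-ring ≈-isCongruence)

-- The exponential series

module ∑≐ = Convolution (ℂ-ring ≐-isCongruence)
module ∑ℚ = Convolution ℚ.+-*-commutativeRing

/1-homo-+ : ∀ i j → (i ℤ.+ j) ℚ./ 1 ≡ i ℚ./ 1 ℚ.+ j ℚ./ 1
/1-homo-+ i j = ℚ.toℚᵘ-injective (begin
  ℚ.toℚᵘ ((i ℤ.+ j) ℚ./ 1)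
    ≈⟨ ℚ.toℚᵘ-fromℚᵘ (ℚᵘ.mkℚᵘ (i ℤ.+ j) 0) ⟩
  ℚᵘ.mkℚᵘ (i ℤ.+ j) 0
    ≈⟨ ℚᵘ.*≡* (cong (ℤ._* 1ℤ) (cong₂ ℤ._+_ (ℤ.*-identityʳ i) (ℤ.*-identityʳ j))) ⟨
  ℚᵘ.mkℚᵘ i 0 ℚᵘ.+ ℚᵘ.mkℚᵘ j 0
    ≈⟨ ℚᵘ.+-cong (ℚ.toℚᵘ-fromℚᵘ (ℚᵘ.mkℚᵘ i 0)) (ℚ.toℚᵘ-fromℚᵘ (ℚᵘ.mkℚᵘ j 0)) ⟨
  ℚ.toℚᵘ (i ℚ./ 1) ℚᵘ.+ ℚ.toℚᵘ (j ℚ./ 1)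
    ≈⟨ ℚ.toℚᵘ-homo-+ (i ℚ./ 1) (j ℚ./ 1) ⟨
  ℚ.toℚᵘ (i ℚ./ 1 ℚ.+ j ℚ./ 1) ∎)
  where open SetoidReasoning ℚᵘ.≃-setoid

/1-homo-* : ∀ i j → (i ℤ.* j) ℚ./ 1 ≡ (i ℚ./ 1) ℚ.* (j ℚ./ 1)
/1-homo-* i j = ℚ.toℚᵘ-injective (begin
  ℚ.toℚᵘ ((i ℤ.* j) ℚ./ 1)
    ≈⟨ ℚ.toℚᵘ-fromℚᵘ (ℚᵘ.mkℚᵘ (i ℤ.* j) 0) ⟩
  ℚᵘ.mkℚᵘ i 0 ℚᵘ.* ℚᵘ.mkℚᵘ j 0
    ≈⟨ ℚᵘ.*-cong (ℚ.toℚᵘ-fromℚᵘ (ℚᵘ.mkℚᵘ i 0)) (ℚ.toℚᵘ-fromℚᵘ (ℚᵘ.mkℚᵘ j 0)) ⟨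
  ℚ.toℚᵘ (i ℚ./ 1) ℚᵘ.* ℚ.toℚᵘ (j ℚ./ 1)
    ≈⟨ ℚ.toℚᵘ-homo-* (i ℚ./ 1) (j ℚ./ 1) ⟨
  ℚ.toℚᵘ ((i ℚ./ 1) ℚ.* (j ℚ./ 1)) ∎)
  where open SetoidReasoning ℚᵘ.≃-setoid

/1-*-1/suc : ∀ k → (+ suc k ℚ./ 1) ℚ.* 1/suc k ≡ 1ℚ
/1-*-1/suc k = ℚ.toℚᵘ-injective (begin
  ℚ.toℚᵘ ((+ suc k ℚ./ 1) ℚ.* 1/suc k)
    ≈⟨ ℚ.toℚᵘ-homo-* (+ suc k ℚ./ 1) (1/suc k) ⟩
  ℚ.toℚᵘ (+ suc k ℚ./ 1) ℚᵘ.* ℚ.toℚᵘ (1/suc k)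
    ≈⟨ ℚᵘ.*-cong (ℚ.toℚᵘ-fromℚᵘ (ℚᵘ.mkℚᵘ (+ suc k) 0)) (toℚᵘ-1/suc k) ⟩
  ℚᵘ.mkℚᵘ (+ suc k) 0 ℚᵘ.* ℚᵘ.mkℚᵘ (+ 1) k
    ≈⟨ ℚᵘ.*≡* (trans (ℤ.*-identityʳ _) (trans (ℤ.*-identityʳ (+ suc k))
         (sym (trans (ℤ.*-identityˡ _) (cong +_ (ℕ.*-identityˡ (suc k))))))) ⟩
  ℚᵘ.mkℚᵘ (+ 1) 0 ∎)
  where open SetoidReasoning ℚᵘ.≃-setoid

ofℚ : ℚ → ℂ
ofℚ q = ofReal (fromℚ q)

ofℚ-homo-+ : ∀ p q → ofℚ (p ℚ.+ q) ≐ ofℚ p +ℂ ofℚ q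
ofℚ-homo-+ p q = pointwise (λ _ → refl) (λ _ → refl)

ofℚ-homo-* : ∀ p q → ofℚ (p ℚ.* q) ≐ ofℚ p *ℂ ofℚ q
ofℚ-homo-* p q = pointwise
  (λ _ → solve 2 (λ p q → p :* q := p :* q :- con 0ℚ :* con 0ℚ) refl p q)
  (λ _ → solve 2 (λ p q → con 0ℚ := p :* con 0ℚ :+ con 0ℚ :* q) refl p q)
  where open +-*-Solver

∙≐* : ∀ q z → q ∙ℂ z ≐ ofℚ q *ℂ z
∙≐* q z = pointwise
  (λ n → re-part q (approx (re z) n) (approx (im z) n))
  (λ n → im-part q (approx (re z) n) (approx (im z) n))
  where
  open +-*-Solver
  re-part : ∀ q a b → q ℚ.* a ≡ q ℚ.* a ℚ.- 0ℚ ℚ.* b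
  re-part = solve 3 (λ q a b → q :* a := q :* a :- con 0ℚ :* b) refl
  im-part : ∀ q a b → q ℚ.* b ≡ q ℚ.* b ℚ.+ 0ℚ ℚ.* a
  im-part = solve 3 (λ q a b → q :* b := q :* b :+ con 0ℚ :* a) refl

module _ where
  open ∑≐ using (ι; IsExponential; conv; conv-isExponential)
  open IsExponential
  open SetoidReasoning ≐.setoid

  ι≐ofℚ : ∀ k → ι k ≐ ofℚ (+ k ℚ./ 1)
  ι≐ofℚ zero    = ≐.refl
  ι≐ofℚ (suc k) = begin
    1ℂ +ℂ ι k                    ≈⟨ ≐.+-congˡ (ι≐ofℚ k) ⟩
    ofℚ 1ℚ +ℂ ofℚ (+ k ℚ./ 1)    ≈⟨ ofℚ-homo-+ 1ℚ (+ k ℚ./ 1) ⟨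
    ofℚ (1ℚ ℚ.+ + k ℚ./ 1)       ≡⟨ cong ofℚ (/1-homo-+ 1ℤ (+ k)) ⟨
    ofℚ (+ suc k ℚ./ 1)          ∎

  ι*1/suc : ∀ k → ι (suc k) *ℂ ofℚ (1/suc k) ≐ 1ℂ
  ι*1/suc k = begin
    ι (suc k) *ℂ ofℚ (1/suc k)              ≈⟨ ≐.*-congʳ (ι≐ofℚ (suc k)) ⟩
    ofℚ (+ suc k ℚ./ 1) *ℂ ofℚ (1/suc k)    ≈⟨ ofℚ-homo-* (+ suc k ℚ./ 1) (1/suc k) ⟨
    ofℚ ((+ suc k ℚ./ 1) ℚ.* 1/suc k)       ≡⟨ cong ofℚ (/1-*-1/suc k) ⟩
    1ℂ                                      ∎

  expTerm-isExponential : ∀ z → IsExponential z (expTerm z)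
  expTerm-isExponential z .at-0 = ≐.refl
  expTerm-isExponential z .at-suc k = begin
    ι (suc k) *ℂ (1/suc k ∙ℂ (expTerm z k *ℂ z))
      ≈⟨ ≐.*-congˡ (∙≐* (1/suc k) (expTerm z k *ℂ z)) ⟩
    ι (suc k) *ℂ (ofℚ (1/suc k) *ℂ (expTerm z k *ℂ z))
      ≈⟨ ≐.*-assoc _ _ _ ⟨
    ι (suc k) *ℂ ofℚ (1/suc k) *ℂ (expTerm z k *ℂ z)
      ≈⟨ ≐.*-congʳ (ι*1/suc k) ⟩
    1ℂ *ℂ (expTerm z k *ℂ z)
      ≈⟨ ≐.*-identityˡ _ ⟩
    expTerm z k *ℂ z
      ≈⟨ ≐.*-comm (expTerm z k) z ⟩
    z *ℂ expTerm z k ∎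

  -- `ι (suc k)` is invertible in ℂ with inverse `1/suc k`, so the recursion determines each
  -- coefficient from the preceding one.
  exponential-unique : ∀ {z f g} → IsExponential z f → IsExponential z g → ∀ k → f k ≐ g k
  exponential-unique exp-f exp-g zero = ≐.trans (at-0 exp-f) (≐.sym (at-0 exp-g))
  exponential-unique {z} {f} {g} exp-f exp-g (suc k) = begin
    f (suc k)                                   ≈⟨ cancel (f (suc k)) ⟨
    ofℚ (1/suc k) *ℂ (ι (suc k) *ℂ f (suc k))   ≈⟨ ≐.*-congˡ (at-suc exp-f k) ⟩
    ofℚ (1/suc k) *ℂ (z *ℂ f k)                 ≈⟨ ≐.*-congˡ (≐.*-congˡ (exponential-unique exp-f exp-g k)) ⟩
    ofℚ (1/suc k) *ℂ (z *ℂ g k)                 ≈⟨ ≐.*-congˡ (at-suc exp-g k) ⟨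
    ofℚ (1/suc k) *ℂ (ι (suc k) *ℂ g (suc k))   ≈⟨ cancel (g (suc k)) ⟩
    g (suc k)                                   ∎
    where
    cancel : ∀ u → ofℚ (1/suc k) *ℂ (ι (suc k) *ℂ u) ≐ u
    cancel u = begin
      ofℚ (1/suc k) *ℂ (ι (suc k) *ℂ u)   ≈⟨ ≐.*-assoc _ _ _ ⟨
      ofℚ (1/suc k) *ℂ ι (suc k) *ℂ u     ≈⟨ ≐.*-congʳ (≐.*-comm _ _) ⟩
      ι (suc k) *ℂ ofℚ (1/suc k) *ℂ u     ≈⟨ ≐.*-congʳ (ι*1/suc k) ⟩
      1ℂ *ℂ u                             ≈⟨ ≐.*-identityˡ u ⟩
      u                                   ∎

  conv-expTerm : ∀ z w k → conv (expTerm z) (expTerm w) k ≐ expTerm (z +ℂ w) k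
  conv-expTerm z w = exponential-unique
    (conv-isExponential (expTerm-isExponential z) (expTerm-isExponential w))
    (expTerm-isExponential (z +ℂ w))

  -- By uniqueness: the terms of `w` also satisfy the recursion for `z`.
  expTerm-cong : ∀ {z w} → z ≐ w → ∀ k → expTerm z k ≐ expTerm w k
  expTerm-cong {z} {w} z≐w = exponential-unique (expTerm-isExponential z)
    (record { at-0 = ≐.refl
            ; at-suc = λ k → ≐.trans (at-suc (expTerm-isExponential w) k) (≐.*-congʳ (≐.sym z≐w)) })

expSum≡∑ : ∀ z n → expSum z n ≡ ∑≐.∑ (expTerm z) n
expSum≡∑ z zero    = refl
expSum≡∑ z (suc n) = cong (_+ℂ expTerm z n) (expSum≡∑ z n)

triangle-expTerm : ∀ z w n → ∑≐.triangle (expTerm z) (expTerm w) n ≐ expSum (z +ℂ w) n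
triangle-expTerm z w n = begin
  ∑≐.triangle (expTerm z) (expTerm w) n      ≈⟨ ∑≐.triangle≈∑conv (expTerm z) (expTerm w) n ⟩
  ∑≐.∑ (∑≐.conv (expTerm z) (expTerm w)) n   ≈⟨ ∑≐.∑-cong (conv-expTerm z w) n ⟩
  ∑≐.∑ (expTerm (z +ℂ w)) n                  ≡⟨ expSum≡∑ (z +ℂ w) n ⟨
  expSum (z +ℂ w) n                          ∎
  where open SetoidReasoning ≐.setoid

∥∥₁-cong : ∀ {z w} n → z ≐ w → ∥ z ∥₁ n ≡ ∥ w ∥₁ n
∥∥₁-cong n (pointwise r i) = cong₂ ℚ._+_ (cong ℚ.∣_∣ (r n)) (cong ℚ.∣_∣ (i n))

∥∥₁-+ : ∀ z w n → ∥ z +ℂ w ∥₁ n ℚ.≤ ∥ z ∥₁ n ℚ.+ ∥ w ∥₁ n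
∥∥₁-+ z w n = subst (∥ z +ℂ w ∥₁ n ℚ.≤_)
  (interchange ℚ.∣ approx (re z) n ∣ ℚ.∣ approx (re w) n ∣ ℚ.∣ approx (im z) n ∣ ℚ.∣ approx (im w) n ∣)
  (ℚ.+-mono-≤ (ℚ.∣p+q∣≤∣p∣+∣q∣ (approx (re z) n) (approx (re w) n))
              (ℚ.∣p+q∣≤∣p∣+∣q∣ (approx (im z) n) (approx (im w) n)))
  where
  open +-*-Solver
  interchange : ∀ a b c d → (a ℚ.+ b) ℚ.+ (c ℚ.+ d) ≡ (a ℚ.+ c) ℚ.+ (b ℚ.+ d)
  interchange = solve 4 (λ a b c d → (a :+ b) :+ (c :+ d) := (a :+ c) :+ (b :+ d)) refl

-- Damped bounds and the functional equation of the exponential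

½^ : ℕ → ℚ
½^ zero    = 1ℚ
½^ (suc k) = ½ ℚ.* ½^ k

0≤* : ∀ p q → 0ℚ ℚ.≤ p → 0ℚ ℚ.≤ q → 0ℚ ℚ.≤ p ℚ.* q
0≤* p q 0≤p 0≤q = subst (ℚ._≤ p ℚ.* q) (ℚ.*-zeroʳ p)
  (ℚ.*-monoˡ-≤-nonNeg p {{ℚ.nonNegative 0≤p}} 0≤q)

0≤+ : ∀ p q → 0ℚ ℚ.≤ p → 0ℚ ℚ.≤ q → 0ℚ ℚ.≤ p ℚ.+ q
0≤+ p q 0≤p 0≤q = ℚ.≤-trans 0≤p (p≤p+q p q 0≤q)

0≤1ℚ : 0ℚ ℚ.≤ 1ℚ
0≤1ℚ = ℚ.nonNegative⁻¹ 1ℚ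

0≤½ : 0ℚ ℚ.≤ ½
0≤½ = ℚ.nonNegative⁻¹ ½

½≤1ℚ : ½ ℚ.≤ 1ℚ
½≤1ℚ = ℚ.*≤* (ℤ.+≤+ (ℕ.s≤s ℕ.z≤n))

½*p≤p : ∀ p → 0ℚ ℚ.≤ p → ½ ℚ.* p ℚ.≤ p
½*p≤p p 0≤p = subst (½ ℚ.* p ℚ.≤_) (ℚ.*-identityˡ p)
  (ℚ.*-monoʳ-≤-nonNeg p {{ℚ.nonNegative 0≤p}} ½≤1ℚ)

0≤½^ : ∀ k → 0ℚ ℚ.≤ ½^ k
0≤½^ zero    = 0≤1ℚ
0≤½^ (suc k) = 0≤* ½ (½^ k) 0≤½ (0≤½^ k)

½^-anti : ∀ d m → ½^ (d ℕ.+ m) ℚ.≤ ½^ m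
½^-anti zero    m = ℚ.≤-refl
½^-anti (suc d) m = ℚ.≤-trans (½*p≤p (½^ (d ℕ.+ m)) (0≤½^ (d ℕ.+ m))) (½^-anti d m)

½^≤1/suc : ∀ k → ½^ k ℚ.≤ 1/suc k
½^≤1/suc zero    = ℚ.≤-refl
½^≤1/suc (suc k) = ℚ.≤-trans (ℚ.*-monoˡ-≤-nonNeg ½ (½^≤1/suc k)) (½*1/suc≤ k)

null-½^ : Null ½^
null-½^ ε ε>0 = N , λ n N≤n → ℚ.≤-trans (½^≤1/suc n)
  (subst (ℚ._≤ ε) (ℚ.*-identityˡ (1/suc n)) (small n N≤n))
  where
  N = proj₁ (archimedean 1ℚ ε>0)
  small = proj₂ (archimedean 1ℚ ε>0)

0≤∑ : ∀ {F} → (∀ k → 0ℚ ℚ.≤ F k) → ∀ m → 0ℚ ℚ.≤ ∑ℚ.∑ F m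
0≤∑     0≤F zero    = ℚ.≤-refl
0≤∑ {F} 0≤F (suc m) = 0≤+ (∑ℚ.∑ F m) (F m) (0≤∑ 0≤F m) (0≤F m)

module _ (n : ℕ) where
  open ℚ.≤-Reasoning
  open +-*-Solver using (solve; _:+_; _:*_; _:=_; :-_; _:-_)

  -- f is dominated by c ½ᵏ F k; the factor ½ᵏ is what makes the products f i * g j
  -- with i + j ≥ m small.

  Dominated : ℚ → (ℕ → ℂ) → (ℕ → ℚ) → Set
  Dominated c f F = ∀ k → ∥ f k ∥₁ n ℚ.≤ c ℚ.* (½^ k ℚ.* F k)

  -- One factor ½ of `½^ (suc k)` moves into the constant; carrying `c` in `Dominated` makes it
  -- stable under shifts.
  dominated-suc : ∀ {c f F} → Dominated c f F → Dominated (½ ℚ.* c) (f ∘ suc) (F ∘ suc)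
  dominated-suc {c} {f} {F} f≤F k = subst (∥ f (suc k) ∥₁ n ℚ.≤_)
    (shuffle c ½ (½^ k) (F (suc k))) (f≤F (suc k))
    where
    shuffle : ∀ c h p F → c ℚ.* ((h ℚ.* p) ℚ.* F) ≡ (h ℚ.* c) ℚ.* (p ℚ.* F)
    shuffle = solve 4 (λ c h p F → c :* ((h :* p) :* F) := (h :* c) :* (p :* F)) refl

  -- Every term from index `m` on is damped by at least `½^ m`; the majorants of the tail are
  -- bounded by their full sum.
  ∑-tail : ∀ {g G} → Dominated 1ℚ g G → (∀ k → 0ℚ ℚ.≤ G k) → ∀ m d →
    ∥ ∑≐.∑ g (d ℕ.+ m) +ℂ -ℂ ∑≐.∑ g m ∥₁ n ℚ.≤ ½^ m ℚ.* ∑ℚ.∑ G (d ℕ.+ m)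
  ∑-tail {g} {G} g≤G 0≤G m zero = ℚ.≤-trans
    (ℚ.≤-reflexive (∥∥₁-cong n (≐.-‿inverseʳ (∑≐.∑ g m))))
    (0≤* (½^ m) (∑ℚ.∑ G m) (0≤½^ m) (0≤∑ 0≤G m))
  ∑-tail {g} {G} g≤G 0≤G m (suc d) = begin
    ∥ (S +ℂ t) +ℂ S₀ ∥₁ n
      ≡⟨ ∥∥₁-cong n (≐.trans (≐.+-assoc S t S₀)
           (≐.trans (≐.+-congˡ (≐.+-comm t S₀)) (≐.sym (≐.+-assoc S S₀ t)))) ⟩
    ∥ (S +ℂ S₀) +ℂ t ∥₁ n
      ≤⟨ ∥∥₁-+ (S +ℂ S₀) t n ⟩
    ∥ S +ℂ S₀ ∥₁ n ℚ.+ ∥ t ∥₁ n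
      ≤⟨ ℚ.+-mono-≤ (∑-tail g≤G 0≤G m d) t≤ ⟩
    ½^ m ℚ.* ∑ℚ.∑ G (d ℕ.+ m) ℚ.+ ½^ m ℚ.* G (d ℕ.+ m)
      ≡⟨ ℚ.*-distribˡ-+ (½^ m) (∑ℚ.∑ G (d ℕ.+ m)) (G (d ℕ.+ m)) ⟨
    ½^ m ℚ.* ∑ℚ.∑ G (suc d ℕ.+ m) ∎
    where
    S = ∑≐.∑ g (d ℕ.+ m)
    S₀ = -ℂ ∑≐.∑ g m
    t = g (d ℕ.+ m)
    t≤ : ∥ t ∥₁ n ℚ.≤ ½^ m ℚ.* G (d ℕ.+ m)
    t≤ = ℚ.≤-trans (g≤G (d ℕ.+ m))
      (ℚ.≤-trans (ℚ.≤-reflexive (ℚ.*-identityˡ (½^ (d ℕ.+ m) ℚ.* G (d ℕ.+ m))))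
      (ℚ.*-monoʳ-≤-nonNeg (G (d ℕ.+ m)) {{ℚ.nonNegative (0≤G (d ℕ.+ m))}} (½^-anti d m)))

  -- Row i of the defect is `f i` times a tail of `g` starting at m - i, so the dampings ½ⁱ and ½ᵐ⁻ⁱ
  -- multiply to ½ᵐ in every row. The offset `d` keeps the range of `g` fixed while `m` decreases
  -- along the rows.
  square-triangle : ∀ {c f F g G} → Dominated c f F → Dominated 1ℚ g G →
    (∀ k → 0ℚ ℚ.≤ G k) → ∀ m d →
    ∥ ∑≐.∑ f m *ℂ ∑≐.∑ g (d ℕ.+ m) +ℂ -ℂ ∑≐.triangle f g m ∥₁ n ℚ.≤
    (c ℚ.* ½^ m) ℚ.* (∑ℚ.∑ F m ℚ.* ∑ℚ.∑ G (d ℕ.+ m))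
  square-triangle {c} {f} {F} {g} {G} f≤F g≤G 0≤G zero d = ℚ.≤-reflexive (trans
    (∥∥₁-cong {w = 0ℂ} n (≐.trans (≐.+-congʳ (≐.zeroˡ (∑≐.∑ g (d ℕ.+ 0)))) (≐.-‿inverseʳ 0ℂ)))
    (sym (trans (cong ((c ℚ.* 1ℚ) ℚ.*_) (ℚ.*-zeroˡ (∑ℚ.∑ G (d ℕ.+ 0)))) (ℚ.*-zeroʳ (c ℚ.* 1ℚ)))))
  square-triangle {c} {f} {F} {g} {G} f≤F g≤G 0≤G (suc m) d = begin
    ∥ ∑≐.∑ f (suc m) *ℂ S +ℂ -ℂ ∑≐.triangle f g (suc m) ∥₁ n
      ≡⟨ ∥∥₁-cong n (∑≐.square-triangle-suc f g S m) ⟩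
    ∥ f 0 *ℂ D +ℂ E ∥₁ n
      ≤⟨ ∥∥₁-+ (f 0 *ℂ D) E n ⟩
    ∥ f 0 *ℂ D ∥₁ n ℚ.+ ∥ E ∥₁ n
      ≤⟨ ℚ.+-mono-≤ (ℚ.≤-trans (∥∥₁-* (f 0) D n) head-bound) tail-bound ⟩
    (c ℚ.* (1ℚ ℚ.* F 0)) ℚ.* (½^ (suc m) ℚ.* ΣG) ℚ.+ ((½ ℚ.* c) ℚ.* ½^ m) ℚ.* (ΣF ℚ.* ΣG)
      ≡⟨ cong (λ x → (c ℚ.* x) ℚ.* (½^ (suc m) ℚ.* ΣG) ℚ.+ ((½ ℚ.* c) ℚ.* ½^ m) ℚ.* (ΣF ℚ.* ΣG))
           (ℚ.*-identityˡ (F 0)) ⟩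
    (c ℚ.* F 0) ℚ.* (½^ (suc m) ℚ.* ΣG) ℚ.+ ((½ ℚ.* c) ℚ.* ½^ m) ℚ.* (ΣF ℚ.* ΣG)
      ≡⟨ shuffle c ½ (½^ m) (F 0) ΣF ΣG ⟩
    (c ℚ.* ½^ (suc m)) ℚ.* ((F 0 ℚ.+ ΣF) ℚ.* ΣG)
      ≡⟨ cong (λ x → (c ℚ.* ½^ (suc m)) ℚ.* (x ℚ.* ΣG)) (∑ℚ.∑-head F m) ⟨
    (c ℚ.* ½^ (suc m)) ℚ.* (∑ℚ.∑ F (suc m) ℚ.* ΣG) ∎
    where
    S = ∑≐.∑ g (d ℕ.+ suc m)
    D = S +ℂ -ℂ ∑≐.∑ g (suc m)
    E = ∑≐.∑ (f ∘ suc) m *ℂ S +ℂ -ℂ ∑≐.triangle (f ∘ suc) g m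
    ΣF = ∑ℚ.∑ (F ∘ suc) m
    ΣG = ∑ℚ.∑ G (d ℕ.+ suc m)
    head-bound : ∥ f 0 ∥₁ n ℚ.* ∥ D ∥₁ n ℚ.≤ (c ℚ.* (1ℚ ℚ.* F 0)) ℚ.* (½^ (suc m) ℚ.* ΣG)
    head-bound = *-mono-≤-nonNeg (0≤∥∥₁ (f 0) n)
      (0≤* (½^ (suc m)) ΣG (0≤½^ (suc m)) (0≤∑ 0≤G (d ℕ.+ suc m)))
      (f≤F 0) (∑-tail g≤G 0≤G (suc m) d)
    tail-bound : ∥ E ∥₁ n ℚ.≤ ((½ ℚ.* c) ℚ.* ½^ m) ℚ.* (ΣF ℚ.* ΣG)
    tail-bound = subst
      (λ k → ∥ ∑≐.∑ (f ∘ suc) m *ℂ ∑≐.∑ g k +ℂ -ℂ ∑≐.triangle (f ∘ suc) g m ∥₁ n ℚ.≤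
             ((½ ℚ.* c) ℚ.* ½^ m) ℚ.* (ΣF ℚ.* ∑ℚ.∑ G k))
      -- The upper limit `d + suc m` is read as `suc d + m`: one row fewer, one more step of offset.
      (sym (ℕ.+-suc d m))
      (square-triangle {½ ℚ.* c} {f ∘ suc} {F ∘ suc} {g} {G} (dominated-suc {c} {f} {F} f≤F) g≤G 0≤G m (suc d))
    shuffle : ∀ c h p x y z →
      (c ℚ.* x) ℚ.* ((h ℚ.* p) ℚ.* z) ℚ.+ ((h ℚ.* c) ℚ.* p) ℚ.* (y ℚ.* z) ≡
      (c ℚ.* (h ℚ.* p)) ℚ.* ((x ℚ.+ y) ℚ.* z)
    shuffle = solve 6 (λ c h p x y z →
      (c :* x) :* ((h :* p) :* z) :+ ((h :* c) :* p) :* (y :* z) :=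
      (c :* (h :* p)) :* ((x :+ y) :* z)) refl

majorant : ℚ → ℕ → ℚ
majorant K zero    = 1ℚ
majorant K (suc k) = 1/suc k ℚ.* (majorant K k ℚ.* K)

0≤majorant : ∀ {K} → 0ℚ ℚ.≤ K → ∀ k → 0ℚ ℚ.≤ majorant K k
0≤majorant         0≤K zero    = 0≤1ℚ
0≤majorant {K = K} 0≤K (suc k) = 0≤* (1/suc k) (majorant K k ℚ.* K) (0≤1/suc k)
  (0≤* (majorant K k) K (0≤majorant 0≤K k) 0≤K)

-- The damping comes from halving the argument: (K/2)^k/k! is ½^k times K^k/k!.
expTerm-dominated : ∀ z K n → 0ℚ ℚ.≤ K → ∥ z ∥₁ n ℚ.≤ ½ ℚ.* K →
                    Dominated n 1ℚ (expTerm z) (majorant K)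
expTerm-dominated z K n 0≤K z≤K k =
  ℚ.≤-trans (bound k) (ℚ.≤-reflexive (sym (ℚ.*-identityˡ (½^ k ℚ.* majorant K k))))
  where
  open ℚ.≤-Reasoning
  shuffle : ∀ i p m h K → i ℚ.* ((p ℚ.* m) ℚ.* (h ℚ.* K)) ≡ (h ℚ.* p) ℚ.* (i ℚ.* (m ℚ.* K))
  shuffle = solve 5 (λ i p m h K →
    i :* ((p :* m) :* (h :* K)) := (h :* p) :* (i :* (m :* K))) refl
    where open +-*-Solver
  bound : ∀ k → ∥ expTerm z k ∥₁ n ℚ.≤ ½^ k ℚ.* majorant K k
  bound zero    = ℚ.≤-refl
  bound (suc k) = begin
    ∥ 1/suc k ∙ℂ (expTerm z k *ℂ z) ∥₁ n
      ≡⟨ ∥∥₁-∙ (1/suc k) (expTerm z k *ℂ z) n (0≤1/suc k) ⟩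
    1/suc k ℚ.* ∥ expTerm z k *ℂ z ∥₁ n
      ≤⟨ ℚ.*-monoˡ-≤-nonNeg (1/suc k) {{ℚ.nonNegative (0≤1/suc k)}} (∥∥₁-* (expTerm z k) z n) ⟩
    1/suc k ℚ.* (∥ expTerm z k ∥₁ n ℚ.* ∥ z ∥₁ n)
      ≤⟨ ℚ.*-monoˡ-≤-nonNeg (1/suc k) {{ℚ.nonNegative (0≤1/suc k)}}
           (*-mono-≤-nonNeg (0≤∥∥₁ (expTerm z k) n) (0≤* ½ K 0≤½ 0≤K) (bound k) z≤K) ⟩
    1/suc k ℚ.* ((½^ k ℚ.* majorant K k) ℚ.* (½ ℚ.* K))
      ≡⟨ shuffle (1/suc k) (½^ k) (majorant K k) ½ K ⟩
    ½^ (suc k) ℚ.* majorant K (suc k) ∎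

expTerm-ofℚ : ∀ K k → expTerm (ofℚ K) k ≐ ofℚ (majorant K k)
expTerm-ofℚ K zero    = ≐.refl
expTerm-ofℚ K (suc k) = begin
  1/suc k ∙ℂ (expTerm (ofℚ K) k *ℂ ofℚ K)        ≈⟨ ∙≐* (1/suc k) (expTerm (ofℚ K) k *ℂ ofℚ K) ⟩
  ofℚ (1/suc k) *ℂ (expTerm (ofℚ K) k *ℂ ofℚ K)  ≈⟨ ≐.*-congˡ (≐.*-congʳ (expTerm-ofℚ K k)) ⟩
  ofℚ (1/suc k) *ℂ (ofℚ (majorant K k) *ℂ ofℚ K) ≈⟨ ≐.*-congˡ (ofℚ-homo-* (majorant K k) K) ⟨
  ofℚ (1/suc k) *ℂ ofℚ (majorant K k ℚ.* K)      ≈⟨ ofℚ-homo-* (1/suc k) (majorant K k ℚ.* K) ⟨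
  ofℚ (majorant K (suc k))                       ∎
  where open SetoidReasoning ≐.setoid

expSum-ofℚ : ∀ K n → expSum (ofℚ K) n ≐ ofℚ (∑ℚ.∑ (majorant K) n)
expSum-ofℚ K zero    = ≐.refl
expSum-ofℚ K (suc n) = ≐.trans (≐.+-cong (expSum-ofℚ K n) (expTerm-ofℚ K n))
  (≐.sym (ofℚ-homo-+ (∑ℚ.∑ (majorant K) n) (majorant K n)))

-- The partial sums of e^K are the approximants of `re (exp (ofℚ K))`, a Cauchy sequence by
-- construction, and hence are bounded.
∑majorant-bounded : ∀ {K} → 0ℚ ℚ.≤ K →
  ∃ λ B → 0ℚ ℚ.< B × Eventually λ n → ∑ℚ.∑ (majorant K) n ℚ.≤ B
∑majorant-bounded {K} 0≤K = proj₁ bounded , proj₁ (proj₂ (proj₂ bounded)) ,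
  eventually-map (λ n → ℚ.≤-trans (ℚ.≤-trans (p≤∣p∣ (∑ℚ.∑ (majorant K) n))
      (ℚ.≤-reflexive (cong ℚ.∣_∣ (sym (trans (re-exp (ofℚ K) n) (re-≡ (expSum-ofℚ K n) n)))))))
    (proj₁ (proj₂ bounded) , proj₂ (proj₂ (proj₂ bounded)))
  where
  e = re (exp (ofℚ K))
  bounded = cauchy⇒bounded {approx e} (cauchy e)

-- `n` is at once the number of terms and the index of approximation, as in the diagonal that
-- defines `exp`. The defect is eventually at most B² ½ⁿ, where B bounds the partial sums of e^K.
exp-defect : ∀ z w → Null λ n →
  ∥ expSum z n *ℂ expSum w n +ℂ -ℂ expSum (z +ℂ w) n ∥₁ n
exp-defect z w = null-squeeze {B = B ℚ.* B} B²>0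
  (eventually-zip defect≤
    (eventually-zip (λ n z≤ w≤ → z≤ , w≤) z-bounded w-bounded)
    (proj₂ (proj₂ maj)))
  null-½^
  where
  -- `b` bounds both norms and `K` is its double, so that `expTerm-dominated` applies to `z` and `w`
  -- with the same majorant.
  b = proj₁ (∥∥₁-bounded z) ℚ.+ proj₁ (∥∥₁-bounded w)
  K = b ℚ.+ b
  z-bounded : Eventually λ n → ∥ z ∥₁ n ℚ.≤ proj₁ (∥∥₁-bounded z)
  z-bounded = proj₂ (∥∥₁-bounded z)
  w-bounded : Eventually λ n → ∥ w ∥₁ n ℚ.≤ proj₁ (∥∥₁-bounded w)
  w-bounded = proj₂ (∥∥₁-bounded w)
  0≤z : 0ℚ ℚ.≤ proj₁ (∥∥₁-bounded z)
  0≤z = ℚ.≤-trans (0≤∥∥₁ z (proj₁ z-bounded)) (proj₂ z-bounded (proj₁ z-bounded) ℕ.≤-refl)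
  0≤w : 0ℚ ℚ.≤ proj₁ (∥∥₁-bounded w)
  0≤w = ℚ.≤-trans (0≤∥∥₁ w (proj₁ w-bounded)) (proj₂ w-bounded (proj₁ w-bounded) ℕ.≤-refl)
  0≤b = 0≤+ (proj₁ (∥∥₁-bounded z)) (proj₁ (∥∥₁-bounded w)) 0≤z 0≤w
  0≤K = 0≤+ b b 0≤b 0≤b
  ½K≡b : ½ ℚ.* K ≡ b
  ½K≡b = trans (ℚ.*-distribˡ-+ ½ b b) (halves b)
  maj = ∑majorant-bounded 0≤K
  B = proj₁ maj
  B²>0 : 0ℚ ℚ.< B ℚ.* B
  B²>0 = subst (ℚ._< B ℚ.* B) (ℚ.*-zeroʳ B)
    (ℚ.*-monoʳ-<-pos B {{ℚ.positive (proj₁ (proj₂ maj))}} (proj₁ (proj₂ maj)))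
  dominated : ∀ v n → ∥ v ∥₁ n ℚ.≤ b → Dominated n 1ℚ (expTerm v) (majorant K)
  dominated v n v≤b = expTerm-dominated v K n 0≤K (subst (∥ v ∥₁ n ℚ.≤_) (sym ½K≡b) v≤b)
  defect≤ : ∀ n →
    ∥ z ∥₁ n ℚ.≤ proj₁ (∥∥₁-bounded z) × ∥ w ∥₁ n ℚ.≤ proj₁ (∥∥₁-bounded w) →
    ∑ℚ.∑ (majorant K) n ℚ.≤ B →
    ∥ expSum z n *ℂ expSum w n +ℂ -ℂ expSum (z +ℂ w) n ∥₁ n ℚ.≤ (B ℚ.* B) ℚ.* ½^ n
  defect≤ n (z≤ , w≤) M≤B = begin
    ∥ expSum z n *ℂ expSum w n +ℂ -ℂ expSum (z +ℂ w) n ∥₁ n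
      ≡⟨ ∥∥₁-cong n (≐.+-cong
           (≐.reflexive (cong₂ _*ℂ_ (expSum≡∑ z n) (expSum≡∑ w n)))
           (≐.-‿cong (≐.sym (triangle-expTerm z w n)))) ⟩
    ∥ ∑≐.∑ (expTerm z) n *ℂ ∑≐.∑ (expTerm w) n +ℂ -ℂ ∑≐.triangle (expTerm z) (expTerm w) n ∥₁ n
      ≤⟨ square-triangle n {1ℚ} {expTerm z} {majorant K} {expTerm w} {majorant K}
           (dominated z n (ℚ.≤-trans z≤ (p≤p+q _ _ 0≤w)))
           (dominated w n (ℚ.≤-trans w≤ (q≤p+q _ _ 0≤z)))
           (0≤majorant 0≤K) n 0 ⟩
    (1ℚ ℚ.* ½^ n) ℚ.* (M ℚ.* M)
      ≡⟨ trans (cong (ℚ._* (M ℚ.* M)) (ℚ.*-identityˡ (½^ n))) (ℚ.*-comm (½^ n) (M ℚ.* M)) ⟩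
    (M ℚ.* M) ℚ.* ½^ n
      ≤⟨ ℚ.*-monoʳ-≤-nonNeg (½^ n) {{ℚ.nonNegative (0≤½^ n)}}
           (*-mono-≤-nonNeg 0≤M (ℚ.<⇒≤ (proj₁ (proj₂ maj))) M≤B M≤B) ⟩
    (B ℚ.* B) ℚ.* ½^ n ∎
    where
    open ℚ.≤-Reasoning
    M = ∑ℚ.∑ (majorant K) n
    0≤M = 0≤∑ (0≤majorant 0≤K) n

exp-+ : ∀ z w → exp (z +ℂ w) ≈ exp z *ℂ exp w
exp-+ z w = ≈.sym {exp z *ℂ exp w} {exp (z +ℂ w)} (asymptotic
  ( null-≤ (λ n → ℚ.≤-trans (ℚ.≤-reflexive (re-defect n))
      (p≤p+q _ _ (ℚ.0≤∣p∣ (approx (im (defect n)) n)))) (exp-defect z w)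
  , null-≤ (λ n → ℚ.≤-trans (ℚ.≤-reflexive (im-defect n))
      (q≤p+q _ _ (ℚ.0≤∣p∣ (approx (re (defect n)) n)))) (exp-defect z w) ))
  where
  defect : ℕ → ℂ
  defect n = expSum z n *ℂ expSum w n +ℂ -ℂ expSum (z +ℂ w) n
  re-product : ∀ n → approx (re (exp z *ℂ exp w)) n ≡ approx (re (expSum z n *ℂ expSum w n)) n
  re-product n = cong₂ ℚ._-_ (cong₂ ℚ._*_ (re-exp z n) (re-exp w n))
                             (cong₂ ℚ._*_ (im-exp z n) (im-exp w n))
  im-product : ∀ n → approx (im (exp z *ℂ exp w)) n ≡ approx (im (expSum z n *ℂ expSum w n)) n
  im-product n = cong₂ ℚ._+_ (cong₂ ℚ._*_ (re-exp z n) (im-exp w n))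
                             (cong₂ ℚ._*_ (im-exp z n) (re-exp w n))
  re-defect : ∀ n → ℚ.∣ approx (re (exp z *ℂ exp w)) n ℚ.- approx (re (exp (z +ℂ w))) n ∣ ≡
                    ℚ.∣ approx (re (defect n)) n ∣
  re-defect n = cong ℚ.∣_∣ (cong₂ ℚ._-_ (re-product n) (re-exp (z +ℂ w) n))
  im-defect : ∀ n → ℚ.∣ approx (im (exp z *ℂ exp w)) n ℚ.- approx (im (exp (z +ℂ w))) n ∣ ≡
                    ℚ.∣ approx (im (defect n)) n ∣
  im-defect n = cong ℚ.∣_∣ (cong₂ ℚ._-_ (im-product n) (im-exp (z +ℂ w) n))

expSum-cong : ∀ {z w} → z ≐ w → ∀ n → expSum z n ≐ expSum w n
expSum-cong z≐w zero    = ≐.refl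
expSum-cong z≐w (suc n) = ≐.+-cong (expSum-cong z≐w n) (expTerm-cong z≐w n)

exp-cong : ∀ {z w} → z ≐ w → exp z ≐ exp w
exp-cong {z} {w} z≐w = pointwise
  (λ n → trans (re-exp z n) (trans (re-≡ (expSum-cong z≐w n) n) (sym (re-exp w n))))
  (λ n → trans (im-exp z n) (trans (im-≡ (expSum-cong z≐w n) n) (sym (im-exp w n))))

expSum-0 : ∀ n → expSum 0ℂ (suc n) ≐ 1ℂ
expSum-0 zero    = ≐.+-identityˡ 1ℂ
expSum-0 (suc n) = ≐.trans (≐.+-cong (expSum-0 n) term≐0) (≐.+-identityʳ 1ℂ)
  where
  term≐0 : expTerm 0ℂ (suc n) ≐ 0ℂ
  term≐0 = ≐.trans (∙≐* (1/suc n) (expTerm 0ℂ n *ℂ 0ℂ))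
    (≐.trans (≐.*-congˡ (≐.zeroʳ (expTerm 0ℂ n))) (≐.zeroʳ (ofℚ (1/suc n))))

≃ℝ-eventually : ∀ x y → Eventually (λ n → approx x n ≡ approx y n) → x ≃ℝ y
≃ℝ-eventually x y x≡y ε ε>0 = eventually-map
  (λ n x≡y → ℚ.≤-trans (ℚ.≤-reflexive (cong ℚ.∣_∣
    (trans (cong (ℚ._- approx y n) x≡y) (ℚ.+-inverseʳ (approx y n))))) (ℚ.<⇒≤ ε>0))
  x≡y

exp-0 : exp 0ℂ ≈ 1ℂ
exp-0 = asymptotic
  -- The partial sum at index 0 is empty and equals 0, so the equality starts at index 1.
  ( ≃ℝ-eventually (re (exp 0ℂ)) 1ℝ (1 , λ where (suc n) _ → trans (re-exp 0ℂ (suc n)) (re-≡ (expSum-0 n) (suc n)))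
  , ≃ℝ-eventually (im (exp 0ℂ)) 0ℝ (1 , λ where (suc n) _ → trans (im-exp 0ℂ (suc n)) (im-≡ (expSum-0 n) (suc n))) )

-- Complex conjugation

conj : ℂ → ℂ
conj z = re z +i (-ℝ im z)

conj-cong : ∀ {z w} → z ≐ w → conj z ≐ conj w
conj-cong (pointwise r i) = pointwise r (cong ℚ.-_ ∘ i)

conj-+ : ∀ z w → conj (z +ℂ w) ≐ conj z +ℂ conj w
conj-+ z w = pointwise (λ _ → refl) (λ n → ℚ.neg-distrib-+ (approx (im z) n) (approx (im w) n))

conj-* : ∀ z w → conj (z *ℂ w) ≐ conj z *ℂ conj w
conj-* z w = pointwise
  (λ n → re-part (approx (re z) n) (approx (im z) n) (approx (re w) n) (approx (im w) n))
  (λ n → im-part (approx (re z) n) (approx (im z) n) (approx (re w) n) (approx (im w) n))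
  where
  open +-*-Solver
  re-part : ∀ a b c d → a ℚ.* c ℚ.- b ℚ.* d ≡ a ℚ.* c ℚ.- (ℚ.- b) ℚ.* (ℚ.- d)
  re-part = solve 4 (λ a b c d → a :* c :- b :* d := a :* c :- (:- b) :* (:- d)) refl
  im-part : ∀ a b c d → ℚ.- (a ℚ.* d ℚ.+ b ℚ.* c) ≡ a ℚ.* (ℚ.- d) ℚ.+ (ℚ.- b) ℚ.* c
  im-part = solve 4 (λ a b c d → :- (a :* d :+ b :* c) := a :* (:- d) :+ (:- b) :* c) refl

conj-ofℚ : ∀ q → conj (ofℚ q) ≐ ofℚ q
conj-ofℚ q = pointwise (λ _ → refl) (λ _ → refl)

conj-expTerm : ∀ z k → conj (expTerm z k) ≐ expTerm (conj z) k
conj-expTerm z zero    = conj-ofℚ 1ℚ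
conj-expTerm z (suc k) = begin
  conj (1/suc k ∙ℂ (expTerm z k *ℂ z))
    ≈⟨ conj-cong (∙≐* (1/suc k) (expTerm z k *ℂ z)) ⟩
  conj (ofℚ (1/suc k) *ℂ (expTerm z k *ℂ z))
    ≈⟨ conj-* (ofℚ (1/suc k)) (expTerm z k *ℂ z) ⟩
  conj (ofℚ (1/suc k)) *ℂ conj (expTerm z k *ℂ z)
    ≈⟨ ≐.*-cong (conj-ofℚ (1/suc k)) (conj-* (expTerm z k) z) ⟩
  ofℚ (1/suc k) *ℂ (conj (expTerm z k) *ℂ conj z)
    ≈⟨ ≐.*-congˡ (≐.*-congʳ (conj-expTerm z k)) ⟩
  ofℚ (1/suc k) *ℂ (expTerm (conj z) k *ℂ conj z)
    ≈⟨ ∙≐* (1/suc k) (expTerm (conj z) k *ℂ conj z) ⟨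
  expTerm (conj z) (suc k) ∎
  where open SetoidReasoning ≐.setoid

conj-expSum : ∀ z n → conj (expSum z n) ≐ expSum (conj z) n
conj-expSum z zero    = conj-ofℚ 0ℚ
conj-expSum z (suc n) = ≐.trans (conj-+ (expSum z n) (expTerm z n))
  (≐.+-cong (conj-expSum z n) (conj-expTerm z n))

-- The coefficients of the series are rational, hence fixed by conjugation, and this holds for each
-- partial sum.
conj-exp : ∀ z → conj (exp z) ≐ exp (conj z)
conj-exp z = pointwise
  (λ n → trans (re-exp z n) (trans (re-≡ (conj-expSum z n) n) (sym (re-exp (conj z) n))))
  (λ n → trans (cong ℚ.-_ (im-exp z n)) (trans (im-≡ (conj-expSum z n) n) (sym (im-exp (conj z) n))))

-- Points of the unit circle

-- Angles are only ever rearranged by rational identities valid at every index, hence the hypothesis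
-- is exact equality of the approximants.
exp𝕚-cong : ∀ {x y} → (∀ n → approx x n ≡ approx y n) → exp[𝕚 x ] ≈ exp[𝕚 y ]
exp𝕚-cong x≡y = ≐⇒≈ (exp-cong (≐.*-congˡ (pointwise x≡y (λ _ → refl))))

exp𝕚-+ : ∀ x y → exp[𝕚 x +ℝ y ] ≈ exp[𝕚 x ] *ℂ exp[𝕚 y ]
exp𝕚-+ x y = ≈.trans
  (≐⇒≈ (exp-cong (≐.trans (≐.*-congˡ {𝕚} (pointwise (λ _ → refl) (λ _ → refl)))
    (≐.distribˡ 𝕚 (ofReal x) (ofReal y)))))
  (exp-+ (𝕚 *ℂ ofReal x) (𝕚 *ℂ ofReal y))

exp𝕚-0 : ∀ {x} → (∀ n → approx x n ≡ 0ℚ) → exp[𝕚 x ] ≈ 1ℂ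
exp𝕚-0 x≡0 = ≈.trans
  (≐⇒≈ (exp-cong (≐.trans (≐.*-congˡ (pointwise x≡0 (λ _ → refl))) (≐.zeroʳ 𝕚)))) exp-0

exp𝕚-inverse : ∀ x → exp[𝕚 x ] *ℂ exp[𝕚 -ℝ x ] ≈ 1ℂ
exp𝕚-inverse x = ≈.trans (≈.sym (exp𝕚-+ x (-ℝ x)))
  (exp𝕚-0 {x +ℝ (-ℝ x)} (λ n → ℚ.+-inverseʳ (approx x n)))

conj-exp𝕚 : ∀ x → conj exp[𝕚 x ] ≐ exp[𝕚 -ℝ x ]
conj-exp𝕚 x = ≐.trans (conj-exp (𝕚 *ℂ ofReal x)) (exp-cong (pointwise
  (λ n → re-part (approx x n)) (λ n → im-part (approx x n))))
  where
  open +-*-Solver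
  re-part : ∀ a → 0ℚ ℚ.* a ℚ.- 1ℚ ℚ.* 0ℚ ≡ 0ℚ ℚ.* (ℚ.- a) ℚ.- 1ℚ ℚ.* 0ℚ
  re-part = solve 1 (λ a → con 0ℚ :* a :- con 1ℚ :* con 0ℚ :=
                           con 0ℚ :* (:- a) :- con 1ℚ :* con 0ℚ) refl
  im-part : ∀ a → ℚ.- (0ℚ ℚ.* 0ℚ ℚ.+ 1ℚ ℚ.* a) ≡ 0ℚ ℚ.* 0ℚ ℚ.+ 1ℚ ℚ.* (ℚ.- a)
  im-part = solve 1 (λ a → :- (con 0ℚ :* con 0ℚ :+ con 1ℚ :* a) :=
                           con 0ℚ :* con 0ℚ :+ con 1ℚ :* (:- a)) refl

exp𝕚-conj-inverse : ∀ x → exp[𝕚 x ] *ℂ conj exp[𝕚 x ] ≈ 1ℂ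
exp𝕚-conj-inverse x = ≈.trans (≈.*-congˡ (≐⇒≈ (conj-exp𝕚 x))) (exp𝕚-inverse x)

im≃0⇒≈conj : ∀ z → im z ≃ℝ 0ℝ → z ≈ conj z
im≃0⇒≈conj z im≃0 = asymptotic
  ( ≃ℝ-pointwise (re z) (re z) (λ _ → refl)
  , ≃ℝ-trans (im z) 0ℝ (-ℝ im z) im≃0
      (≃ℝ-sym (-ℝ im z) 0ℝ (-ℝ-cong (im z) 0ℝ im≃0)) )

≈conj⇒im≃0 : ∀ z → z ≈ conj z → im z ≃ℝ 0ℝ
≈conj⇒im≃0 z (asymptotic (_ , im≃-im)) = null-≤ (λ n → bound (approx (im z) n)) im≃-im
  where
  open ℚ.≤-Reasoning
  double : ∀ b → b ℚ.- 0ℚ ≡ ½ ℚ.* (b ℚ.- (ℚ.- b))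
  double b = trans (trans (ℚ.+-identityʳ b) (sym (halves b))) (factor ½ b)
    where
    factor : ∀ h b → h ℚ.* b ℚ.+ h ℚ.* b ≡ h ℚ.* (b ℚ.- (ℚ.- b))
    factor = solve 2 (λ h b → h :* b :+ h :* b := h :* (b :- (:- b))) refl
      where open +-*-Solver
  bound : ∀ b → ℚ.∣ b ℚ.- 0ℚ ∣ ℚ.≤ ℚ.∣ b ℚ.- (ℚ.- b) ∣
  bound b = begin
    ℚ.∣ b ℚ.- 0ℚ ∣                ≡⟨ cong ℚ.∣_∣ (double b) ⟩
    ℚ.∣ ½ ℚ.* (b ℚ.- (ℚ.- b)) ∣   ≡⟨ ℚ.∣p*q∣≡∣p∣*∣q∣ ½ (b ℚ.- (ℚ.- b)) ⟩
    ½ ℚ.* ℚ.∣ b ℚ.- (ℚ.- b) ∣     ≤⟨ ½*p≤p ℚ.∣ b ℚ.- (ℚ.- b) ∣ (ℚ.0≤∣p∣ (b ℚ.- (ℚ.- b))) ⟩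
    ℚ.∣ b ℚ.- (ℚ.- b) ∣           ∎

-- On the unit circle v² = 1 holds exactly when v is its own conjugate, i.e. when v is real.

sin≃0⇒exp𝕚-double≈1 : ∀ x → sin x ≃ℝ 0ℝ → exp[𝕚 x +ℝ x ] ≈ 1ℂ
sin≃0⇒exp𝕚-double≈1 x sin≃0 = begin
  exp[𝕚 x +ℝ x ]                   ≈⟨ exp𝕚-+ x x ⟩
  exp[𝕚 x ] *ℂ exp[𝕚 x ]           ≈⟨ ≈.*-congˡ (im≃0⇒≈conj exp[𝕚 x ] sin≃0) ⟩
  exp[𝕚 x ] *ℂ conj exp[𝕚 x ]      ≈⟨ exp𝕚-conj-inverse x ⟩
  1ℂ                               ∎
  where open SetoidReasoning ≈.setoid

exp𝕚-double≈1⇒sin≃0 : ∀ x → exp[𝕚 x +ℝ x ] ≈ 1ℂ → sin x ≃ℝ 0ℝ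
exp𝕚-double≈1⇒sin≃0 x double≈1 = ≈conj⇒im≃0 v (begin
  v                    ≈⟨ ≈.*-identityʳ v ⟨
  v *ℂ 1ℂ              ≈⟨ ≈.*-congˡ (exp𝕚-conj-inverse x) ⟨
  v *ℂ (v *ℂ conj v)   ≈⟨ ≈.*-assoc v v (conj v) ⟨
  v *ℂ v *ℂ conj v     ≈⟨ ≈.*-congʳ (≈.trans (≈.sym (exp𝕚-+ x x)) double≈1) ⟩
  1ℂ *ℂ conj v         ≈⟨ ≈.*-identityˡ (conj v) ⟩
  conj v               ∎)
  where
  open SetoidReasoning ≈.setoid
  v = exp[𝕚 x ]

0<* : ∀ p q → 0ℚ ℚ.< p → 0ℚ ℚ.< q → 0ℚ ℚ.< p ℚ.* q
0<* p q 0<p 0<q = subst (ℚ._< p ℚ.* q) (ℚ.*-zeroʳ p) (ℚ.*-monoʳ-<-pos p {{ℚ.positive 0<p}} 0<q)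

p<q⇒0<q-p : ∀ p q → p ℚ.< q → 0ℚ ℚ.< q ℚ.- p
p<q⇒0<q-p p q p<q = subst (ℚ._< q ℚ.- p) (ℚ.+-inverseʳ p) (ℚ.+-monoˡ-< (ℚ.- p) p<q)

/1-mono-< : ∀ {m n} → m ℕ.< n → + m ℚ./ 1 ℚ.< + n ℚ./ 1
/1-mono-< {m} {n} m<n = ℚ.toℚᵘ-cancel-< (begin-strict
  ℚ.toℚᵘ (+ m ℚ./ 1)   ≃⟨ ℚ.toℚᵘ-fromℚᵘ (ℚᵘ.mkℚᵘ (+ m) 0) ⟩
  ℚᵘ.mkℚᵘ (+ m) 0      <⟨ ℚᵘ.*<* (ℤ.*-monoʳ-<-pos 1ℤ (ℤ.+<+ m<n)) ⟩
  ℚᵘ.mkℚᵘ (+ n) 0      ≃⟨ ℚ.toℚᵘ-fromℚᵘ (ℚᵘ.mkℚᵘ (+ n) 0) ⟨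
  ℚ.toℚᵘ (+ n ℚ./ 1)   ∎)
  where open ℚᵘ.≤-Reasoning

0<1/suc : ∀ k → 0ℚ ℚ.< 1/suc k
0<1/suc k = ℚ.positive⁻¹ (1/suc k) {{ℚ.normalize-pos 1 (suc k)}}

0<1/ : ∀ l .{{_ : NonZero l}} → 0ℚ ℚ.< + 1 ℚ./ l
0<1/ (suc k) = 0<1/suc k

/1-*-1/ : ∀ l .{{_ : NonZero l}} → (+ l ℚ./ 1) ℚ.* (+ 1 ℚ./ l) ≡ 1ℚ
/1-*-1/ (suc k) = /1-*-1/suc k

angle : ℝ → ℤ → (l : ℕ) .{{_ : NonZero l}} → ℝ
angle π p l = (fromℕ 2 *ℝ π *ℝ fromℤ p) /ℝ l

module _ {π : ℝ} (isPi : IsPi π) where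
  open IsPi isPi

  -- The half angle qπ lies strictly between 0 and `π`; if the double angle gave 1, it would be a
  -- zero of the sine below the least one.
  exp𝕚-2qπ≉1 : ∀ q → 0ℚ ℚ.< q → q ℚ.< 1ℚ → ¬ exp[𝕚 fromℚ q *ℝ π +ℝ fromℚ q *ℝ π ] ≈ 1ℂ
  exp𝕚-2qπ≉1 q 0<q q<1 ≈1 = least x 0<x x<π (exp𝕚-double≈1⇒sin≃0 x ≈1)
    where
    x = fromℚ q *ℝ π
    δ = proj₁ positive
    δ>0 = proj₁ (proj₂ positive)
    δ≤π : Eventually λ n → δ ℚ.≤ approx π n
    δ≤π = eventually-map (λ n → subst (ℚ._≤ approx π n) (ℚ.+-identityˡ δ)) (proj₂ (proj₂ positive))
    0<x : 0ℝ <ℝ x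
    -- `δ` is a positive lower bound of `π`, so qδ is one of qπ.
    0<x = q ℚ.* δ , 0<* q δ 0<q δ>0 , eventually-map
      (λ n δ≤π → subst (ℚ._≤ q ℚ.* approx π n) (sym (ℚ.+-identityˡ (q ℚ.* δ)))
        (ℚ.*-monoˡ-≤-nonNeg q {{ℚ.nonNegative (ℚ.<⇒≤ 0<q)}} δ≤π)) δ≤π
    0<1-q = p<q⇒0<q-p q 1ℚ q<1
    split : ∀ q p → q ℚ.* p ℚ.+ (1ℚ ℚ.- q) ℚ.* p ≡ p
    split = solve 2 (λ q p → q :* p :+ (con 1ℚ :- q) :* p := p) refl
      where open +-*-Solver
    x<π : x <ℝ π
    -- The gap between qπ and `π` is (1 - q)π, which is at least (1 - q)δ.
    x<π = (1ℚ ℚ.- q) ℚ.* δ , 0<* (1ℚ ℚ.- q) δ 0<1-q δ>0 , eventually-map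
      (λ n δ≤π → subst (q ℚ.* approx π n ℚ.+ (1ℚ ℚ.- q) ℚ.* δ ℚ.≤_) (split q (approx π n))
        (ℚ.+-monoʳ-≤ (q ℚ.* approx π n)
          (ℚ.*-monoˡ-≤-nonNeg (1ℚ ℚ.- q) {{ℚ.nonNegative (ℚ.<⇒≤ 0<1-q)}} δ≤π))) δ≤π

  exp𝕚-+angle≉1 : ∀ s l .{{_ : NonZero l}} → suc s ℕ.< l → ¬ exp[𝕚 angle π (+ suc s) l ] ≈ 1ℂ
  exp𝕚-+angle≉1 s l s<l ≈1 = exp𝕚-2qπ≉1 q 0<q q<1
    (≈.trans (exp𝕚-cong {fromℚ q *ℝ π +ℝ fromℚ q *ℝ π} {angle π (+ suc s) l}
      (λ n → rearrange (+ suc s ℚ./ 1) (+ 1 ℚ./ l) (approx π n))) ≈1)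
    where
    q = (+ suc s ℚ./ 1) ℚ.* (+ 1 ℚ./ l)
    0<q = 0<* (+ suc s ℚ./ 1) (+ 1 ℚ./ l) (/1-mono-< {0} {suc s} (ℕ.s≤s ℕ.z≤n)) (0<1/ l)
    q<1 : q ℚ.< 1ℚ
    q<1 = subst (q ℚ.<_) (/1-*-1/ l)
      (ℚ.*-monoˡ-<-pos (+ 1 ℚ./ l) {{ℚ.positive (0<1/ l)}} (/1-mono-< {suc s} {l} s<l))
    rearrange : ∀ s i p → (s ℚ.* i) ℚ.* p ℚ.+ (s ℚ.* i) ℚ.* p ≡ (((+ 2 ℚ./ 1) ℚ.* p) ℚ.* s) ℚ.* i
    rearrange = solve 3 (λ s i p → (s :* i) :* p :+ (s :* i) :* p :=
      ((con (+ 2 ℚ./ 1) :* p) :* s) :* i) refl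
      where open +-*-Solver

  -- A point of the circle equals 1 as soon as its inverse does, which reduces negative `p` to
  -- positive `p`.
  exp𝕚-angle≉1 : ∀ p l .{{_ : NonZero l}} → p ≢ 0ℤ → ℤ.∣ p ∣ ℕ.< l → ¬ exp[𝕚 angle π p l ] ≈ 1ℂ
  exp𝕚-angle≉1 (+ zero)  l p≢0 _ _            = p≢0 refl
  exp𝕚-angle≉1 (+ suc s) l _ s<l ≈1 = exp𝕚-+angle≉1 s l s<l ≈1
  exp𝕚-angle≉1 -[1+ s ]  l _ s<l ≈1 = exp𝕚-+angle≉1 s l s<l (begin
    exp[𝕚 angle π (+ suc s) l ]
      ≈⟨ exp𝕚-cong {angle π (+ suc s) l} { -ℝ θ}
           (λ n → rearrange (+ 2 ℚ./ 1) (approx π n) (+ suc s ℚ./ 1) (+ 1 ℚ./ l)) ⟩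
    exp[𝕚 -ℝ θ ]                  ≈⟨ ≈.*-identityˡ _ ⟨
    1ℂ *ℂ exp[𝕚 -ℝ θ ]            ≈⟨ ≈.*-congʳ ≈1 ⟨
    exp[𝕚 θ ] *ℂ exp[𝕚 -ℝ θ ]     ≈⟨ exp𝕚-inverse θ ⟩
    1ℂ                            ∎)
    where
    open SetoidReasoning ≈.setoid
    θ = angle π -[1+ s ] l
    rearrange : ∀ t p s i → ((t ℚ.* p) ℚ.* s) ℚ.* i ≡ ℚ.- (((t ℚ.* p) ℚ.* (ℚ.- s)) ℚ.* i)
    rearrange = solve 4 (λ t p s i → ((t :* p) :* s) :* i := :- (((t :* p) :* (:- s)) :* i)) refl
      where open +-*-Solver

  exp𝕚-2π≈1 : exp[𝕚 fromℕ 2 *ℝ π ] ≈ 1ℂ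
  exp𝕚-2π≈1 = ≈.trans (exp𝕚-cong {fromℕ 2 *ℝ π} {π +ℝ π} (λ n → double (approx π n)))
    (sin≃0⇒exp𝕚-double≈1 π root)
    where
    double : ∀ p → (+ 2 ℚ./ 1) ℚ.* p ≡ p ℚ.+ p
    double = solve 1 (λ p → con (+ 2 ℚ./ 1) :* p := p :+ p) refl
      where open +-*-Solver

*-/1-suc : ∀ q k → q ℚ.* (+ suc k ℚ./ 1) ≡ q ℚ.+ q ℚ.* (+ k ℚ./ 1)
*-/1-suc q k = trans (cong (q ℚ.*_) (/1-homo-+ 1ℤ (+ k)))
  (trans (ℚ.*-distribˡ-+ q 1ℚ (+ k ℚ./ 1)) (cong (ℚ._+ q ℚ.* (+ k ℚ./ 1)) (ℚ.*-identityʳ q)))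

exp𝕚-*-suc : ∀ x k → exp[𝕚 x *ℝ fromℕ (suc k) ] ≈ exp[𝕚 x ] *ℂ exp[𝕚 x *ℝ fromℕ k ]
exp𝕚-*-suc x k = ≈.trans
  (exp𝕚-cong {x *ℝ fromℕ (suc k)} {x +ℝ x *ℝ fromℕ k} (λ n → *-/1-suc (approx x n) k))
  (exp𝕚-+ x (x *ℝ fromℕ k))

exp𝕚-*-0 : ∀ x → exp[𝕚 x *ℝ fromℕ 0 ] ≈ 1ℂ
exp𝕚-*-0 x = exp𝕚-0 {x *ℝ fromℕ 0} (λ n → ℚ.*-zeroʳ (approx x n))

exp𝕚-*ℕ≈1 : ∀ {x} → exp[𝕚 x ] ≈ 1ℂ → ∀ k → exp[𝕚 x *ℝ fromℕ k ] ≈ 1ℂ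
exp𝕚-*ℕ≈1 {x} ≈1 zero    = exp𝕚-*-0 x
exp𝕚-*ℕ≈1 {x} ≈1 (suc k) = ≈.trans (exp𝕚-*-suc x k)
  (≈.trans (≈.*-cong ≈1 (exp𝕚-*ℕ≈1 {x} ≈1 k)) (≈.*-identityˡ 1ℂ))

exp𝕚-*ℤ≈1 : ∀ {x} → exp[𝕚 x ] ≈ 1ℂ → ∀ i → exp[𝕚 x *ℝ fromℤ i ] ≈ 1ℂ
exp𝕚-*ℤ≈1 {x} ≈1 (+ k)    = exp𝕚-*ℕ≈1 {x} ≈1 k
exp𝕚-*ℤ≈1 {x} ≈1 -[1+ k ] = begin
  exp[𝕚 x *ℝ fromℤ -[1+ k ] ]
    ≈⟨ exp𝕚-cong {x *ℝ fromℤ -[1+ k ]} { -ℝ y}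
         (λ n → sym (ℚ.neg-distribʳ-* (approx x n) (+ suc k ℚ./ 1))) ⟩
  exp[𝕚 -ℝ y ]                  ≈⟨ ≈.*-identityˡ _ ⟨
  1ℂ *ℂ exp[𝕚 -ℝ y ]            ≈⟨ ≈.*-congʳ (exp𝕚-*ℕ≈1 {x} ≈1 (suc k)) ⟨
  exp[𝕚 y ] *ℂ exp[𝕚 -ℝ y ]     ≈⟨ exp𝕚-inverse y ⟩
  1ℂ                            ∎
  where
  open SetoidReasoning ≈.setoid
  y = x *ℝ fromℕ (suc k)

-- Stability of equality and order under double negation

-- One decidable comparison of rationals suffices: beyond `N` the approximants differ by at most ½ε,
-- so `approx x N` either bounds all later ones by ε or exceeds ½ε, and then the excess is a
-- positive lower bound for `x`.
¬positive⇒null : ∀ x → ¬ (∃ λ δ → 0ℚ ℚ.< δ × Eventually λ n → δ ℚ.≤ approx x n) → Null (approx x)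
¬positive⇒null x ¬pos ε ε>0 with cauchy x (½ ℚ.* ε) (half>0 ε>0)
... | N , close with approx x N ℚ.≤? ½ ℚ.* ε
... | yes xN≤ = N , λ n N≤n → subst (approx x n ℚ.≤_) (halves ε)
  (ℚ.≤-trans (p≤q+δ {approx x n} {approx x N} (close n N N≤n ℕ.≤-refl))
             (ℚ.+-monoˡ-≤ (½ ℚ.* ε) xN≤))
... | no xN≰ = ⊥-elim (¬pos
  ( approx x N ℚ.- ½ ℚ.* ε , p<q⇒0<q-p (½ ℚ.* ε) (approx x N) (ℚ.≰⇒> xN≰) , N
  , λ n N≤n → p-q≤δ (approx x N) (½ ℚ.* ε) (subst (approx x N ℚ.≤_)
      (ℚ.+-comm (approx x n) (½ ℚ.* ε)) (q≤p+δ {approx x n} {approx x N} (close n N N≤n ℕ.≤-refl))) ))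

¬<⇒≥ : ∀ x y → ¬ x <ℝ y → y ≤ℝ x
¬<⇒≥ x y x≮y ε ε>0 = eventually-map
  (λ n y-x≤ε → subst (ℚ._≤ approx x n ℚ.+ ε) (restore (approx y n) (approx x n))
    (ℚ.+-monoʳ-≤ (approx x n) y-x≤ε))
  (¬positive⇒null (y -ℝ x) (λ (δ , δ>0 , δ≤) → x≮y (δ , δ>0 , eventually-map
    (λ n δ≤y-x → subst (approx x n ℚ.+ δ ℚ.≤_) (restore (approx y n) (approx x n))
      (ℚ.+-monoʳ-≤ (approx x n) δ≤y-x)) δ≤)) ε ε>0)
  where
  restore : ∀ p q → q ℚ.+ (p ℚ.- q) ≡ p
  restore = solve 2 (λ p q → q :+ (p :- q) := p) refl
    where open +-*-Solver

-- Positive evidence of being non-zero, strong enough to divide by.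
Apart : ℝ → Set
Apart x = ∃ λ δ → 0ℚ ℚ.< δ × Eventually λ n → δ ℚ.≤ ℚ.∣ approx x n ∣

¬apart⇒≃0 : ∀ x → ¬ Apart x → x ≃ℝ 0ℝ
¬apart⇒≃0 x ¬apart = null-≤
  (λ n → ℚ.≤-reflexive (cong ℚ.∣_∣ (ℚ.+-identityʳ (approx x n))))
  (¬positive⇒null ∣ x ∣ℝ ¬apart)

*-apart⇒≃0 : ∀ x y → Apart y → x *ℝ y ≃ℝ 0ℝ → x ≃ℝ 0ℝ
*-apart⇒≃0 x y (δ , δ>0 , δ≤y) xy≃0 = null-squeeze (positive-inverse)
  (eventually-map (λ n → bound (approx x n) (approx y n)) δ≤y) xy≃0
  where
  -- `B` is 1/δ, an eventual bound for the inverse of the modulus of `y`.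
  inverse-δ = divide {δ} {1ℚ} δ>0 (ℚ.positive⁻¹ 1ℚ)
  B = proj₁ inverse-δ
  positive-inverse = proj₁ (proj₂ inverse-δ)
  open ℚ.≤-Reasoning
  bound : ∀ p q → δ ℚ.≤ ℚ.∣ q ∣ → ℚ.∣ p ℚ.- 0ℚ ∣ ℚ.≤ B ℚ.* ℚ.∣ p ℚ.* q ℚ.- 0ℚ ∣
  bound p q δ≤q = begin
    ℚ.∣ p ℚ.- 0ℚ ∣               ≡⟨ cong ℚ.∣_∣ (ℚ.+-identityʳ p) ⟩
    ℚ.∣ p ∣                      ≡⟨ ℚ.*-identityˡ ℚ.∣ p ∣ ⟨
    1ℚ ℚ.* ℚ.∣ p ∣               ≡⟨ cong (ℚ._* ℚ.∣ p ∣) (trans (ℚ.*-comm B δ) (proj₂ (proj₂ inverse-δ))) ⟨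
    B ℚ.* δ ℚ.* ℚ.∣ p ∣          ≡⟨ trans (ℚ.*-assoc B δ ℚ.∣ p ∣) (cong (B ℚ.*_) (ℚ.*-comm δ ℚ.∣ p ∣)) ⟩
    B ℚ.* (ℚ.∣ p ∣ ℚ.* δ)        ≤⟨ ℚ.*-monoˡ-≤-nonNeg B {{ℚ.nonNegative (ℚ.<⇒≤ positive-inverse)}}
                                      (ℚ.*-monoˡ-≤-nonNeg ℚ.∣ p ∣ {{ℚ.nonNegative (ℚ.0≤∣p∣ p)}} δ≤q) ⟩
    B ℚ.* (ℚ.∣ p ∣ ℚ.* ℚ.∣ q ∣)  ≡⟨ cong (B ℚ.*_) (ℚ.∣p*q∣≡∣p∣*∣q∣ p q) ⟨
    B ℚ.* ℚ.∣ p ℚ.* q ∣          ≡⟨ cong (λ t → B ℚ.* ℚ.∣ t ∣) (ℚ.+-identityʳ (p ℚ.* q)) ⟨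
    B ℚ.* ℚ.∣ p ℚ.* q ℚ.- 0ℚ ∣   ∎

∣_∣² : ℂ → ℝ
∣ z ∣² = re z *ℝ re z +ℝ im z *ℝ im z

*-conj : ∀ z → z *ℂ conj z ≐ ofReal ∣ z ∣²
*-conj z = pointwise
  (λ n → re-part (approx (re z) n) (approx (im z) n))
  (λ n → im-part (approx (re z) n) (approx (im z) n))
  where
  open +-*-Solver
  re-part : ∀ a b → a ℚ.* a ℚ.- b ℚ.* (ℚ.- b) ≡ a ℚ.* a ℚ.+ b ℚ.* b
  re-part = solve 2 (λ a b → a :* a :- b :* (:- b) := a :* a :+ b :* b) refl
  im-part : ∀ a b → a ℚ.* (ℚ.- b) ℚ.+ b ℚ.* a ≡ 0ℚ
  im-part = solve 2 (λ a b → a :* (:- b) :+ b :* a := con 0ℚ) refl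

*-ofReal : ∀ z x → z *ℂ ofReal x ≐ (re z *ℝ x) +i (im z *ℝ x)
*-ofReal z x = pointwise
  (λ n → re-part (approx (re z) n) (approx (im z) n) (approx x n))
  (λ n → im-part (approx (re z) n) (approx (im z) n) (approx x n))
  where
  open +-*-Solver
  re-part : ∀ a b c → a ℚ.* c ℚ.- b ℚ.* 0ℚ ≡ a ℚ.* c
  re-part = solve 3 (λ a b c → a :* c :- b :* con 0ℚ := a :* c) refl
  im-part : ∀ a b c → a ℚ.* 0ℚ ℚ.+ b ℚ.* c ≡ b ℚ.* c
  im-part = solve 3 (λ a b c → a :* con 0ℚ :+ b :* c := b :* c) refl

0≤p² : ∀ p → 0ℚ ℚ.≤ p ℚ.* p
0≤p² p with ℚ.≤-total 0ℚ p
... | inj₁ 0≤p = 0≤* p p 0≤p 0≤p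
... | inj₂ p≤0 = subst (0ℚ ℚ.≤_) (square p) (0≤* (ℚ.- p) (ℚ.- p) 0≤-p 0≤-p)
  where
  0≤-p : 0ℚ ℚ.≤ ℚ.- p
  0≤-p = ℚ.neg-antimono-≤ p≤0
  square : ∀ p → (ℚ.- p) ℚ.* (ℚ.- p) ≡ p ℚ.* p
  square = solve 1 (λ p → (:- p) :* (:- p) := p :* p) refl
    where open +-*-Solver

≤∣p∣⇒≤p² : ∀ p {δ} → 0ℚ ℚ.≤ δ → δ ℚ.≤ ℚ.∣ p ∣ → δ ℚ.* δ ℚ.≤ p ℚ.* p
≤∣p∣⇒≤p² p {δ} 0≤δ δ≤p = subst (δ ℚ.* δ ℚ.≤_)
  (trans (sym (ℚ.∣p*q∣≡∣p∣*∣q∣ p p)) (ℚ.0≤p⇒∣p∣≡p (0≤p² p)))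
  (*-mono-≤-nonNeg 0≤δ (ℚ.0≤∣p∣ p) δ≤p δ≤p)

re-apart⇒∣∣²-apart : ∀ z → Apart (re z) → Apart ∣ z ∣²
re-apart⇒∣∣²-apart z (δ , δ>0 , δ≤) = δ ℚ.* δ , 0<* δ δ δ>0 δ>0 , eventually-map
  (λ n δ≤ → ℚ.≤-trans (≤∣p∣⇒≤p² (approx (re z) n) (ℚ.<⇒≤ δ>0) δ≤)
    (ℚ.≤-trans (p≤p+q _ _ (0≤p² (approx (im z) n))) (p≤∣p∣ (approx ∣ z ∣² n)))) δ≤

im-apart⇒∣∣²-apart : ∀ z → Apart (im z) → Apart ∣ z ∣²
im-apart⇒∣∣²-apart z (δ , δ>0 , δ≤) = δ ℚ.* δ , 0<* δ δ δ>0 δ>0 , eventually-map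
  (λ n δ≤ → ℚ.≤-trans (≤∣p∣⇒≤p² (approx (im z) n) (ℚ.<⇒≤ δ>0) δ≤)
    (ℚ.≤-trans (q≤p+q _ _ (0≤p² (approx (re z) n))) (p≤∣p∣ (approx ∣ z ∣² n)))) δ≤

-- Equality to 0 follows from refuting apartness. If a coordinate of `w` were apart from 0, so would
-- be `∣ w ∣²`, and z∣w∣² = (zw) conj w = 0 could be divided by it to give z = 0.
*≈0⇒≈0 : ∀ z w → ¬ z ≈ 0ℂ → z *ℂ w ≈ 0ℂ → w ≈ 0ℂ
*≈0⇒≈0 z w z≉0 zw≈0 = asymptotic
  ( ¬apart⇒≃0 (re w) (z≉0 ∘ z≈0 ∘ re-apart⇒∣∣²-apart w)
  , ¬apart⇒≃0 (im w) (z≉0 ∘ z≈0 ∘ im-apart⇒∣∣²-apart w) )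
  where
  open SetoidReasoning ≈.setoid
  z∣w∣²≈0 : ((re z *ℝ ∣ w ∣²) +i (im z *ℝ ∣ w ∣²)) ≈ 0ℂ
  z∣w∣²≈0 = begin
    (re z *ℝ ∣ w ∣²) +i (im z *ℝ ∣ w ∣²)   ≈⟨ ≐⇒≈ (*-ofReal z ∣ w ∣²) ⟨
    z *ℂ ofReal ∣ w ∣²                     ≈⟨ ≈.*-congˡ (≐⇒≈ (*-conj w)) ⟨
    z *ℂ (w *ℂ conj w)                     ≈⟨ ≈.*-assoc z w (conj w) ⟨
    z *ℂ w *ℂ conj w                       ≈⟨ ≈.*-congʳ zw≈0 ⟩
    0ℂ *ℂ conj w                           ≈⟨ ≈.zeroˡ (conj w) ⟩
    0ℂ                                     ∎
  z≈0 : Apart ∣ w ∣² → z ≈ 0ℂ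
  z≈0 apart = asymptotic
    ( *-apart⇒≃0 (re z) ∣ w ∣² apart (proj₁ (≈⇒≃ z∣w∣²≈0))
    , *-apart⇒≃0 (im z) ∣ w ∣² apart (proj₂ (≈⇒≃ z∣w∣²≈0)) )

-- Sums over the grid

∑₁-cong : ∀ {F G} → (∀ m → F m ≈ G m) → ∀ l → ∑₁ l F ≈ ∑₁ l G
∑₁-cong F≈G zero    = ≈.refl
∑₁-cong F≈G (suc l) = ≈.+-cong (∑₁-cong F≈G l) (F≈G (suc l))

∑₁-linear : ∀ c F G l → ∑₁ l (λ m → c *ℂ F m +ℂ G m) ≈ c *ℂ ∑₁ l F +ℂ ∑₁ l G
∑₁-linear c F G zero    = ≈.sym (≈.trans (≈.+-identityʳ (c *ℂ 0ℂ)) (≈.zeroʳ c))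
∑₁-linear c F G (suc l) = begin
  ∑₁ l (λ m → c *ℂ F m +ℂ G m) +ℂ (c *ℂ F (suc l) +ℂ G (suc l))
    ≈⟨ ≈.+-congʳ (∑₁-linear c F G l) ⟩
  (c *ℂ ∑₁ l F +ℂ ∑₁ l G) +ℂ (c *ℂ F (suc l) +ℂ G (suc l))
    ≈⟨ interchange _ _ _ _ ⟩
  (c *ℂ ∑₁ l F +ℂ c *ℂ F (suc l)) +ℂ (∑₁ l G +ℂ G (suc l))
    ≈⟨ ≈.+-congʳ (≈.distribˡ c (∑₁ l F) (F (suc l))) ⟨
  c *ℂ (∑₁ l F +ℂ F (suc l)) +ℂ (∑₁ l G +ℂ G (suc l)) ∎
  where
  open SetoidReasoning ≈.setoid
  open CommutativeSemigroupProperties ≈.+-commutativeSemigroup using (interchange)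

∑₁-*ˡ : ∀ c F l → ∑₁ l (λ m → c *ℂ F m) ≈ c *ℂ ∑₁ l F
∑₁-*ˡ c F zero    = ≈.sym (≈.zeroʳ c)
∑₁-*ˡ c F (suc l) = ≈.trans (≈.+-congʳ (∑₁-*ˡ c F l)) (≈.sym (≈.distribˡ c (∑₁ l F) (F (suc l))))

∑₁-*ʳ : ∀ c F l → ∑₁ l (λ m → F m *ℂ c) ≈ ∑₁ l F *ℂ c
∑₁-*ʳ c F l = ≈.trans (∑₁-cong (λ m → ≈.*-comm (F m) c) l)
  (≈.trans (∑₁-*ˡ c F l) (≈.*-comm c (∑₁ l F)))

∑₁⁴-cong : ∀ {F G} → (∀ m₁ m₂ m₃ m₄ → F m₁ m₂ m₃ m₄ ≈ G m₁ m₂ m₃ m₄) → ∀ l → ∑₁⁴ l F ≈ ∑₁⁴ l G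
∑₁⁴-cong F≈G l = ∑₁-cong (λ m₁ → ∑₁-cong (λ m₂ → ∑₁-cong (λ m₃ → ∑₁-cong (F≈G m₁ m₂ m₃) l) l) l) l

∑₁⁴-linear : ∀ c F G l → ∑₁⁴ l (λ m₁ m₂ m₃ m₄ → c *ℂ F m₁ m₂ m₃ m₄ +ℂ G m₁ m₂ m₃ m₄) ≈
                         c *ℂ ∑₁⁴ l F +ℂ ∑₁⁴ l G
∑₁⁴-linear c F G l = ≈.trans
  (∑₁-cong (λ m₁ → ≈.trans
    (∑₁-cong (λ m₂ → ≈.trans
      (∑₁-cong (λ m₃ → ∑₁-linear c (F m₁ m₂ m₃) (G m₁ m₂ m₃) l) l)
      (∑₁-linear c _ _ l)) l)
    (∑₁-linear c _ _ l)) l)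
  (∑₁-linear c _ _ l)

-- Each sum is pulled out past the factors that are constant in its index, innermost first.
∑₁⁴-product : ∀ F₁ F₂ F₃ F₄ l → ∑₁⁴ l (λ m₁ m₂ m₃ m₄ → F₁ m₁ *ℂ F₂ m₂ *ℂ F₃ m₃ *ℂ F₄ m₄) ≈
                                ∑₁ l F₁ *ℂ ∑₁ l F₂ *ℂ ∑₁ l F₃ *ℂ ∑₁ l F₄
∑₁⁴-product F₁ F₂ F₃ F₄ l = ≈.trans
  (∑₁-cong (λ m₁ → ≈.trans
    (∑₁-cong (λ m₂ → ≈.trans
      (∑₁-cong (λ m₃ → ∑₁-*ˡ (F₁ m₁ *ℂ F₂ m₂ *ℂ F₃ m₃) F₄ l) l)
      (≈.trans (∑₁-*ʳ (∑₁ l F₄) (λ m₃ → F₁ m₁ *ℂ F₂ m₂ *ℂ F₃ m₃) l)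
        (≈.*-congʳ (∑₁-*ˡ (F₁ m₁ *ℂ F₂ m₂) F₃ l)))) l)
    (≈.trans (∑₁-*ʳ (∑₁ l F₄) (λ m₂ → F₁ m₁ *ℂ F₂ m₂ *ℂ ∑₁ l F₃) l)
      (≈.*-congʳ (≈.trans (∑₁-*ʳ (∑₁ l F₃) (λ m₂ → F₁ m₁ *ℂ F₂ m₂) l)
        (≈.*-congʳ (∑₁-*ˡ (F₁ m₁) F₂ l)))))) l)
  (≈.trans (∑₁-*ʳ (∑₁ l F₄) (λ m₁ → F₁ m₁ *ℂ ∑₁ l F₂ *ℂ ∑₁ l F₃) l)
    (≈.*-congʳ (≈.trans (∑₁-*ʳ (∑₁ l F₃) (λ m₁ → F₁ m₁ *ℂ ∑₁ l F₂) l)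
      (≈.*-congʳ (∑₁-*ʳ (∑₁ l F₂) F₁ l)))))

∑₁⁴-product≈0 : ∀ F₁ F₂ F₃ F₄ l → ∑₁ l F₁ ≈ 0ℂ ⊎ ∑₁ l F₂ ≈ 0ℂ ⊎ ∑₁ l F₃ ≈ 0ℂ ⊎ ∑₁ l F₄ ≈ 0ℂ →
  ∑₁⁴ l (λ m₁ m₂ m₃ m₄ → F₁ m₁ *ℂ F₂ m₂ *ℂ F₃ m₃ *ℂ F₄ m₄) ≈ 0ℂ
∑₁⁴-product≈0 F₁ F₂ F₃ F₄ l some≈0 = ≈.trans (∑₁⁴-product F₁ F₂ F₃ F₄ l) (product≈0 some≈0)
  where
  S₁ = ∑₁ l F₁
  S₂ = ∑₁ l F₂
  S₃ = ∑₁ l F₃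
  S₄ = ∑₁ l F₄
  *0 : ∀ z {w} → w ≈ 0ℂ → z *ℂ w ≈ 0ℂ
  *0 z w≈0 = ≈.trans (≈.*-congˡ w≈0) (≈.zeroʳ z)
  0* : ∀ {z} w → z ≈ 0ℂ → z *ℂ w ≈ 0ℂ
  0* w z≈0 = ≈.trans (≈.*-congʳ z≈0) (≈.zeroˡ w)
  product≈0 : S₁ ≈ 0ℂ ⊎ S₂ ≈ 0ℂ ⊎ S₃ ≈ 0ℂ ⊎ S₄ ≈ 0ℂ → S₁ *ℂ S₂ *ℂ S₃ *ℂ S₄ ≈ 0ℂ
  product≈0 (inj₁ S₁≈0)               = 0* S₄ (0* S₃ (0* S₂ S₁≈0))
  product≈0 (inj₂ (inj₁ S₂≈0))        = 0* S₄ (0* S₃ (*0 S₁ S₂≈0))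
  product≈0 (inj₂ (inj₂ (inj₁ S₃≈0))) = 0* S₄ (*0 (S₁ *ℂ S₂) S₃≈0)
  product≈0 (inj₂ (inj₂ (inj₂ S₄≈0))) = *0 (S₁ *ℂ S₂ *ℂ S₃) S₄≈0

-- Both sides are the sum over 1, ..., l + 1.
∑₁-shift : ∀ F l → ∑₁ l (F ∘ suc) +ℂ F 1 ≈ ∑₁ l F +ℂ F (suc l)
∑₁-shift F zero    = ≈.refl
∑₁-shift F (suc l) = begin
  (∑₁ l (F ∘ suc) +ℂ F (2 ℕ.+ l)) +ℂ F 1   ≈⟨ xy∙z≈xz∙y _ _ _ ⟩
  (∑₁ l (F ∘ suc) +ℂ F 1) +ℂ F (2 ℕ.+ l)   ≈⟨ ≈.+-congʳ (∑₁-shift F l) ⟩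
  (∑₁ l F +ℂ F (suc l)) +ℂ F (2 ℕ.+ l)     ∎
  where
  open SetoidReasoning ≈.setoid
  open CommutativeSemigroupProperties ≈.+-commutativeSemigroup using (xy∙z≈xz∙y)

-- Multiplication by z permutes the summands cyclically, so it fixes their sum.

geometric≈0 : ∀ z F l → ¬ z ≈ 1ℂ → (∀ m → F (suc m) ≈ z *ℂ F m) →
              F 0 ≈ 1ℂ → F l ≈ 1ℂ → ∑₁ l F ≈ 0ℂ
geometric≈0 z F l z≉1 step F0≈1 Fl≈1 =
  *≈0⇒≈0 (z +ℂ -ℂ 1ℂ) S (λ z-1≈0 → z≉1 (x∙y⁻¹≈ε⇒x≈y z 1ℂ z-1≈0)) (begin
    (z +ℂ -ℂ 1ℂ) *ℂ S          ≈⟨ ≈.distribʳ S z (-ℂ 1ℂ) ⟩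
    z *ℂ S +ℂ -ℂ 1ℂ *ℂ S       ≈⟨ ≈.+-cong zS≈S (-1*x≈-x S) ⟩
    S +ℂ -ℂ S                  ≈⟨ ≈.-‿inverseʳ S ⟩
    0ℂ                         ∎)
  where
  open SetoidReasoning ≈.setoid
  open RingProperties ≈.ring using (-1*x≈-x; x∙y⁻¹≈ε⇒x≈y; +-cancelʳ)
  S = ∑₁ l F
  F1≈z : F 1 ≈ z
  F1≈z = ≈.trans (step 0) (≈.trans (≈.*-congˡ F0≈1) (≈.*-identityʳ z))
  zS≈S : z *ℂ S ≈ S
  zS≈S = +-cancelʳ z (z *ℂ S) S (begin
    z *ℂ S +ℂ z                        ≈⟨ ≈.+-cong (∑₁-*ˡ z F l) F1≈z ⟨
    ∑₁ l (λ m → z *ℂ F m) +ℂ F 1       ≈⟨ ≈.+-congʳ (∑₁-cong step l) ⟨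
    ∑₁ l (F ∘ suc) +ℂ F 1              ≈⟨ ∑₁-shift F l ⟩
    S +ℂ F (suc l)                     ≈⟨ ≈.+-congˡ (≈.trans (step l) (≈.*-congˡ Fl≈1)) ⟩
    S +ℂ z *ℂ 1ℂ                       ≈⟨ ≈.+-congˡ (≈.*-identityʳ z) ⟩
    S +ℂ z                             ∎)

∑₁-exp𝕚-angle≈0 : ∀ {π} → IsPi π → ∀ p l .{{_ : NonZero l}} → p ≢ 0ℤ → ℤ.∣ p ∣ ℕ.< l →
                  ∑₁ l (λ m → exp[𝕚 angle π p l *ℝ fromℕ m ]) ≈ 0ℂ
∑₁-exp𝕚-angle≈0 {π} isPi p l p≢0 p<l =
  geometric≈0 exp[𝕚 θ ] (λ m → exp[𝕚 θ *ℝ fromℕ m ]) l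
    (exp𝕚-angle≉1 isPi p l p≢0 p<l) (exp𝕚-*-suc θ) (exp𝕚-*-0 θ)
    -- The progression closes up after `l` steps: `l` times the angle is `p` full turns.
    (≈.trans (exp𝕚-cong {θ *ℝ fromℕ l} {fromℕ 2 *ℝ π *ℝ fromℤ p}
        (λ n → full-turn (approx (fromℕ 2 *ℝ π *ℝ fromℤ p) n)))
      (exp𝕚-*ℤ≈1 {fromℕ 2 *ℝ π} (exp𝕚-2π≈1 isPi) p))
  where
  θ = angle π p l
  full-turn : ∀ q → q ℚ.* (+ 1 ℚ./ l) ℚ.* (+ l ℚ./ 1) ≡ q
  full-turn q = trans (ℚ.*-assoc q (+ 1 ℚ./ l) (+ l ℚ./ 1))
    (trans (cong (q ℚ.*_) (trans (ℚ.*-comm (+ 1 ℚ./ l) (+ l ℚ./ 1)) (/1-*-1/ l)))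
      (ℚ.*-identityʳ q))

-- A non-zero frequency in each quadruple

minimum≤ : ∀ {m} (F : Fin m → ℝ) k n → approx (minimum F) n ℚ.≤ approx (F k) n
minimum≤ {suc zero}    F zero    n = ℚ.≤-refl
minimum≤ {suc (suc m)} F zero    n = ℚ.p⊓q≤p (approx (F zero) n) (approx (minimum (F ∘ suc)) n)
minimum≤ {suc (suc m)} F (suc k) n = ℚ.≤-trans
  (ℚ.p⊓q≤q (approx (F zero) n) (approx (minimum (F ∘ suc)) n)) (minimum≤ (F ∘ suc) k n)

≤-foldr-⊔ : ∀ {m} (f : Fin m → ℕ) k → f k ℕ.≤ foldr ℕ._⊔_ 0 f
≤-foldr-⊔ f zero    = ℕ.m≤m⊔n (f zero) (foldr ℕ._⊔_ 0 (f ∘ suc))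
≤-foldr-⊔ f (suc k) = ℕ.≤-trans (≤-foldr-⊔ (f ∘ suc) k) (ℕ.m≤n⊔m (f zero) (foldr ℕ._⊔_ 0 (f ∘ suc)))

⊔-lub-< : ∀ {p q r} → p ℚ.< r → q ℚ.< r → p ℚ.⊔ q ℚ.< r
⊔-lub-< {p} {q} {r} p<r q<r with ℚ.⊔-sel p q
... | inj₁ ⊔≡p = subst (ℚ._< r) (sym ⊔≡p) p<r
... | inj₂ ⊔≡q = subst (ℚ._< r) (sym ⊔≡q) q<r

<ℝ⇒eventually-< : ∀ x y → x <ℝ y → Eventually λ n → approx x n ℚ.< approx y n
<ℝ⇒eventually-< x y (δ , δ>0 , x+δ≤y) = eventually-map
  (λ n x+δ≤y → ℚ.<-≤-trans
    (subst (ℚ._< approx x n ℚ.+ δ) (ℚ.+-identityʳ (approx x n)) (ℚ.+-monoʳ-< (approx x n) δ>0)) x+δ≤y)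
  x+δ≤y

-- ≤ℝ on a maximum of four cannot be decided, so the argument that one of the four
-- frequencies reaches the minimum μ only refutes that all four fail to.

¬¬≤⊔⁴ : ∀ m x y z w → (∀ n → approx m n ℚ.≤ approx (x ⊔ℝ y ⊔ℝ z ⊔ℝ w) n) →
        ¬ (m ≤ℝ x) → ¬ (m ≤ℝ y) → ¬ (m ≤ℝ z) → ¬ (m ≤ℝ w) → ⊥
¬¬≤⊔⁴ m x y z w m≤ m≰x m≰y m≰z m≰w =
  m≰x (¬<⇒≥ x m λ x<m → m≰y (¬<⇒≥ y m λ y<m → m≰z (¬<⇒≥ z m λ z<m → m≰w (¬<⇒≥ w m λ w<m →
    absurd (eventually-zip (λ n x<m y<m → ⊔-lub-< {approx x n} x<m y<m)
             (<ℝ⇒eventually-< x m x<m) (<ℝ⇒eventually-< y m y<m))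
           (<ℝ⇒eventually-< z m z<m) (<ℝ⇒eventually-< w m w<m)))))
  where
  absurd : Eventually (λ n → approx x n ℚ.⊔ approx y n ℚ.< approx m n) →
           Eventually (λ n → approx z n ℚ.< approx m n) →
           Eventually (λ n → approx w n ℚ.< approx m n) → ⊥
  absurd xy<m z<m w<m = ℚ.<-irrefl refl (ℚ.≤-<-trans (m≤ N) (proj₂ all<m N ℕ.≤-refl))
    where
    all<m : Eventually λ n → approx (x ⊔ℝ y ⊔ℝ z ⊔ℝ w) n ℚ.< approx m n
    all<m = eventually-zip (λ n xyz<m w<m → ⊔-lub-< {approx (x ⊔ℝ y ⊔ℝ z) n} xyz<m w<m)
      (eventually-zip (λ n xy<m z<m → ⊔-lub-< {approx (x ⊔ℝ y) n} xy<m z<m) xy<m z<m) w<m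
    N = proj₁ all<m

module _ {π : ℝ} {n : ℕ} {z′ : Integerization n} (separates : SeparatesFromZero π z′)
         (k : Fin (3 ℕ.^ n ℕ.∸ 1)) where
  open Coefficients π n

  -- The maximum of the four moduli is at least `μ` at every index of approximation, since a minimum
  -- is bounded by its entry at `k`. Four vanishing integerized frequencies would keep each single
  -- modulus from reaching `μ`.
  ¬all-frequencies≡0 : z′A z′ k ≡ 0ℤ → z′B z′ k ≡ 0ℤ → z′C z′ k ≡ 0ℤ → z′D z′ k ≡ 0ℤ → ⊥
  ¬all-frequencies≡0 A≡0 B≡0 C≡0 D≡0 =
    ¬¬≤⊔⁴ μ ∣ A k ∣ℝ ∣ B k ∣ℝ ∣ C k ∣ℝ ∣ D k ∣ℝ
      (minimum≤ (λ k → ∣ A k ∣ℝ ⊔ℝ ∣ B k ∣ℝ ⊔ℝ ∣ C k ∣ℝ ⊔ℝ ∣ D k ∣ℝ) k)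
      (λ μ≤ → proj₁ (separates k) μ≤ A≡0)
      (λ μ≤ → proj₁ (proj₂ (separates k)) μ≤ B≡0)
      (λ μ≤ → proj₁ (proj₂ (proj₂ (separates k))) μ≤ C≡0)
      (λ μ≤ → proj₂ (proj₂ (proj₂ (separates k))) μ≤ D≡0)

module _ {n : ℕ} (z′ : Integerization n) (k : Fin (3 ℕ.^ n ℕ.∸ 1)) where
  private
    ∣A∣ ∣B∣ ∣C∣ ∣D∣ : ℕ
    ∣A∣ = ℤ.∣ z′A z′ k ∣
    ∣B∣ = ℤ.∣ z′B z′ k ∣
    ∣C∣ = ℤ.∣ z′C z′ k ∣
    ∣D∣ = ℤ.∣ z′D z′ k ∣

    ⊔≤max : ∣A∣ ℕ.⊔ ∣B∣ ℕ.⊔ ∣C∣ ℕ.⊔ ∣D∣ ℕ.≤ maximalMaximum z′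
    ⊔≤max = ≤-foldr-⊔
      (λ k → ℤ.∣ z′A z′ k ∣ ℕ.⊔ ℤ.∣ z′B z′ k ∣ ℕ.⊔ ℤ.∣ z′C z′ k ∣ ℕ.⊔ ℤ.∣ z′D z′ k ∣) k

  ∣z′D∣≤max : ∣D∣ ℕ.≤ maximalMaximum z′
  ∣z′D∣≤max = ℕ.m⊔n≤o⇒n≤o (∣A∣ ℕ.⊔ ∣B∣ ℕ.⊔ ∣C∣) ∣D∣ ⊔≤max

  ∣z′C∣≤max : ∣C∣ ℕ.≤ maximalMaximum z′
  ∣z′C∣≤max = ℕ.m⊔n≤o⇒n≤o (∣A∣ ℕ.⊔ ∣B∣) ∣C∣ (ℕ.m⊔n≤o⇒m≤o (∣A∣ ℕ.⊔ ∣B∣ ℕ.⊔ ∣C∣) ∣D∣ ⊔≤max)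

  ∣z′B∣≤max : ∣B∣ ℕ.≤ maximalMaximum z′
  ∣z′B∣≤max = ℕ.m⊔n≤o⇒n≤o ∣A∣ ∣B∣
    (ℕ.m⊔n≤o⇒m≤o (∣A∣ ℕ.⊔ ∣B∣) ∣C∣ (ℕ.m⊔n≤o⇒m≤o (∣A∣ ℕ.⊔ ∣B∣ ℕ.⊔ ∣C∣) ∣D∣ ⊔≤max))

  ∣z′A∣≤max : ∣A∣ ℕ.≤ maximalMaximum z′
  ∣z′A∣≤max = ℕ.m⊔n≤o⇒m≤o ∣A∣ ∣B∣
    (ℕ.m⊔n≤o⇒m≤o (∣A∣ ℕ.⊔ ∣B∣) ∣C∣ (ℕ.m⊔n≤o⇒m≤o (∣A∣ ℕ.⊔ ∣B∣ ℕ.⊔ ∣C∣) ∣D∣ ⊔≤max))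

-- Equality of integers is decidable, so the refutation yields an actual non-zero frequency.
≢0-of-four : ∀ p q r s → (p ≡ 0ℤ → q ≡ 0ℤ → r ≡ 0ℤ → s ≡ 0ℤ → ⊥) →
             p ≢ 0ℤ ⊎ q ≢ 0ℤ ⊎ r ≢ 0ℤ ⊎ s ≢ 0ℤ
≢0-of-four p q r s ¬all with p ℤ.≟ 0ℤ | q ℤ.≟ 0ℤ | r ℤ.≟ 0ℤ | s ℤ.≟ 0ℤ
... | no p≢0  | _       | _       | _       = inj₁ p≢0
... | yes _   | no q≢0  | _       | _       = inj₂ (inj₁ q≢0)
... | yes _   | yes _   | no r≢0  | _       = inj₂ (inj₂ (inj₁ r≢0))
... | yes _   | yes _   | yes _   | no s≢0  = inj₂ (inj₂ (inj₂ s≢0))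
... | yes p≡0 | yes q≡0 | yes r≡0 | yes s≡0 = ⊥-elim (¬all p≡0 q≡0 r≡0 s≡0)

-- Unfolds to a factor of the summand in the theorem, so the vanishing of its sums carries over
-- without rearrangement.
wave : ℝ → (l : ℕ) .{{_ : NonZero l}} → ℤ → ℕ → ℂ
wave π l p m = exp[𝕚 angle π p l *ℝ fromℕ m ]

module _ {π : ℝ} (isPi : IsPi π) {n : ℕ} {z′ : Integerization n}
         (separates : SeparatesFromZero π z′) (l : ℕ) .{{_ : NonZero l}}
         (max<l : maximalMaximum z′ ℕ.< l) where

  ∑wave≈0 : ∀ p → ℤ.∣ p ∣ ℕ.≤ maximalMaximum z′ → p ≢ 0ℤ → ∑₁ l (wave π l p) ≈ 0ℂ
  ∑wave≈0 p p≤max p≢0 = ∑₁-exp𝕚-angle≈0 isPi p l p≢0 (ℕ.≤-<-trans p≤max max<l)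

  ∑₁⁴-waves≈0 : ∀ k → ∑₁⁴ l (λ m₁ m₂ m₃ m₄ →
    wave π l (z′A z′ k) m₁ *ℂ wave π l (z′B z′ k) m₂ *ℂ wave π l (z′C z′ k) m₃ *ℂ wave π l (z′D z′ k) m₄) ≈ 0ℂ
  ∑₁⁴-waves≈0 k = ∑₁⁴-product≈0
    (wave π l (z′A z′ k)) (wave π l (z′B z′ k)) (wave π l (z′C z′ k)) (wave π l (z′D z′ k)) l
    (Sum.map (∑wave≈0 (z′A z′ k) (∣z′A∣≤max z′ k))
      (Sum.map (∑wave≈0 (z′B z′ k) (∣z′B∣≤max z′ k))
        (Sum.map (∑wave≈0 (z′C z′ k) (∣z′C∣≤max z′ k)) (∑wave≈0 (z′D z′ k) (∣z′D∣≤max z′ k))))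
      (≢0-of-four (z′A z′ k) (z′B z′ k) (z′C z′ k) (z′D z′ k) (¬all-frequencies≡0 {π} {n} {z′} separates k)))

-- Exponents of the logical formula

-- `σ` is the only non-zero exponent allowed and `Q` the set of variables that may carry it;
-- recording `Q` is what lets disjointness be checked when factors are multiplied.
Supported : ∀ {n} → ℤ → (Fin n → Set) → Laurent n → Set
Supported σ Q = All λ (q , e) → ∀ j → Vec.lookup e j ≡ 0ℤ ⊎ (Q j × Vec.lookup e j ≡ σ)

lookup-replicate[]≔ : ∀ {n} (a : Fin n) (i : ℤ) j →
  Vec.lookup (Vec.replicate n 0ℤ Vec.[ a ]≔ i) j ≡ 0ℤ ⊎
  (j ≡ a × Vec.lookup (Vec.replicate n 0ℤ Vec.[ a ]≔ i) j ≡ i)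
lookup-replicate[]≔ {n} a i j with j Fin.≟ a
... | yes refl = inj₂ (refl , Vec.lookup∘update a (Vec.replicate n 0ℤ) i)
... | no j≢a   = inj₁ (trans (Vec.lookup∘update′ j≢a (Vec.replicate n 0ℤ) i) (Vec.lookup-replicate j 0ℤ))

all-cartesianProductWith : ∀ {A B C : Set} {P : A → Set} {Q : B → Set} {R : C → Set} (f : A → B → C) →
  (∀ x y → P x → Q y → R (f x y)) → ∀ {xs ys} → All P xs → All Q ys →
  All R (List.cartesianProductWith f xs ys)
all-cartesianProductWith f pres []         qys = []
all-cartesianProductWith f pres (px ∷ pxs) qys =
  All.++⁺ (All.map⁺ (All.map (pres _ _ px) qys)) (all-cartesianProductWith f pres pxs qys)

module _ {n : ℕ} {σ : ℤ} where

  supported-⊆ : ∀ {Q R : Fin n → Set} {f} → (∀ j → Q j → R j) → Supported σ Q f → Supported σ R f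
  supported-⊆ {Q} {R} Q⊆R = All.map (λ {t} → widen t)
    where
    widen : ∀ (t : ℚ × Vec ℤ n) → (∀ j → Vec.lookup (proj₂ t) j ≡ 0ℤ ⊎ (Q j × Vec.lookup (proj₂ t) j ≡ σ)) →
            ∀ j → Vec.lookup (proj₂ t) j ≡ 0ℤ ⊎ (R j × Vec.lookup (proj₂ t) j ≡ σ)
    widen t e j with e j
    ... | inj₁ ≡0       = inj₁ ≡0
    ... | inj₂ (q , ≡σ) = inj₂ (Q⊆R j q , ≡σ)

  supported-const : ∀ {Q : Fin n → Set} q → Supported σ Q (const q)
  supported-const q = (λ j → inj₁ (Vec.lookup-replicate j 0ℤ)) ∷ []

  -- Disjointness prevents two exponents `σ` from meeting in one variable and adding up to twice
  -- `σ`.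
  supported-* : ∀ {Q R : Fin n → Set} {f g} → (∀ j → Q j → R j → ⊥) →
    Supported σ Q f → Supported σ R g → Supported σ (λ j → Q j ⊎ R j) (f *ᴸ g)
  supported-* {Q} {R} disjoint = all-cartesianProductWith _ add
    where
    add : ∀ (s t : ℚ × Vec ℤ n) →
      (∀ j → Vec.lookup (proj₂ s) j ≡ 0ℤ ⊎ (Q j × Vec.lookup (proj₂ s) j ≡ σ)) →
      (∀ j → Vec.lookup (proj₂ t) j ≡ 0ℤ ⊎ (R j × Vec.lookup (proj₂ t) j ≡ σ)) →
      ∀ j → Vec.lookup (Vec.zipWith ℤ._+_ (proj₂ s) (proj₂ t)) j ≡ 0ℤ ⊎
            ((Q j ⊎ R j) × Vec.lookup (Vec.zipWith ℤ._+_ (proj₂ s) (proj₂ t)) j ≡ σ)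
    add s t e d j rewrite Vec.lookup-zipWith ℤ._+_ j (proj₂ s) (proj₂ t) with e j | d j
    ... | inj₁ e≡0       | inj₁ d≡0       = inj₁ (cong₂ ℤ._+_ e≡0 d≡0)
    ... | inj₁ e≡0       | inj₂ (r , d≡σ) = inj₂ (inj₂ r , trans (cong₂ ℤ._+_ e≡0 d≡σ) (ℤ.+-identityˡ σ))
    ... | inj₂ (q , e≡σ) | inj₁ d≡0       = inj₂ (inj₁ q , trans (cong₂ ℤ._+_ e≡σ d≡0) (ℤ.+-identityʳ σ))
    ... | inj₂ (q , _)   | inj₂ (r , _)   = ⊥-elim (disjoint j q r)

  supported-const-* : ∀ {Q : Fin n → Set} q {f} → Supported σ Q f → Supported σ Q (const q *ᴸ f)
  supported-const-* {Q} q supp = supported-⊆ (λ { j (inj₂ qj) → qj })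
    (supported-* {λ _ → ⊥} {Q} (λ _ ()) (supported-const q) supp)

  supported-∏ : ∀ {k} (Q : Fin k → Fin n → Set) {F : Fin k → Laurent n} →
    (∀ c c′ j → Q c j → Q c′ j → c ≡ c′) → (∀ c → Supported σ (Q c) (F c)) →
    Supported σ (λ j → ∃ λ c → Q c j) (∏ᴸ F)
  supported-∏ {zero}  Q disjoint supp = supported-const 1ℚ
  supported-∏ {suc k} Q disjoint supp = supported-⊆
    (λ { j (inj₁ q) → zero , q ; j (inj₂ (c , q)) → suc c , q })
    (supported-* (λ { j q (c , q′) → Fin.0≢1+n (disjoint zero (suc c) j q q′) }) (supp zero)
      (supported-∏ (Q ∘ suc) (λ c c′ j q q′ → Fin.suc-injective (disjoint (suc c) (suc c′) j q q′))
        (supp ∘ suc)))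

supported-X : ∀ {n} (a : Fin n) → Supported 1ℤ (_≡ a) (X a)
supported-X a = lookup-replicate[]≔ a 1ℤ ∷ []

supported-X⁻¹ : ∀ {n} (a : Fin n) → Supported -1ℤ (_≡ a) (X⁻¹ a)
supported-X⁻¹ a = lookup-replicate[]≔ a -1ℤ ∷ []

-- Each exponent comes with its digit in `Fin 3`, from which `funToFin` computes the index `k`.
Admissible : ∀ {n} → Laurent n → Set
Admissible = All λ (q , e) → ∀ j → ∃ λ t → Vec.lookup e j ≡ digit t

-- The two supports may overlap: where both factors contribute, 1 and -1 cancel to 0.
admissible-* : ∀ {n} {Q R : Fin n → Set} {f g} →
  Supported 1ℤ Q f → Supported -1ℤ R g → Admissible (f *ᴸ g)
admissible-* {n} {Q} {R} = all-cartesianProductWith _ add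
  where
  add : ∀ (s t : ℚ × Vec ℤ n) →
    (∀ j → Vec.lookup (proj₂ s) j ≡ 0ℤ ⊎ (Q j × Vec.lookup (proj₂ s) j ≡ 1ℤ)) →
    (∀ j → Vec.lookup (proj₂ t) j ≡ 0ℤ ⊎ (R j × Vec.lookup (proj₂ t) j ≡ -1ℤ)) →
    ∀ j → ∃ λ i → Vec.lookup (Vec.zipWith ℤ._+_ (proj₂ s) (proj₂ t)) j ≡ digit i
  add s t e d j rewrite Vec.lookup-zipWith ℤ._+_ j (proj₂ s) (proj₂ t) with e j | d j
  ... | inj₁ e≡0       | inj₁ d≡0       = zero , cong₂ ℤ._+_ e≡0 d≡0
  ... | inj₁ e≡0       | inj₂ (_ , d≡σ) = suc (suc zero) , cong₂ ℤ._+_ e≡0 d≡σ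
  ... | inj₂ (_ , e≡σ) | inj₁ d≡0       = suc zero , cong₂ ℤ._+_ e≡σ d≡0
  ... | inj₂ (_ , e≡σ) | inj₂ (_ , d≡σ) = zero , cong₂ ℤ._+_ e≡σ d≡σ

lookup-injective : ∀ {A : Set} {xs : List A} → Unique xs →
                   ∀ i j → List.lookup xs i ≡ List.lookup xs j → i ≡ j
lookup-injective {xs = _ ∷ _} _          zero    zero    _  = refl
lookup-injective {xs = _ ∷ _} (x≢ ∷ _)   zero    (suc j) eq = ⊥-elim (All.lookup x≢ (∈-lookup j) eq)
lookup-injective {xs = _ ∷ _} (x≢ ∷ _)   (suc i) zero    eq = ⊥-elim (All.lookup x≢ (∈-lookup i) (sym eq))
lookup-injective {xs = _ ∷ _} (_ ∷ uniq) (suc i) (suc j) eq = cong suc (lookup-injective uniq i j eq)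

module _ {M N : ℕ} (φ : CNF M N) where
  open CNF φ

  supported-clause : ∀ (c : Fin M) → Supported 1ℤ (λ j → ∃ λ i → j ≡ combine c i)
    ((X (combine c zero) +ᴸ const (ℚ.- 1ℚ)) *ᴸ (X (combine c (suc zero)) +ᴸ const (ℚ.- 1ℚ))
      *ᴸ (X (combine c (suc (suc zero))) +ᴸ const (ℚ.- 1ℚ)) +ᴸ const (+ 8 ℚ./ 1))
  supported-clause c = All.++⁺
    (supported-⊆ (λ { j (inj₁ (inj₁ eq)) → zero , eq
                    ; j (inj₁ (inj₂ eq)) → suc zero , eq
                    ; j (inj₂ eq)        → suc (suc zero) , eq })
      (supported-*
        (λ { j (inj₁ eq) eq′ → distinct zero (suc (suc zero)) (λ ()) (trans (sym eq) eq′)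
           ; j (inj₂ eq) eq′ → distinct (suc zero) (suc (suc zero)) (λ ()) (trans (sym eq) eq′) })
        (supported-* (λ j eq eq′ → distinct zero (suc zero) (λ ()) (trans (sym eq) eq′))
          (factor zero) (factor (suc zero)))
        (factor (suc (suc zero)))))
    (supported-const (+ 8 ℚ./ 1))
    where
    factor : ∀ i → Supported 1ℤ (_≡ combine c i) (X (combine c i) +ᴸ const (ℚ.- 1ℚ))
    factor i = All.++⁺ (supported-X (combine c i)) (supported-const (ℚ.- 1ℚ))
    distinct : ∀ (i i′ : Fin 3) → i ≢ i′ → combine c i ≡ combine c i′ → ⊥
    distinct i i′ i≢i′ eq = i≢i′ (Fin.combine-injectiveʳ c i c i′ eq)

  occurrence-injective : ∀ s t t′ → occurrence s t ≡ occurrence s t′ → t ≡ t′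
  occurrence-injective s = lookup-injective
    (Unique.filter⁺ (λ a → var a Fin.≟ s) (Unique.allFin⁺ (M ℕ.* 3)))

  var-occurrence : ∀ s t → var (occurrence s t) ≡ s
  var-occurrence s t =
    All.lookup (All.all-filter (λ a → var a Fin.≟ s) (List.allFin (M ℕ.* 3))) (∈-lookup t)

  -- With `η` arbitrary, one lemma serves the products with `ε s` and with its negative. Both have
  -- the same support, so their sum, a concatenation of lists of terms, has it too.
  supported-literals : ∀ s (η : Fin (r s) → ℚ) → Supported -1ℤ (λ j → var j ≡ s)
    (∏ᴸ (λ t → const (η t) *ᴸ X⁻¹ (occurrence s t) +ᴸ const 1ℚ))
  supported-literals s η = supported-⊆ (λ { j (t , refl) → var-occurrence s t })
    (supported-∏ (λ t → _≡ occurrence s t)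
      (λ t t′ j eq eq′ → occurrence-injective s t t′ (trans (sym eq) eq′))
      (λ t → All.++⁺ (supported-const-* (η t) (supported-X⁻¹ (occurrence s t))) (supported-const 1ℚ)))

  logicalFormula-admissible : Admissible (logicalFormula φ)
  logicalFormula-admissible = All.++⁺
    (admissible-*
      -- `*ᴸ` associates to the left, so the rational prefactor belongs to the clause product.
      (supported-const-* (ℚ._/_ (+ 1) (2 ℕ.^ (6 ℕ.* M ℕ.∸ 1)) {{ℕ.m^n≢0 2 (6 ℕ.* M ℕ.∸ 1)}})
        (supported-∏ (λ c j → ∃ λ i → j ≡ combine c i)
        (λ { c c′ j (i , eq) (i′ , eq′) → Fin.combine-injectiveˡ c i c′ i′ (trans (sym eq) eq′) })
        supported-clause))
      (supported-∏ (λ s j → var j ≡ s) (λ s s′ j eq eq′ → trans (sym eq) eq′)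
        (λ s → All.++⁺ (supported-literals s (ε s)) (supported-literals s (λ t → ℚ.- ε s t)))))
    -- The final summand -1, whose exponents are all 0.
    ((λ j → zero , Vec.lookup-replicate j 0ℤ) ∷ [])

-- Monomials as points of the unit circle

exp𝕚-^ℂ : ∀ z θ → z ≈ exp[𝕚 θ ] → ∀ k → z ^ℂ k ≈ exp[𝕚 θ *ℝ fromℕ k ]
exp𝕚-^ℂ z θ z≈ zero    = ≈.sym (exp𝕚-*-0 θ)
exp𝕚-^ℂ z θ z≈ (suc k) = ≈.trans (≈.*-cong z≈ (exp𝕚-^ℂ z θ z≈ k)) (≈.sym (exp𝕚-*-suc θ k))

-- A negative power is a positive power of `inverse u`, which uniqueness of inverses identifies with
-- the point at angle `-ℝ θ`.
exp𝕚-^ℤ : ∀ u θ → value u ≈ exp[𝕚 θ ] → ∀ i → u ^ℤ i ≈ exp[𝕚 θ *ℝ fromℤ i ]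
exp𝕚-^ℤ u θ u≈ (+ k)    = exp𝕚-^ℂ (value u) θ u≈ k
exp𝕚-^ℤ u θ u≈ -[1+ k ] = ≈.trans (exp𝕚-^ℂ (inverse u) (-ℝ θ) inverse≈ (suc k))
  (exp𝕚-cong { -ℝ θ *ℝ fromℕ (suc k)} {θ *ℝ fromℤ -[1+ k ]}
    (λ n → trans (sym (ℚ.neg-distribˡ-* (approx θ n) (+ suc k ℚ./ 1)))
                 (ℚ.neg-distribʳ-* (approx θ n) (+ suc k ℚ./ 1))))
  where
  open SetoidReasoning ≈.setoid
  inverse≈ : inverse u ≈ exp[𝕚 -ℝ θ ]
  inverse≈ = begin
    inverse u                                      ≈⟨ ≈.*-identityʳ (inverse u) ⟨
    inverse u *ℂ 1ℂ                                ≈⟨ ≈.*-congˡ (exp𝕚-inverse θ) ⟨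
    inverse u *ℂ (exp[𝕚 θ ] *ℂ exp[𝕚 -ℝ θ ])       ≈⟨ ≈.*-congˡ (≈.*-congʳ u≈) ⟨
    inverse u *ℂ (value u *ℂ exp[𝕚 -ℝ θ ])         ≈⟨ ≈.*-assoc _ _ _ ⟨
    inverse u *ℂ value u *ℂ exp[𝕚 -ℝ θ ]           ≈⟨ ≈.*-congʳ (≈.*-comm _ _) ⟩
    value u *ℂ inverse u *ℂ exp[𝕚 -ℝ θ ]           ≈⟨ ≈.*-congʳ (asymptotic (isInverse u)) ⟩
    1ℂ *ℂ exp[𝕚 -ℝ θ ]                             ≈⟨ ≈.*-identityˡ _ ⟩
    exp[𝕚 -ℝ θ ]                                   ∎

-- `frequencyℤ a k` unfolds to `dot (exponents k) a`; arbitrary exponent vectors admit the induction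
-- on `n` that the index `k` does not.
dot : ∀ {n} → (Fin n → ℤ) → (Fin n → ℤ) → ℤ
dot e a = foldr ℤ._+_ 0ℤ λ j → e j ℤ.* a j

dot-cong : ∀ {n} {e e′ : Fin n → ℤ} → (∀ j → e j ≡ e′ j) → ∀ a → dot e a ≡ dot e′ a
dot-cong {zero}  e≡ a = refl
dot-cong {suc n} e≡ a = cong₂ ℤ._+_ (cong (ℤ._* a zero) (e≡ zero)) (dot-cong (e≡ ∘ suc) (a ∘ suc))

monomial : ∀ {n} → (Fin n → ℂˣ) → (Fin n → ℤ) → ℂ
monomial x e = foldr _*ℂ_ 1ℂ λ j → x j ^ℤ e j

monomial-0 : ∀ {n} (x : Fin n → ℂˣ) {e} → (∀ j → e j ≡ 0ℤ) → monomial x e ≈ 1ℂ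
monomial-0 {zero}  x e≡0 = ≈.refl
monomial-0 {suc n} x e≡0 = ≈.trans
  (≈.*-cong (≈.reflexive (cong (x zero ^ℤ_) (e≡0 zero))) (monomial-0 (x ∘ suc) (e≡0 ∘ suc)))
  (≈.*-identityˡ 1ℂ)

module _ (x y z w : ℝ) where

  phase : ℤ → ℤ → ℤ → ℤ → ℝ
  phase a b c d = fromℤ a *ℝ x +ℝ fromℤ b *ℝ y +ℝ fromℤ c *ℝ z +ℝ fromℤ d *ℝ w

  -- On the left, the angle of one variable raised to the power `e` plus the angle of the remaining
  -- monomial; on the right, the shape to which `dot` unfolds.
  phase-affine : ∀ e a b c d a′ b′ c′ d′ n →
    approx (phase a b c d *ℝ fromℤ e +ℝ phase a′ b′ c′ d′) n ≡
    approx (phase (e ℤ.* a ℤ.+ a′) (e ℤ.* b ℤ.+ b′) (e ℤ.* c ℤ.+ c′) (e ℤ.* d ℤ.+ d′)) n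
  phase-affine e a b c d a′ b′ c′ d′ n = trans
    (collect (e ℚ./ 1)
      ((a ℚ./ 1) ℚ.* approx x n) ((b ℚ./ 1) ℚ.* approx y n)
      ((c ℚ./ 1) ℚ.* approx z n) ((d ℚ./ 1) ℚ.* approx w n)
      ((a′ ℚ./ 1) ℚ.* approx x n) ((b′ ℚ./ 1) ℚ.* approx y n)
      ((c′ ℚ./ 1) ℚ.* approx z n) ((d′ ℚ./ 1) ℚ.* approx w n))
    (cong₂ ℚ._+_ (cong₂ ℚ._+_ (cong₂ ℚ._+_
      (affine a a′ (approx x n)) (affine b b′ (approx y n)))
      (affine c c′ (approx z n))) (affine d d′ (approx w n)))
    where
    open +-*-Solver
    collect : ∀ e s t u v s′ t′ u′ v′ →
      (s ℚ.+ t ℚ.+ u ℚ.+ v) ℚ.* e ℚ.+ (s′ ℚ.+ t′ ℚ.+ u′ ℚ.+ v′) ≡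
      (s ℚ.* e ℚ.+ s′) ℚ.+ (t ℚ.* e ℚ.+ t′) ℚ.+ (u ℚ.* e ℚ.+ u′) ℚ.+ (v ℚ.* e ℚ.+ v′)
    collect = solve 9 (λ e s t u v s′ t′ u′ v′ →
      (s :+ t :+ u :+ v) :* e :+ (s′ :+ t′ :+ u′ :+ v′) :=
      (s :* e :+ s′) :+ (t :* e :+ t′) :+ (u :* e :+ u′) :+ (v :* e :+ v′)) refl
    factor : ∀ e a a′ p → a ℚ.* p ℚ.* e ℚ.+ a′ ℚ.* p ≡ (e ℚ.* a ℚ.+ a′) ℚ.* p
    factor = solve 4 (λ e a a′ p → a :* p :* e :+ a′ :* p := (e :* a :+ a′) :* p) refl
    affine : ∀ a a′ p → (a ℚ./ 1) ℚ.* p ℚ.* (e ℚ./ 1) ℚ.+ (a′ ℚ./ 1) ℚ.* p ≡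
                        ((e ℤ.* a ℤ.+ a′) ℚ./ 1) ℚ.* p
    affine a a′ p = trans (factor (e ℚ./ 1) (a ℚ./ 1) (a′ ℚ./ 1) p)
      (cong (ℚ._* p) (sym (trans (/1-homo-+ (e ℤ.* a) a′)
        (cong (ℚ._+ (a′ ℚ./ 1)) (/1-homo-* e a)))))

  monomial≈exp𝕚 : ∀ {n} (u : Fin n → ℂˣ) (a b c d : Fin n → ℤ) →
    (∀ j → value (u j) ≈ exp[𝕚 phase (a j) (b j) (c j) (d j) ]) → ∀ e →
    monomial u e ≈ exp[𝕚 phase (dot e a) (dot e b) (dot e c) (dot e d) ]
  monomial≈exp𝕚 {zero} u a b c d u≈ e = ≈.sym (exp𝕚-0 {phase 0ℤ 0ℤ 0ℤ 0ℤ}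
    (λ n → vanish (approx x n) (approx y n) (approx z n) (approx w n)))
    where
    open +-*-Solver
    vanish : ∀ p q r s → 0ℚ ℚ.* p ℚ.+ 0ℚ ℚ.* q ℚ.+ 0ℚ ℚ.* r ℚ.+ 0ℚ ℚ.* s ≡ 0ℚ
    vanish = solve 4 (λ p q r s →
      con 0ℚ :* p :+ con 0ℚ :* q :+ con 0ℚ :* r :+ con 0ℚ :* s := con 0ℚ) refl
  monomial≈exp𝕚 {suc n} u a b c d u≈ e = begin
    u zero ^ℤ e zero *ℂ monomial (u ∘ suc) (e ∘ suc)
      ≈⟨ ≈.*-cong (exp𝕚-^ℤ (u zero) θ (u≈ zero) (e zero))
                  (monomial≈exp𝕚 (u ∘ suc) (a ∘ suc) (b ∘ suc) (c ∘ suc) (d ∘ suc) (u≈ ∘ suc) (e ∘ suc)) ⟩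
    exp[𝕚 θ *ℝ fromℤ (e zero) ] *ℂ exp[𝕚 θ′ ]
      ≈⟨ exp𝕚-+ (θ *ℝ fromℤ (e zero)) θ′ ⟨
    exp[𝕚 θ *ℝ fromℤ (e zero) +ℝ θ′ ]
      ≈⟨ exp𝕚-cong {θ *ℝ fromℤ (e zero) +ℝ θ′} {phase (dot e a) (dot e b) (dot e c) (dot e d)}
           (phase-affine (e zero) (a zero) (b zero) (c zero) (d zero) (tail a) (tail b) (tail c) (tail d)) ⟩
    exp[𝕚 phase (dot e a) (dot e b) (dot e c) (dot e d) ] ∎
    where
    open SetoidReasoning ≈.setoid
    tail : (Fin (suc n) → ℤ) → ℤ
    tail a = dot (e ∘ suc) (a ∘ suc)
    θ = phase (a zero) (b zero) (c zero) (d zero)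
    θ′ = phase (tail a) (tail b) (tail c) (tail d)

gridPoint : ℝ → (l : ℕ) .{{_ : NonZero l}} → ℕ → ℝ
gridPoint π l m = (fromℕ 2 *ℝ π) /ℝ l *ℝ fromℕ m

exp𝕚-phase≈waves : ∀ π l .{{_ : NonZero l}} p q r s m₁ m₂ m₃ m₄ →
  exp[𝕚 phase (gridPoint π l m₁) (gridPoint π l m₂) (gridPoint π l m₃) (gridPoint π l m₄) p q r s ] ≈
  wave π l p m₁ *ℂ wave π l q m₂ *ℂ wave π l r m₃ *ℂ wave π l s m₄
exp𝕚-phase≈waves π l p q r s m₁ m₂ m₃ m₄ = ≈.trans (exp𝕚-+ (P +ℝ Q +ℝ R) S)
  (≈.*-cong (≈.trans (exp𝕚-+ (P +ℝ Q) R)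
    (≈.*-cong (≈.trans (exp𝕚-+ P Q) (≈.*-cong (toWave p m₁) (toWave q m₂))) (toWave r m₃))) (toWave s m₄))
  where
  P = fromℤ p *ℝ gridPoint π l m₁
  Q = fromℤ q *ℝ gridPoint π l m₂
  R = fromℤ r *ℝ gridPoint π l m₃
  S = fromℤ s *ℝ gridPoint π l m₄
  rearrange : ∀ p t i m → p ℚ.* ((t ℚ.* i) ℚ.* m) ≡ ((t ℚ.* p) ℚ.* i) ℚ.* m
  rearrange = solve 4 (λ p t i m → p :* ((t :* i) :* m) := ((t :* p) :* i) :* m) refl
    where open +-*-Solver
  toWave : ∀ p m → exp[𝕚 fromℤ p *ℝ gridPoint π l m ] ≈ wave π l p m
  toWave p m = exp𝕚-cong {fromℤ p *ℝ gridPoint π l m} {angle π p l *ℝ fromℕ m}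
    (λ n → rearrange (p ℚ./ 1) ((+ 2 ℚ./ 1) ℚ.* approx π n) (+ 1 ℚ./ l) (+ m ℚ./ 1))

toℕ-funToFin-0 : ∀ {n} → Fin.toℕ (funToFin {n} {3} (λ _ → zero)) ≡ 0
toℕ-funToFin-0 {zero}  = refl
toℕ-funToFin-0 {suc n} = trans (Fin.toℕ-combine {3} zero (funToFin {n} {3} (λ _ → zero)))
  (trans (cong (ℕ._+ Fin.toℕ (funToFin {n} {3} (λ _ → zero))) (ℕ.*-zeroʳ (3 ℕ.^ n))) (toℕ-funToFin-0 {n}))

-- `funToFin` inverts the reading of digits, and only the zero vector has code 0. The cast from
-- `3 ^ n` to a successor lets the code be split into 0 and `suc k`, where `k` is the index sought.
exponents-surjective : ∀ {n} (t : Fin n → Fin 3) →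
  (∀ j → t j ≡ zero) ⊎ (∃ λ k → ∀ j → digit (t j) ≡ exponents k j)
exponents-surjective {n} t = split (Fin.cast (sym 3^n≡) i) refl
  where
  3^n≡ : suc (3 ℕ.^ n ℕ.∸ 1) ≡ 3 ℕ.^ n
  3^n≡ = ℕ.suc-pred (3 ℕ.^ n) {{ℕ.m^n≢0 3 n}}
  i = funToFin t
  split : ∀ i′ → Fin.cast (sym 3^n≡) i ≡ i′ →
    (∀ j → t j ≡ zero) ⊎ (∃ λ k → ∀ j → digit (t j) ≡ exponents k j)
  split zero cast≡0 = inj₁ λ j → trans (sym (Fin.finToFun-funToFin t j))
    (trans (cong (λ i → finToFun i j) i≡0) (Fin.finToFun-funToFin {n} {3} (λ _ → zero) j))
    where
    i≡0 : i ≡ funToFin {n} {3} (λ _ → zero)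
    i≡0 = Fin.toℕ-injective (trans (sym (Fin.toℕ-cast (sym 3^n≡) i))
      (trans (cong Fin.toℕ cast≡0) (sym (toℕ-funToFin-0 {n}))))
  split (suc k) cast≡k = inj₂ (k , λ j → cong digit (trans (sym (Fin.finToFun-funToFin t j))
    (cong (λ i → finToFun i j)
      (trans (sym (Fin.cast-involutive 3^n≡ (sym 3^n≡) i)) (cong (Fin.cast 3^n≡) cast≡k)))))

lookup-≡0⇒replicate : ∀ {n} (e : Vec ℤ n) → (∀ j → Vec.lookup e j ≡ 0ℤ) → e ≡ Vec.replicate n 0ℤ
lookup-≡0⇒replicate Vec.[]      _   = refl
lookup-≡0⇒replicate (i Vec.∷ e) e≡0 = cong₂ Vec._∷_ (e≡0 zero) (lookup-≡0⇒replicate e (e≡0 ∘ suc))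

coefficient-≡ : ∀ {n} {e d : Vec ℤ n} q f → d ≡ e → coefficient e ((q , d) ∷ f) ≡ q ℚ.+ coefficient e f
coefficient-≡ {e = e} {d} q f d≡e = cong (λ b → if b then q ℚ.+ coefficient e f else coefficient e f)
  (dec-true (Vec.≡-dec ℤ._≟_ d e) d≡e)

coefficient-≢ : ∀ {n} {e d : Vec ℤ n} q f → d ≢ e → coefficient e ((q , d) ∷ f) ≡ coefficient e f
coefficient-≢ {e = e} {d} q f d≢e = cong (λ b → if b then q ℚ.+ coefficient e f else coefficient e f)
  (dec-false (Vec.≡-dec ℤ._≟_ d e) d≢e)

∑₁-0 : ∀ l → ∑₁ l (λ _ → 0ℂ) ≈ 0ℂ
∑₁-0 zero    = ≈.refl
∑₁-0 (suc l) = ≈.trans (≈.+-congʳ (∑₁-0 l)) (≈.+-identityʳ 0ℂ)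

-- The summand is a natural number so that four nested uses produce `l * (l * (l * (l * 1)))`, which
-- is how `l ^ 4` unfolds.
∑₁-const : ∀ c l → ∑₁ l (λ _ → ofℚ (+ c ℚ./ 1)) ≈ ofℚ (+ (l ℕ.* c) ℚ./ 1)
∑₁-const c zero    = ≈.refl
∑₁-const c (suc l) = begin
  ∑₁ l (λ _ → ofℚ (+ c ℚ./ 1)) +ℂ ofℚ (+ c ℚ./ 1)   ≈⟨ ≈.+-congʳ (∑₁-const c l) ⟩
  ofℚ (+ (l ℕ.* c) ℚ./ 1) +ℂ ofℚ (+ c ℚ./ 1)        ≈⟨ ≈.+-comm _ _ ⟩
  ofℚ (+ c ℚ./ 1) +ℂ ofℚ (+ (l ℕ.* c) ℚ./ 1)        ≈⟨ ≐⇒≈ (ofℚ-homo-+ (+ c ℚ./ 1) (+ (l ℕ.* c) ℚ./ 1)) ⟨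
  ofℚ ((+ c ℚ./ 1) ℚ.+ (+ (l ℕ.* c) ℚ./ 1))         ≡⟨ cong ofℚ (/1-homo-+ (+ c) (+ (l ℕ.* c))) ⟨
  ofℚ (+ (suc l ℕ.* c) ℚ./ 1)                       ∎
  where open SetoidReasoning ≈.setoid

∑₁⁴-0 : ∀ l → ∑₁⁴ l (λ _ _ _ _ → 0ℂ) ≈ 0ℂ
∑₁⁴-0 l = ≈.trans (∑₁-cong (λ _ → ≈.trans (∑₁-cong (λ _ → ≈.trans (∑₁-cong (λ _ → ∑₁-0 l) l)
  (∑₁-0 l)) l) (∑₁-0 l)) l) (∑₁-0 l)

∑₁⁴-1 : ∀ l → ∑₁⁴ l (λ _ _ _ _ → 1ℂ) ≈ ofℚ (+ (l ℕ.^ 4) ℚ./ 1)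
∑₁⁴-1 l = ≈.trans (∑₁-cong (λ _ → ≈.trans (∑₁-cong (λ _ → ≈.trans (∑₁-cong (λ _ → ∑₁-const 1 l) l)
  (∑₁-const (l ℕ.^ 1) l)) l) (∑₁-const (l ℕ.^ 2) l)) l) (∑₁-const (l ℕ.^ 3) l)

-- Summing a Laurent polynomial over the grid

module _ {π : ℝ} (isPi : IsPi π) {n : ℕ} {z′ : Integerization n}
         (separates : SeparatesFromZero π z′) (l : ℕ) .{{_ : NonZero l}}
         (max<l : maximalMaximum z′ ℕ.< l)
         (u : ℕ → ℕ → ℕ → ℕ → Fin n → ℂˣ)
         (u≈ : ∀ m₁ m₂ m₃ m₄ j → value (u m₁ m₂ m₃ m₄ j) ≈
           exp[𝕚 phase (gridPoint π l m₁) (gridPoint π l m₂) (gridPoint π l m₃) (gridPoint π l m₄)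
                       (z′a z′ j) (z′b z′ j) (z′c z′ j) (z′d z′ j) ]) where

  private
    l⁴ : ℚ
    l⁴ = + (l ℕ.^ 4) ℚ./ 1

    monomials : Vec ℤ n → ℕ → ℕ → ℕ → ℕ → ℂ
    monomials e m₁ m₂ m₃ m₄ = monomial (u m₁ m₂ m₃ m₄) (Vec.lookup e)

  monomials≈waves : ∀ e k → (∀ j → Vec.lookup e j ≡ exponents k j) → ∀ m₁ m₂ m₃ m₄ →
    monomials e m₁ m₂ m₃ m₄ ≈ wave π l (z′A z′ k) m₁ *ℂ wave π l (z′B z′ k) m₂
                               *ℂ wave π l (z′C z′ k) m₃ *ℂ wave π l (z′D z′ k) m₄
  monomials≈waves e k e≡ m₁ m₂ m₃ m₄ = begin
    monomials e m₁ m₂ m₃ m₄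
      ≈⟨ monomial≈exp𝕚 (gridPoint π l m₁) (gridPoint π l m₂) (gridPoint π l m₃) (gridPoint π l m₄)
           (u m₁ m₂ m₃ m₄) (z′a z′) (z′b z′) (z′c z′) (z′d z′) (u≈ m₁ m₂ m₃ m₄) (Vec.lookup e) ⟩
    exp[𝕚 phase (gridPoint π l m₁) (gridPoint π l m₂) (gridPoint π l m₃) (gridPoint π l m₄) a b c d ]
      ≈⟨ exp𝕚-phase≈waves π l a b c d m₁ m₂ m₃ m₄ ⟩
    wave π l a m₁ *ℂ wave π l b m₂ *ℂ wave π l c m₃ *ℂ wave π l d m₄
      ≡⟨ cong₂ _*ℂ_ (cong₂ _*ℂ_ (cong₂ _*ℂ_ (wave≡ (z′a z′) m₁) (wave≡ (z′b z′) m₂))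
           (wave≡ (z′c z′) m₃)) (wave≡ (z′d z′) m₄) ⟩
    wave π l (z′A z′ k) m₁ *ℂ wave π l (z′B z′ k) m₂ *ℂ wave π l (z′C z′ k) m₃ *ℂ wave π l (z′D z′ k) m₄ ∎
    where
    open SetoidReasoning ≈.setoid
    a = dot (Vec.lookup e) (z′a z′)
    b = dot (Vec.lookup e) (z′b z′)
    c = dot (Vec.lookup e) (z′c z′)
    d = dot (Vec.lookup e) (z′d z′)
    wave≡ : ∀ g m → wave π l (dot (Vec.lookup e) g) m ≡ wave π l (frequencyℤ g k) m
    wave≡ g m = cong (λ p → wave π l p m) (dot-cong e≡ g)

  ∑₁⁴-monomials≈0 : ∀ e → (∀ j → ∃ λ t → Vec.lookup e j ≡ digit t) → e ≢ Vec.replicate n 0ℤ →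
                    ∑₁⁴ l (monomials e) ≈ 0ℂ
  ∑₁⁴-monomials≈0 e digits e≢0 = nonconstant (exponents-surjective (λ j → proj₁ (digits j)))
    where
    nonconstant : (∀ j → proj₁ (digits j) ≡ zero) ⊎
                  (∃ λ k → ∀ j → digit (proj₁ (digits j)) ≡ exponents k j) → ∑₁⁴ l (monomials e) ≈ 0ℂ
    nonconstant (inj₁ ≡0) = ⊥-elim (e≢0 (lookup-≡0⇒replicate e
      (λ j → trans (proj₂ (digits j)) (cong digit (≡0 j)))))
    nonconstant (inj₂ (k , digit≡)) = ≈.trans
      (∑₁⁴-cong (monomials≈waves e k (λ j → trans (proj₂ (digits j)) (digit≡ j))) l)
      (∑₁⁴-waves≈0 isPi {n} {z′} separates l max<l k)

  ∑₁⁴-monomials≈l⁴ : ∀ e → e ≡ Vec.replicate n 0ℤ → ∑₁⁴ l (monomials e) ≈ ofℚ l⁴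
  ∑₁⁴-monomials≈l⁴ e refl = ≈.trans
    (∑₁⁴-cong (λ m₁ m₂ m₃ m₄ → monomial-0 (u m₁ m₂ m₃ m₄) (λ j → Vec.lookup-replicate j 0ℤ)) l)
    (∑₁⁴-1 l)

  -- Induction on the list of terms treats repeated exponent vectors one at a time, in the order in
  -- which `constantTerm` collects them.
  ∑₁⁴-eval : ∀ f → Admissible f →
    ∑₁⁴ l (λ m₁ m₂ m₃ m₄ → eval f (u m₁ m₂ m₃ m₄)) ≈ ofℚ (l⁴ ℚ.* constantTerm f)
  ∑₁⁴-eval [] [] = ≈.trans (∑₁⁴-0 l) (≈.reflexive (cong ofℚ (sym (ℚ.*-zeroʳ l⁴))))
  ∑₁⁴-eval ((q , e) ∷ f) (digits ∷ admissible) = begin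
    ∑₁⁴ l (λ m₁ m₂ m₃ m₄ → ofℚ q *ℂ monomials e m₁ m₂ m₃ m₄ +ℂ eval f (u m₁ m₂ m₃ m₄))
      ≈⟨ ∑₁⁴-linear (ofℚ q) (monomials e) (λ m₁ m₂ m₃ m₄ → eval f (u m₁ m₂ m₃ m₄)) l ⟩
    ofℚ q *ℂ ∑₁⁴ l (monomials e) +ℂ ∑₁⁴ l (λ m₁ m₂ m₃ m₄ → eval f (u m₁ m₂ m₃ m₄))
      ≈⟨ ≈.+-congˡ (∑₁⁴-eval f admissible) ⟩
    ofℚ q *ℂ ∑₁⁴ l (monomials e) +ℂ ofℚ (l⁴ ℚ.* C)
      -- The same decision that `coefficient` makes on the head term.
      ≈⟨ term (Vec.≡-dec ℤ._≟_ e (Vec.replicate n 0ℤ)) ⟩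
    ofℚ (l⁴ ℚ.* constantTerm ((q , e) ∷ f)) ∎
    where
    open SetoidReasoning ≈.setoid
    C = constantTerm f
    distribute : ∀ q l C → q ℚ.* l ℚ.+ l ℚ.* C ≡ l ℚ.* (q ℚ.+ C)
    distribute = solve 3 (λ q l C → q :* l :+ l :* C := l :* (q :+ C)) refl
      where open +-*-Solver
    term : Dec (e ≡ Vec.replicate n 0ℤ) →
           ofℚ q *ℂ ∑₁⁴ l (monomials e) +ℂ ofℚ (l⁴ ℚ.* C) ≈ ofℚ (l⁴ ℚ.* constantTerm ((q , e) ∷ f))
    term (yes e≡0) = begin
      ofℚ q *ℂ ∑₁⁴ l (monomials e) +ℂ ofℚ (l⁴ ℚ.* C)
        ≈⟨ ≈.+-congʳ (≈.*-congˡ (∑₁⁴-monomials≈l⁴ e e≡0)) ⟩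
      ofℚ q *ℂ ofℚ l⁴ +ℂ ofℚ (l⁴ ℚ.* C)
        ≈⟨ ≈.+-congʳ (≐⇒≈ (ofℚ-homo-* q l⁴)) ⟨
      ofℚ (q ℚ.* l⁴) +ℂ ofℚ (l⁴ ℚ.* C)
        ≈⟨ ≐⇒≈ (ofℚ-homo-+ (q ℚ.* l⁴) (l⁴ ℚ.* C)) ⟨
      ofℚ (q ℚ.* l⁴ ℚ.+ l⁴ ℚ.* C)
        ≡⟨ cong ofℚ (distribute q l⁴ C) ⟩
      ofℚ (l⁴ ℚ.* (q ℚ.+ C))
        ≡⟨ cong (λ c → ofℚ (l⁴ ℚ.* c)) (coefficient-≡ q f e≡0) ⟨
      ofℚ (l⁴ ℚ.* constantTerm ((q , e) ∷ f)) ∎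
    term (no e≢0) = begin
      ofℚ q *ℂ ∑₁⁴ l (monomials e) +ℂ ofℚ (l⁴ ℚ.* C)
        ≈⟨ ≈.+-congʳ (≈.trans (≈.*-congˡ (∑₁⁴-monomials≈0 e digits e≢0)) (≈.zeroʳ (ofℚ q))) ⟩
      0ℂ +ℂ ofℚ (l⁴ ℚ.* C)
        ≈⟨ ≈.+-identityˡ _ ⟩
      ofℚ (l⁴ ℚ.* C)
        ≡⟨ cong (λ c → ofℚ (l⁴ ℚ.* c)) (coefficient-≢ q f e≢0) ⟨
      ofℚ (l⁴ ℚ.* constantTerm ((q , e) ∷ f)) ∎

open import Data.Nat.Base using (_*_; _∸_; _^_; _<_)

theorem18 : (M N : ℕ) .{{_ : NonZero M}} (φ : CNF M N)
    (π : ℝ) → IsPi π →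
    (z′ : Integerization (M * 3)) → Rounds π z′ → SeparatesFromZero π z′ →
    (l : ℕ) .{{_ : NonZero l}} → maximalMaximum z′ < l →
    ((k : Fin (3 ^ (M * 3) ∸ 1)) →
    ∑₁⁴ l (λ m₁ m₂ m₃ m₄ →
    exp[𝕚 (fromℕ 2 *ℝ π *ℝ fromℤ (z′A z′ k)) /ℝ l *ℝ fromℕ m₁ ]
    *ℂ exp[𝕚 (fromℕ 2 *ℝ π *ℝ fromℤ (z′B z′ k)) /ℝ l *ℝ fromℕ m₂ ]
    *ℂ exp[𝕚 (fromℕ 2 *ℝ π *ℝ fromℤ (z′C z′ k)) /ℝ l *ℝ fromℕ m₃ ]
    *ℂ exp[𝕚 (fromℕ 2 *ℝ π *ℝ fromℤ (z′D z′ k)) /ℝ l *ℝ fromℕ m₄ ])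
    ≃ℂ 0ℂ)
    ×
    ((X : (x y z w : ℝ) → Fin (M * 3) → ℂˣ) →
    (∀ x y z w j → value (X x y z w j) ≃ℂ
    exp[𝕚 fromℤ (z′a z′ j) *ℝ x +ℝ fromℤ (z′b z′ j) *ℝ y
    +ℝ fromℤ (z′c z′ j) *ℝ z +ℝ fromℤ (z′d z′ j) *ℝ w ]) →
    ∑₁⁴ l (λ m₁ m₂ m₃ m₄ → eval (logicalFormula φ)
    (X ((fromℕ 2 *ℝ π) /ℝ l *ℝ fromℕ m₁) ((fromℕ 2 *ℝ π) /ℝ l *ℝ fromℕ m₂)
    ((fromℕ 2 *ℝ π) /ℝ l *ℝ fromℕ m₃) ((fromℕ 2 *ℝ π) /ℝ l *ℝ fromℕ m₄)))
    ≃ℂ ofReal (fromℚ (+ (l ^ 4) ℚ./ 1 ℚ.* constantTerm (logicalFormula φ))))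
theorem18 M N φ π isPi z′ _ separates l max<l =
    (λ k → ≈⇒≃ (∑₁⁴-waves≈0 isPi {M * 3} {z′} separates l max<l k))
  , λ X X≃ → ≈⇒≃ (∑₁⁴-eval isPi {M * 3} {z′} separates l max<l
      (λ m₁ m₂ m₃ m₄ → X (gridPoint π l m₁) (gridPoint π l m₂) (gridPoint π l m₃) (gridPoint π l m₄))
      (λ m₁ m₂ m₃ m₄ j → asymptotic
        (X≃ (gridPoint π l m₁) (gridPoint π l m₂) (gridPoint π l m₃) (gridPoint π l m₄) j))
      (logicalFormula φ) (logicalFormula-admissible φ))
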